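{- Let $n$ be an odd positive integer and let $\Gamma$ be a non-trivial strongly regular $n$-bicirculant. Then for every vertex $x$ of $\Gamma$, the graph $\Gamma$ is not locally $3$-isoregular at $x$.
   Context: All graphs are finite, simple and undirected. A strongly regular graph with parameters $(N,k,\lambda,\mu)$ is a $k$-regular graph on $N$ vertices in which every pair of adjacent vertices has exactly $\lambda$ common neighbours and every pair of distinct non-adjacent vertices has exactly $\mu$ common neighbours; it is non-trivial if both it and its complement are connected. An $n$-bicirculant is a graph on $2n$ vertices admitting an automorphism whose cycle decomposition consists of exactly two cycles, each of length $n$. For a set $T$ of vertices, a neighbour of $T$ is a vertex adjacent to every vertex of $T$, and the valency of $T$ is the number of neighbours of $T$. An ordered pair $(x,y)$ of distinct vertices is called $3$-isoregular if, for all vertices $z\neq x,y$, the valency of $\{x,y,z\}$ depends only on the isomorphism type of the subgraph induced on $\{x,y,z\}$. A graph $\Gamma$ is locally $3$-isoregular at a vertex $x$ if there exist a vertex $y$ adjacent to $x$ and a vertex $z\ne x$ not adjacent to $x$ such that both $(x,y)$ and $(x,z)$ are $3$-isoregular. -}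

module Defs where

open import Data.Nat using (ℕ; zero; suc; _+_; _*_; _<_)
open import Data.Fin using (Fin; zero; suc)
open import Data.Fin.Properties using (_≟_)
open import Data.Fin.Permutation using (Permutation′; _⟨$⟩ʳ_)
open import Data.Bool using (Bool; true; false; _∧_; not)
open import Data.List using (List; []; _∷_; length; filterᵇ)
open import Data.List using () renaming (allFin to allFinL)
open import Data.Product using (Σ; ∃; _×_; _,_)
open import Data.Sum using (_⊎_)
open import Relation.Nullary using (¬_; does)
open import Relation.Binary.PropositionalEquality using (_≡_; _≢_)

allᵇ : {A : Set} → (A → Bool) → List A → Bool
allᵇ p [] = true
allᵇ p (x ∷ xs) = p x ∧ allᵇ p xs

record Graph (N : ℕ) : Set where
  field
    adj    : Fin N → Fin N → Bool
    adj-sym    : ∀ x y → adj x y ≡ adj y x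
    adj-irrefl : ∀ x → adj x x ≡ false
open Graph public

module _ {N : ℕ} (G : Graph N) where

  Adj : Fin N → Fin N → Set
  Adj x y = adj G x y ≡ true

  neighboursOf : List (Fin N) → List (Fin N)
  neighboursOf T = filterᵇ (λ w → allᵇ (λ t → adj G t w) T) (allFinL N)

  valency : List (Fin N) → ℕ
  valency T = length (neighboursOf T)

  degree : Fin N → ℕ
  degree x = valency (x ∷ [])

  compAdj : Fin N → Fin N → Bool
  compAdj x y = not (does (x ≟ y)) ∧ not (adj G x y)

data Reach {N : ℕ} (R : Fin N → Fin N → Bool) : Fin N → Fin N → Set where
  here : ∀ {x} → Reach R x x
  step : ∀ {x y z} → R x y ≡ true → Reach R y z → Reach R x z

ConnectedBy : {N : ℕ} → (Fin N → Fin N → Bool) → Set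
ConnectedBy {N} R = ∀ (x y : Fin N) → Reach R x y

module _ {N : ℕ} (G : Graph N) where

  Connected : Set
  Connected = ConnectedBy (adj G)

  ComplementConnected : Set
  ComplementConnected = ConnectedBy (compAdj G)

  NonTrivial : Set
  NonTrivial = Connected × ComplementConnected

  IsSRG : (k λ' μ : ℕ) → Set
  IsSRG k λ' μ =
    (∀ x → degree G x ≡ k) ×
    (∀ x y → x ≢ y → Adj G x y → valency G (x ∷ y ∷ []) ≡ λ') ×
    (∀ x y → x ≢ y → ¬ Adj G x y → valency G (x ∷ y ∷ []) ≡ μ)

  StronglyRegular : Set
  StronglyRegular = Σ ℕ λ k → Σ ℕ λ λ' → Σ ℕ λ μ → IsSRG k λ' μ

  IsAutomorphism : Permutation′ N → Set
  IsAutomorphism σ = ∀ x y → adj G (σ ⟨$⟩ʳ x) (σ ⟨$⟩ʳ y) ≡ adj G x y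

iterate : {A : Set} → (A → A) → ℕ → A → A
iterate f zero a = a
iterate f (suc i) a = f (iterate f i a)

TwoCyclesOfLength : {N : ℕ} → ℕ → Permutation′ N → Set
TwoCyclesOfLength {N} n σ =
  (∀ v → iterate s n v ≡ v) ×
  (∀ v i → 0 < i → i < n → iterate s i v ≢ v) ×
  Σ (Fin N) λ a → Σ (Fin N) λ b →
    (∀ i → iterate s i a ≢ b) ×
    (∀ v → Σ ℕ λ i → i < n × (v ≡ iterate s i a ⊎ v ≡ iterate s i b))
  where
  s : Fin N → Fin N
  s x = σ ⟨$⟩ʳ x

IsBicirculant : (n : ℕ) → Graph (n + n) → Set
IsBicirculant n G =
  Σ (Permutation′ (n + n)) λ σ → IsAutomorphism G σ × TwoCyclesOfLength n σ

module _ {N : ℕ} (G : Graph N) where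

  triple : Fin N → Fin N → Fin N → Fin 3 → Fin N
  triple x y z zero = x
  triple x y z (suc zero) = y
  triple x y z (suc (suc zero)) = z

  InducedIso : (Fin 3 → Fin N) → (Fin 3 → Fin N) → Set
  InducedIso t t' = Σ (Permutation′ 3) λ π →
    ∀ i j → adj G (t i) (t j) ≡ adj G (t' (π ⟨$⟩ʳ i)) (t' (π ⟨$⟩ʳ j))

  ThreeIsoregular : Fin N → Fin N → Set
  ThreeIsoregular x y =
    x ≢ y ×
    (∀ z z' → z ≢ x → z ≢ y → z' ≢ x → z' ≢ y →
      InducedIso (triple x y z) (triple x y z') →
      valency G (x ∷ y ∷ z ∷ []) ≡ valency G (x ∷ y ∷ z' ∷ []))

  LocallyThreeIsoregular : Fin N → Set
  LocallyThreeIsoregular x =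
    Σ (Fin N) λ y → Σ (Fin N) λ z →
      Adj G x y × z ≢ x × ¬ Adj G x z ×
      ThreeIsoregular x y × ThreeIsoregular x z

{-# OPTIONS --safe #-}
module Submission where

-- Index the two cycles by ℤ/n and write the graph as connection sets S, T (inside the cycles) and R
-- (between them). With β = λ - μ, the element U = S + T - β of the group ring satisfies U (S - T) = 0,
-- U R = const and U³ = Δ² U + const for an integer Δ, and its coefficients off the identity are 0, 1 or 2.
-- The Frobenius congruence U^q ≡ Σ U(i) X^(q i) (mod q) for odd primes q shows that U is invariant under
-- all multipliers coprime to n; for p ∣ n it makes U constant off a subgroup if p ∤ Δ, and invariant under
-- the subgroup of order p if p ∣ Δ, unless two vertices are twins, which nontriviality excludes.
-- Hence U is constant on L and off L for some subgroup L. If U itself is constant, then S + T = ℤ/n - 0 and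
-- 2n = 4m² + 4m + 2, k = 2m² + m, λ = m² - 1, μ = m² for some m ∈ ℤ. Otherwise summing over the cosets of L,
-- which has odd order, leaves only the parameters of the Hoffman-Singleton graph and its complement.
-- In each of these cases the double counts forced by a 3-isoregular edge and a 3-isoregular non-edge
-- have no solution in non-negative integers.

-- In character language the cubic equation says that every non-trivial character of ℤ/n sends U to
-- 0, Δ or -Δ. The proof stays with integers: for an odd prime q the cubic equation collapses U^q to
-- Δ^(q-1) U + const, and Fermat makes the factor 0 or 1 modulo q, so Frobenius becomes a linear
-- congruence between values of U. It is an equality because 0, 1 and 2 stay distinct modulo an odd
-- prime. Odd n makes this available at every prime divisor of n. The value U(0) = -β escapes this,
-- having no bound in advance. If a prime p divides n and Δ, comparing U(0) with U(n/p) bounds it,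
-- since a difference would create twins; otherwise U(0) stays free and L is the trivial subgroup.
-- In the infinite family the edge and the non-edge clash through the parity of m: for m > 0 the
-- non-edge forces m to be even and the edge forbids it; for m < -1 the edge forces m to be odd and
-- the non-edge forbids it.

open import Level using (0ℓ)
open import Algebra.Bundles using (CommutativeSemiring)
open import Algebra.Structures.Biased using (isCommutativeSemiringˡ)
import Algebra.Properties.CommutativeMonoid.Mult as CommutativeMonoidMult
import Algebra.Properties.CommutativeSemiring.Binomial as Binomial
import Algebra.Properties.Semiring.Exp as SemiringExp
import Algebra.Properties.Semiring.Mult as SemiringMult
import Algebra.Properties.Semiring.Sum as SemiringSum
open import Data.Bool using (Bool; true; false; _∧_; not; if_then_else_)
import Data.Bool.Properties as Boolₚ
open import Data.Empty using (⊥; ⊥-elim)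
open import Data.Fin using (Fin; zero; suc; toℕ; inject₁; fromℕ)
import Data.Fin.Properties as Finₚ
open import Data.Fin.Permutation using (Permutation′; _⟨$⟩ʳ_; _⟨$⟩ˡ_; inverseˡ; inverseʳ; transpose) renaming (id to idₚ)
open import Data.List using (List; []; _∷_; length; filterᵇ; tabulate)
open import Data.List.Relation.Unary.All using (All; []; _∷_)
open import Data.Nat as ℕ using (ℕ; zero; suc)
open import Data.Nat.Combinatorics using (nCn≡1; nCk≡n!/k![n-k]!; k![n∸k]!∣n!) renaming (_C_ to _choose_)
open import Data.Nat.Coprimality using (Coprime; coprime-divisor)
import Data.Nat.DivMod as ℕDivMod
import Data.Nat.Divisibility as ℕ∣
open import Data.Nat.GCD using (gcd; gcd[m,n]∣m; gcd[m,n]∣n; gcd-greatest; gcd[m,n]≡0⇒m≡0)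
open import Data.Nat.Induction using (<-rec)
open import Data.Nat.ListAction using (product)
open import Data.Nat.Primality using (Prime; euclidsLemma; prime⇒irreducible; prime⇒nonTrivial; prime⇒nonZero; prime[2])
open import Data.Nat.Primality.Factorisation using (factorise; PrimeFactorisation)
import Data.Nat.Properties as ℕₚ
open import Data.Product using (Σ; ∃; _×_; _,_; proj₁; proj₂)
open import Data.Sum using (_⊎_; inj₁; inj₂)
open import Function using (_∘_; id)
import Relation.Binary.Reasoning.Setoid as SetoidReasoning
open import Relation.Binary.PropositionalEquality hiding (setoid; J; [_])
open import Relation.Binary.Structures using (IsEquivalence)
open import Relation.Nullary using (¬_; Dec; yes; no; contradiction; does)
open import Relation.Nullary.Decidable using (dec-true; dec-false; from-no; ¬?; _×-dec_)

-- The Frobenius congruence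

prime∤! : ∀ {p} → Prime p → ∀ k → k ℕ.< p → ¬ p ℕ∣.∣ k ℕ.!
prime∤! {p} pr zero    k<p d = ℕₚ.<⇒≢ (ℕ.nonTrivial⇒n>1 p {{prime⇒nonTrivial pr}}) (sym (ℕ∣.∣1⇒≡1 d))
prime∤! {p} pr (suc k) k<p d with euclidsLemma (suc k) (k ℕ.!) pr d
... | inj₁ e = ℕ∣.>⇒∤ k<p e
... | inj₂ e = prime∤! pr k (ℕₚ.<-trans (ℕₚ.n<1+n k) k<p) e

prime∣C : ∀ {p} → Prime p → ∀ k → 0 ℕ.< k → k ℕ.< p → p ℕ∣.∣ p choose k
prime∣C {zero}  pr k _ ()
prime∣C {suc q} pr k 0<k k<p with euclidsLemma (p choose k) (k ℕ.! ℕ.* (p ℕ.∸ k) ℕ.!) pr p∣prod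
  where
  p = suc q
  instance _ = k ℕₚ.!* (p ℕ.∸ k) !≢0
  prod≡ : (p choose k) ℕ.* (k ℕ.! ℕ.* (p ℕ.∸ k) ℕ.!) ≡ p ℕ.!
  prod≡ = trans (cong (ℕ._* (k ℕ.! ℕ.* (p ℕ.∸ k) ℕ.!)) (nCk≡n!/k![n-k]! (ℕₚ.<⇒≤ k<p)))
                (ℕDivMod.m/n*n≡m (k![n∸k]!∣n! (ℕₚ.<⇒≤ k<p)))
  p∣prod : p ℕ∣.∣ (p choose k) ℕ.* (k ℕ.! ℕ.* (p ℕ.∸ k) ℕ.!)
  p∣prod = subst (p ℕ∣.∣_) (sym prod≡) (ℕ∣.m∣m*n (q ℕ.!))
... | inj₁ d = d
... | inj₂ d with euclidsLemma (k ℕ.!) ((suc q ℕ.∸ k) ℕ.!) pr d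
...   | inj₁ e = contradiction e (prime∤! pr k k<p)
...   | inj₂ e = contradiction e (prime∤! pr (suc q ℕ.∸ k) (ℕₚ.∸-monoʳ-< {o = 0} 0<k (ℕₚ.<⇒≤ k<p)))

module Freshman {a ℓ} (S : CommutativeSemiring a ℓ) where
  open CommutativeSemiring S hiding (zero) renaming (_+_ to _⊕_; _*_ to _⊛_; refl to ≈-refl; sym to ≈-sym; trans to ≈-trans)
  open SemiringSum semiring using (sum; sum-init-last; sum-cong-≋)
  open SemiringMult semiring using (×-congʳ; ×-assocˡ; ×-congˡ; ×-homo-1) renaming (_×_ to _·_)
  open CommutativeMonoidMult +-commutativeMonoid using (×-distrib-+)
  open SemiringExp semiring using () renaming (_^_ to _↑_)
  open SetoidReasoning setoid

  multiple-sum : ∀ p {n} (t : Fin n → Carrier) → (∀ i → ∃ λ z → t i ≈ p · z) → ∃ λ z → sum t ≈ p · z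
  multiple-sum p {zero}  t h = 0# , zero-mult p
    where
    zero-mult : ∀ p → 0# ≈ p · 0#
    zero-mult zero    = ≈-refl
    zero-mult (suc p) = ≈-trans (zero-mult p) (≈-sym (+-identityˡ _))
  multiple-sum p {suc n} t h with h zero | multiple-sum p (t ∘ suc) (h ∘ suc)
  ... | z , e | z′ , e′ = z ⊕ z′ , ≈-trans (+-cong e e′) (≈-sym (×-distrib-+ z z′ p))

  -- A semiring has no subtraction in which to state a congruence, so the multiple of `p` is carried
  -- by an explicit witness. Two instances are used: ℤ, where it gives Fermat, and the convolution
  -- ring, where it gives Frobenius.
  freshman : ∀ {p} → Prime p → ∀ x y → ∃ λ z → (x ⊕ y) ↑ p ≈ x ↑ p ⊕ y ↑ p ⊕ p · z
  freshman {zero}  pr x y = contradiction (prime⇒nonTrivial pr) λ ()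
  freshman {suc q} pr x y with multiple-sum (suc q) middle middle-multiple
    where
    middle : Fin q → Carrier
    middle i = Binomial.binomialTerm S x y (suc q) (suc (inject₁ i))
    middle-multiple : ∀ i → ∃ λ z → middle i ≈ suc q · z
    middle-multiple i with prime∣C pr (suc (toℕ (inject₁ i))) (ℕ.s≤s ℕ.z≤n)
      (ℕ.s≤s (subst (ℕ._< q) (sym (Finₚ.toℕ-inject₁ i)) (Finₚ.toℕ<n i)))
    ... | ℕ∣.divides d e = d · b , ≈-trans (×-congˡ (trans e (ℕₚ.*-comm d (suc q)))) (≈-sym (×-assocˡ b (suc q) d))
      where b = Binomial.binomial S x y (suc q) (suc (inject₁ i))
  ... | z , e = z , (begin
    (x ⊕ y) ↑ suc q
      ≈⟨ Binomial.theorem S (suc q) x y ⟩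
    term zero ⊕ sum (term ∘ suc)
      ≈⟨ +-congˡ (sum-init-last (term ∘ suc)) ⟩
    term zero ⊕ (sum (λ i → term (suc (inject₁ i))) ⊕ term (suc (fromℕ q)))
      ≈⟨ +-cong first (+-cong e final) ⟩
    y ↑ suc q ⊕ (suc q · z ⊕ x ↑ suc q)
      ≈⟨ +-congˡ (+-comm _ _) ⟩
    y ↑ suc q ⊕ (x ↑ suc q ⊕ suc q · z)
      ≈⟨ +-assoc _ _ _ ⟨
    y ↑ suc q ⊕ x ↑ suc q ⊕ suc q · z
      ≈⟨ +-congʳ (+-comm _ _) ⟩
    x ↑ suc q ⊕ y ↑ suc q ⊕ suc q · z ∎)
    where
    term = Binomial.binomialTerm S x y (suc q)
    first : term zero ≈ y ↑ suc q
    first = ≈-trans (+-identityʳ _) (*-identityˡ _)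
    final : term (suc (fromℕ q)) ≈ x ↑ suc q
    final = begin
      (suc q choose suc (toℕ (fromℕ q))) · (x ↑ suc (toℕ (fromℕ q)) ⊛ y ↑ (q ℕ.∸ toℕ (fromℕ q)))
        ≡⟨ cong (λ k → (suc q choose suc k) · (x ↑ suc k ⊛ y ↑ (q ℕ.∸ k))) (Finₚ.toℕ-fromℕ q) ⟩
      (suc q choose suc q) · (x ↑ suc q ⊛ y ↑ (q ℕ.∸ q))
        ≡⟨ cong₂ (λ k l → k · (x ↑ suc q ⊛ y ↑ l)) (nCn≡1 (suc q)) (ℕₚ.n∸n≡0 q) ⟩
      1 · (x ↑ suc q ⊛ 1#)
        ≈⟨ ×-homo-1 _ ⟩
      x ↑ suc q ⊛ 1#
        ≈⟨ *-identityʳ _ ⟩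
      x ↑ suc q ∎

open import Data.Integer hiding (suc) renaming (∣_∣ to abs)
open import Data.Integer.DivMod using (_%ℕ_; _/ℕ_; a≡a%ℕn+[a/ℕn]*n; n%ℕd<d)
open import Data.Integer.Divisibility.Signed
open import Data.Integer.Properties
open import Data.Integer.Tactic.RingSolver

0≤+ : ∀ {n} → 0ℤ ≤ + n
0≤+ = +≤+ ℕ.z≤n

0<+ : ∀ {n} → 0ℤ < + suc n
0<+ = +<+ (ℕ.s≤s ℕ.z≤n)

-- Linear combinations of equations

-- Elimination by certificate: once the cofactors are supplied, what is left is a polynomial
-- identity without hypotheses, which the ring solver decides. Most of the later algebra has this
-- form.
lin₁ : ∀ {x y l r} c → l ≡ r → x - y ≡ c * (l - r) → x ≡ y
lin₁ {x} {y} {l} c refl e =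
  i-j≡0⇒i≡j x y (trans e (trans (cong (c *_) (i≡j⇒i-j≡0 {l} refl)) (*-zeroʳ c)))

lin₂ : ∀ {x y l r l′ r′} c c′ → l ≡ r → l′ ≡ r′ →
  x - y ≡ c * (l - r) + c′ * (l′ - r′) → x ≡ y
lin₂ {l′ = l′} c c′ p refl e = lin₁ c p (trans e (lem c _ c′ l′))
  where
  lem : ∀ c d c′ l′ → c * d + c′ * (l′ - l′) ≡ c * d
  lem = solve-∀

lin₃ : ∀ {x y l r l′ r′ l″ r″} c c′ c″ → l ≡ r → l′ ≡ r′ → l″ ≡ r″ →
  x - y ≡ c * (l - r) + c′ * (l′ - r′) + c″ * (l″ - r″) → x ≡ y
lin₃ {l″ = l″} c c′ c″ p q refl e = lin₂ c c′ p q (trans e (lem _ c″ l″))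
  where
  lem : ∀ d c l → d + c * (l - l) ≡ d
  lem = solve-∀

+-cancelˡ-≡ : ∀ c x y → c + x ≡ c + y → x ≡ y
+-cancelˡ-≡ c x y e = lin₁ 1ℤ e (lem c x y)
  where
  lem : ∀ c x y → x - y ≡ 1ℤ * ((c + x) - (c + y))
  lem = solve-∀

-- Finite sums of functions on ℤ

∑ : ℕ → (ℤ → ℤ) → ℤ
∑ zero    f = 0ℤ
∑ (suc n) f = ∑ n f + f (+ n)

∑-cong< : ∀ n {f g : ℤ → ℤ} → (∀ i → i ℕ.< n → f (+ i) ≡ g (+ i)) → ∑ n f ≡ ∑ n g
∑-cong< zero    e = refl
∑-cong< (suc n) e =
  cong₂ _+_ (∑-cong< n (λ i i<n → e i (ℕₚ.m<n⇒m<1+n i<n))) (e n (ℕₚ.n<1+n n))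

∑-cong : ∀ n {f g : ℤ → ℤ} → (∀ x → f x ≡ g x) → ∑ n f ≡ ∑ n g
∑-cong n e = ∑-cong< n (λ i _ → e (+ i))

∑-+ : ∀ n (f g : ℤ → ℤ) → ∑ n (λ i → f i + g i) ≡ ∑ n f + ∑ n g
∑-+ zero    f g = refl
∑-+ (suc n) f g = trans (cong (_+ (f (+ n) + g (+ n))) (∑-+ n f g)) (lem (∑ n f) (∑ n g) (f (+ n)) (g (+ n)))
  where
  lem : ∀ a b c d → (a + b) + (c + d) ≡ (a + c) + (b + d)
  lem = solve-∀

∑-*ˡ : ∀ n c (f : ℤ → ℤ) → ∑ n (λ i → c * f i) ≡ c * ∑ n f
∑-*ˡ zero    c f = sym (*-zeroʳ c)
∑-*ˡ (suc n) c f = trans (cong (_+ c * f (+ n)) (∑-*ˡ n c f)) (sym (*-distribˡ-+ c _ _))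

∑-*ʳ : ∀ n c (f : ℤ → ℤ) → ∑ n (λ i → f i * c) ≡ ∑ n f * c
∑-*ʳ n c f = trans (∑-cong n (λ x → *-comm (f x) c)) (trans (∑-*ˡ n c f) (*-comm c _))

∑-- : ∀ n (f g : ℤ → ℤ) → ∑ n (λ i → f i - g i) ≡ ∑ n f - ∑ n g
∑-- zero    f g = refl
∑-- (suc n) f g = trans (cong (_+ (f (+ n) - g (+ n))) (∑-- n f g)) (lem (∑ n f) (∑ n g) (f (+ n)) (g (+ n)))
  where
  lem : ∀ a b c d → (a - b) + (c - d) ≡ (a + c) - (b + d)
  lem = solve-∀

∑-const : ∀ n c → ∑ n (λ _ → c) ≡ + n * c
∑-const zero    c = refl
∑-const (suc n) c = trans (cong (_+ c) (∑-const n c)) (trans (lem (+ n) c) (cong (_* c) (+-comm (+ n) 1ℤ)))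
  where
  lem : ∀ n c → n * c + c ≡ (n + 1ℤ) * c
  lem = solve-∀

∑-swap : ∀ m n (f : ℤ → ℤ → ℤ) → ∑ m (λ i → ∑ n (f i)) ≡ ∑ n (λ j → ∑ m (λ i → f i j))
∑-swap zero    n f = sym (trans (∑-const n 0ℤ) (*-zeroʳ (+ n)))
∑-swap (suc m) n f = trans (cong (_+ ∑ n (f (+ m))) (∑-swap m n f)) (sym (∑-+ n _ _))

∑-front : ∀ n (f : ℤ → ℤ) → ∑ (suc n) f ≡ f 0ℤ + ∑ n (λ i → f (i + 1ℤ))
∑-front zero    f = +-comm 0ℤ (f 0ℤ)
∑-front (suc n) f = trans (cong (_+ f (+ suc n)) (∑-front n f))
  (trans (+-assoc (f 0ℤ) _ _) (cong (λ z → f 0ℤ + (∑ n (λ i → f (i + 1ℤ)) + f z)) (+-comm 1ℤ (+ n))))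

∑-append : ∀ m n (f : ℤ → ℤ) → ∑ (m ℕ.+ n) f ≡ ∑ m f + ∑ n (λ i → f (+ m + i))
∑-append m zero    f = trans (cong (λ z → ∑ z f) (ℕₚ.+-identityʳ m)) (sym (+-identityʳ _))
∑-append m (suc n) f = trans (cong (λ z → ∑ z f) (ℕₚ.+-suc m n))
  (trans (cong (_+ f (+ (m ℕ.+ n))) (∑-append m n f)) (+-assoc (∑ m f) _ _))

∑-blocks : ∀ m h (f : ℤ → ℤ) →
  ∑ (m ℕ.* h) f ≡ ∑ m (λ j → ∑ h (λ i → f (j * + h + i)))
∑-blocks zero    h f = refl
∑-blocks (suc m) h f = trans (∑-append h (m ℕ.* h) f)
  (trans (cong₂ _+_ (∑-cong h (λ x → cong f (sym (lem₀ (+ h) x))))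
                    (trans (∑-blocks m h (λ i → f (+ h + i)))
                           (∑-cong m (λ j → ∑-cong h (λ i → cong f (lem₁ (+ h) i j))))))
         (sym (∑-front m (λ j → ∑ h (λ i → f (j * + h + i))))))
  where
  lem₀ : ∀ h x → 0ℤ * h + x ≡ x
  lem₀ = solve-∀
  lem₁ : ∀ h i j → h + (j * h + i) ≡ (j + 1ℤ) * h + i
  lem₁ = solve-∀

∑-reverse : ∀ n (f : ℤ → ℤ) → ∑ n (λ i → f (+ n - 1ℤ - i)) ≡ ∑ n f
∑-reverse zero    f = refl
∑-reverse (suc n) f = trans (∑-front n (λ i → f (+ suc n - 1ℤ - i)))
  (trans (cong₂ _+_ (cong f (lem₀ (+ n)))
                    (trans (∑-cong n (λ i → cong f (lem₁ (+ n) i))) (∑-reverse n f)))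
         (+-comm (f (+ n)) (∑ n f)))
  where
  lem₀ : ∀ n → 1ℤ + n - 1ℤ - 0ℤ ≡ n
  lem₀ = solve-∀
  lem₁ : ∀ n i → 1ℤ + n - 1ℤ - (i + 1ℤ) ≡ n - 1ℤ - i
  lem₁ = solve-∀

∑-nonneg : ∀ n {f : ℤ → ℤ} → (∀ x → 0ℤ ≤ f x) → 0ℤ ≤ ∑ n f
∑-nonneg zero    h = ≤-refl
∑-nonneg (suc n) h = +-mono-≤ (∑-nonneg n h) (h (+ n))

-- Periodic functions

-- Elements of the group ring of ℤ/n are kept as functions on all of ℤ: negating, translating or
-- multiplying the argument needs no reduction, and the same function can be read again at a smaller
-- period.
Periodic : ℕ → (ℤ → ℤ) → Set
Periodic n f = ∀ x → f (x + + n) ≡ f x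

module _ {n : ℕ} {f : ℤ → ℤ} (per : Periodic n f) where

  private
    multiple⁺ : ∀ k x → f (x + + k * + n) ≡ f x
    multiple⁺ zero    x = cong f (+-identityʳ x)
    multiple⁺ (suc k) x = trans (cong f (lem x (+ k) (+ n))) (trans (per _) (multiple⁺ k x))
      where
      lem : ∀ x k n → x + (1ℤ + k) * n ≡ (x + k * n) + n
      lem = solve-∀

  periodic-multiple : ∀ z x → f (x + z * + n) ≡ f x
  periodic-multiple (+ k)    x = multiple⁺ k x
  periodic-multiple -[1+ k ] x =
    trans (sym (multiple⁺ (suc k) (x + -[1+ k ] * + n))) (cong f (lem x (+ suc k) (+ n)))
    where
    lem : ∀ x k n → (x + (- k) * n) + k * n ≡ x
    lem = solve-∀

  periodic-≡ : ∀ {x y} → + n ∣ x - y → f x ≡ f y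
  periodic-≡ {x} {y} (divides q e) =
    trans (cong f (trans (lem x y) (cong (λ z → y + z) e))) (periodic-multiple q y)
    where
    lem : ∀ x y → x ≡ y + (x - y)
    lem = solve-∀

∑-shift₁ : ∀ n {f} → Periodic n f → ∑ n (λ i → f (i + 1ℤ)) ≡ ∑ n f
∑-shift₁ n {f} per = +-cancelˡ-≡ (f 0ℤ) _ _ (begin
  f 0ℤ + ∑ n (λ i → f (i + 1ℤ)) ≡⟨ ∑-front n f ⟨
  ∑ n f + f (+ n)               ≡⟨ cong (λ z → ∑ n f + z) (trans (cong f (sym (+-identityˡ (+ n)))) (per 0ℤ)) ⟩
  ∑ n f + f 0ℤ                  ≡⟨ +-comm (∑ n f) _ ⟩
  f 0ℤ + ∑ n f                  ∎)
  where open ≡-Reasoning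

periodic-+ : ∀ n {f} z → Periodic n f → Periodic n (λ i → f (i + z))
periodic-+ n {f} z per x = trans (cong f (lem x z (+ n))) (per (x + z))
  where
  lem : ∀ x z n → (x + n) + z ≡ (x + z) + n
  lem = solve-∀

private
  ∑-shift⁺ : ∀ n {f} → Periodic n f → ∀ k → ∑ n (λ i → f (i + + k)) ≡ ∑ n f
  ∑-shift⁺ n {f} per zero    = ∑-cong n (λ x → cong f (+-identityʳ x))
  ∑-shift⁺ n {f} per (suc k) = trans (∑-cong n (λ x → cong f (sym (+-assoc x 1ℤ (+ k)))))
    (trans (∑-shift₁ n (periodic-+ n (+ k) per)) (∑-shift⁺ n per k))

∑-shift : ∀ n {f} → Periodic n f → ∀ z → ∑ n (λ i → f (i + z)) ≡ ∑ n f
∑-shift n per (+ k)    = ∑-shift⁺ n per k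
∑-shift n {f} per -[1+ k ] =
  trans (sym (∑-shift⁺ n (periodic-+ n -[1+ k ] per) (suc k)))
        (∑-cong n (λ x → cong f (lem x (+ suc k))))
  where
  lem : ∀ x k → (x + k) + (- k) ≡ x
  lem = solve-∀

∑-neg : ∀ n {f} → Periodic n f → ∑ n (λ i → f (- i)) ≡ ∑ n f
∑-neg n {f} per =
  trans (∑-cong n (λ i → cong f (lem (+ n) i)))
  (trans (∑-reverse n (λ j → f (j + (1ℤ - + n)))) (∑-shift n per (1ℤ - + n)))
  where
  lem : ∀ n i → - i ≡ (n - 1ℤ - i) + (1ℤ - n)
  lem = solve-∀

-- Iverson brackets for divisibility

opaque
  ⟦_∣_⟧ : ℤ → ℤ → ℤ
  ⟦ d ∣ x ⟧ = if does (d ∣? x) then 1ℤ else 0ℤ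

  ⟦⟧-yes : ∀ {d x} → d ∣ x → ⟦ d ∣ x ⟧ ≡ 1ℤ
  ⟦⟧-yes {d} {x} p = cong (if_then 1ℤ else 0ℤ) (dec-true (d ∣? x) p)

  ⟦⟧-no : ∀ {d x} → ¬ d ∣ x → ⟦ d ∣ x ⟧ ≡ 0ℤ
  ⟦⟧-no {d} {x} p = cong (if_then 1ℤ else 0ℤ) (dec-false (d ∣? x) p)

∣-resp-- : ∀ {d} x y → d ∣ x - y → d ∣ x → d ∣ y
∣-resp-- {d} x y p q = subst (d ∣_) (lem x y) (∣m∣n⇒∣m-n q p)
  where
  lem : ∀ x y → x - (x - y) ≡ y
  lem = solve-∀

∣-flip : ∀ {d} x y → d ∣ x - y → d ∣ y - x
∣-flip {d} x y p = subst (d ∣_) (lem x y) (∣m⇒∣-m p)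
  where
  lem : ∀ x y → - (x - y) ≡ y - x
  lem = solve-∀

⟦⟧-⇔ : ∀ {d e x y} → (d ∣ x → e ∣ y) → (e ∣ y → d ∣ x) → ⟦ d ∣ x ⟧ ≡ ⟦ e ∣ y ⟧
⟦⟧-⇔ {d} {e} {x} {y} to from with d ∣? x
... | yes p = trans (⟦⟧-yes p) (sym (⟦⟧-yes (to p)))
... | no ¬p = trans (⟦⟧-no ¬p) (sym (⟦⟧-no (¬p ∘ from)))

⟦⟧-resp : ∀ d x y → d ∣ x - y → ⟦ d ∣ x ⟧ ≡ ⟦ d ∣ y ⟧
⟦⟧-resp d x y p = ⟦⟧-⇔ {d} {d} {x} {y} (∣-resp-- x y p) (∣-resp-- y x (∣-flip x y p))

⟦⟧-neg : ∀ d x → ⟦ d ∣ - x ⟧ ≡ ⟦ d ∣ x ⟧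
⟦⟧-neg d x = ⟦⟧-⇔ {d} {d} { - x} {x} (λ p → subst (d ∣_) (neg-involutive x) (∣m⇒∣-m p)) ∣m⇒∣-m

⟦⟧-periodic : ∀ n d m → n ≡ m ℕ.* d → Periodic n (λ x → ⟦ + d ∣ x ⟧)
⟦⟧-periodic n d m refl x = ⟦⟧-resp (+ d) (x + + (m ℕ.* d)) x (divides (+ m) (trans (lem x (+ (m ℕ.* d))) (pos-* m d)))
  where
  lem : ∀ x y → x + y - x ≡ y
  lem = solve-∀

small-∤ : ∀ {h i} → 0 ℕ.< i → i ℕ.< h → ¬ + h ∣ + i
small-∤ {i = suc i} _ i<h h∣i = ℕ∣.>⇒∤ i<h (∣⇒∣ᵤ h∣i)

∑-⟦⟧-pick₀ : ∀ h → 0 ℕ.< h → (f : ℤ → ℤ) → ∑ h (λ i → ⟦ + h ∣ i ⟧ * f i) ≡ f 0ℤ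
∑-⟦⟧-pick₀ (suc h) _ f =
  trans (∑-front h (λ i → ⟦ + suc h ∣ i ⟧ * f i))
  (trans (cong₂ _+_ (trans (cong (_* f 0ℤ) (⟦⟧-yes {+ suc h} {0ℤ} (divides 0ℤ refl))) (*-identityˡ _))
     (trans (∑-cong< h (λ i i<h → trans (cong (_* f (+ i + 1ℤ))
        (⟦⟧-no {+ suc h} {+ i + 1ℤ} (small-∤ (ℕₚ.m≤n+m 1 i) (subst (ℕ._< suc h) (ℕₚ.+-comm 1 i) (ℕ.s≤s i<h)))))
        (*-zeroˡ (f (+ i + 1ℤ)))))
      (trans (∑-const h 0ℤ) (*-zeroʳ (+ h)))))
   (+-identityʳ _))

-- After a shift by `x` the range splits into `l` blocks of length `h`, and the bracket keeps only
-- the first index of each. The right side sums `f` over a coset of the subgroup of order `l` of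
-- ℤ/n.
∑-⟦⟧-coset : ∀ n l h → n ≡ l ℕ.* h → 0 ℕ.< h → ∀ {f} → Periodic n f → ∀ x →
  ∑ n (λ i → ⟦ + h ∣ x - i ⟧ * f i) ≡ ∑ l (λ j → f (x + j * + h))
∑-⟦⟧-coset n l h n≡lh 0<h {f} per x = begin
  ∑ n (λ i → ⟦ + h ∣ x - i ⟧ * f i)
    ≡⟨ ∑-shift n F-per x ⟨
  ∑ n (λ i → ⟦ + h ∣ x - (i + x) ⟧ * f (i + x))
    ≡⟨ ∑-cong n (λ i → cong (_* f (i + x)) (trans (cong ⟦ + h ∣_⟧ (lem₀ x i)) (⟦⟧-neg (+ h) i))) ⟩
  ∑ n (λ i → ⟦ + h ∣ i ⟧ * f (i + x))
    ≡⟨ cong (λ z → ∑ z (λ i → ⟦ + h ∣ i ⟧ * f (i + x))) n≡lh ⟩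
  ∑ (l ℕ.* h) (λ i → ⟦ + h ∣ i ⟧ * f (i + x))
    ≡⟨ ∑-blocks l h _ ⟩
  ∑ l (λ j → ∑ h (λ i → ⟦ + h ∣ j * + h + i ⟧ * f (j * + h + i + x)))
    ≡⟨ ∑-cong l (λ j → ∑-cong h (λ i → cong₂ _*_
         (⟦⟧-resp (+ h) (j * + h + i) i (divides j (lem₁ i (j * + h)))) (cong f (lem₂ (j * + h) i x)))) ⟩
  ∑ l (λ j → ∑ h (λ i → ⟦ + h ∣ i ⟧ * f (x + j * + h + i)))
    ≡⟨ ∑-cong l (λ j → trans (∑-⟦⟧-pick₀ h 0<h (λ i → f (x + j * + h + i))) (cong f (+-identityʳ _))) ⟩
  ∑ l (λ j → f (x + j * + h)) ∎
  where
  open ≡-Reasoning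
  lem₀ : ∀ x i → x - (i + x) ≡ - i
  lem₀ = solve-∀
  lem₁ : ∀ i y → y + i - i ≡ y
  lem₁ = solve-∀
  lem₂ : ∀ y i x → y + i + x ≡ x + y + i
  lem₂ = solve-∀
  lem₃ : ∀ x i n → (x - (i + n)) + n ≡ x - i
  lem₃ = solve-∀
  F-per : Periodic n (λ i → ⟦ + h ∣ x - i ⟧ * f i)
  F-per i = cong₂ _*_ (trans (sym (⟦⟧-periodic n h l n≡lh (x - (i + + n)))) (cong ⟦ + h ∣_⟧ (lem₃ x i (+ n)))) (per i)

∑-⟦⟧-pick : ∀ n → 0 ℕ.< n → ∀ {f} → Periodic n f → ∀ x → ∑ n (λ i → ⟦ + n ∣ x - i ⟧ * f i) ≡ f x
∑-⟦⟧-pick n 0<n {f} per x =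
  trans (∑-⟦⟧-coset n 1 n (sym (ℕₚ.+-identityʳ n)) 0<n per x)
        (trans (+-identityˡ _) (cong f (+-identityʳ x)))

opaque
  -- Induction over ℤ in both directions: by `freshman` with second summand 1, `c ^ p - c` keeps its
  -- class modulo `p` when `c` changes by one, and reading this backwards reaches the negative
  -- integers.
  fermat : ∀ {p} → Prime p → ∀ c → + p ∣ c ^ p - c
  fermat {p} pr = go
    where
    open SemiringMult (CommutativeSemiring.semiring +-*-commutativeSemiring) using () renaming (_×_ to _·_)
    open SemiringExp (CommutativeSemiring.semiring +-*-commutativeSemiring) using () renaming (_^_ to _↑_)
    ↑≡^ : ∀ c k → c ↑ k ≡ c ^ k
    ↑≡^ c zero    = refl
    ↑≡^ c (suc k) = cong (c *_) (↑≡^ c k)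
    ·≡* : ∀ k c → k · c ≡ c * + k
    ·≡* zero    c = sym (*-zeroʳ c)
    ·≡* (suc k) c = trans (cong (λ z → c + z) (·≡* k c)) (lem c (+ k))
      where
      lem : ∀ c k → c + c * k ≡ c * (1ℤ + k)
      lem = solve-∀
    step : ∀ c → + p ∣ (c + 1ℤ) ^ p - (c ^ p + 1ℤ)
    step c with Freshman.freshman +-*-commutativeSemiring pr c 1ℤ
    ... | z , e = divides z (lin₁ 1ℤ
        (trans (sym (↑≡^ (c + 1ℤ) p)) (trans e (cong₂ _+_ (cong₂ _+_ (↑≡^ c p) (trans (↑≡^ 1ℤ p) (^-zeroˡ p))) (·≡* p z))))
        (lem ((c + 1ℤ) ^ p) (c ^ p) (z * + p)))
      where
      lem : ∀ a b d → a - (b + 1ℤ) - d ≡ 1ℤ * (a - (b + 1ℤ + d))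
      lem = solve-∀
    up : ∀ c → + p ∣ c ^ p - c → + p ∣ (c + 1ℤ) ^ p - (c + 1ℤ)
    up c h = subst (+ p ∣_) (lem ((c + 1ℤ) ^ p) (c ^ p) c) (∣m∣n⇒∣m+n (step c) h)
      where
      lem : ∀ a b c → (a - (b + 1ℤ)) + (b - c) ≡ a - (c + 1ℤ)
      lem = solve-∀
    down : ∀ c → + p ∣ (c + 1ℤ) ^ p - (c + 1ℤ) → + p ∣ c ^ p - c
    down c h = subst (+ p ∣_) (lem ((c + 1ℤ) ^ p) (c ^ p) c) (∣m∣n⇒∣m-n h (step c))
      where
      lem : ∀ a b c → (a - (c + 1ℤ)) - (a - (b + 1ℤ)) ≡ b - c
      lem = solve-∀
    zero^ : ∀ {p} → Prime p → 0ℤ ^ p - 0ℤ ≡ 0ℤ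
    zero^ {zero}  pr = contradiction (prime⇒nonTrivial pr) λ ()
    zero^ {suc _} pr = refl
    go : ∀ c → + p ∣ c ^ p - c
    go (+ zero)      = divides 0ℤ (trans (zero^ pr) (sym (*-zeroˡ (+ p))))
    go (+ suc k)     = subst (λ c → + p ∣ c ^ p - c) (+-comm (+ k) 1ℤ) (up (+ k) (go (+ k)))
    go -[1+ zero ]   = down -[1+ zero ] (go 0ℤ)
    go -[1+ suc k ]  = down -[1+ suc k ] (go -[1+ k ])

-- Cyclic convolution

periodic-* : ∀ n {f g} → Periodic n f → Periodic n g → Periodic n (λ x → f x * g x)
periodic-* n p q x = cong₂ _*_ (p x) (q x)

periodic-reflect : ∀ n {g} x → Periodic n g → Periodic n (λ i → g (x - i))
periodic-reflect n {g} x per i = trans (sym (per (x - (i + + n)))) (cong g (lem x i (+ n)))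
  where
  lem : ∀ x i n → (x - (i + n)) + n ≡ x - i
  lem = solve-∀

-- The unit element for convolution.
δ : ℕ → ℤ → ℤ
δ n x = ⟦ + n ∣ x ⟧

δ-periodic : ∀ n → Periodic n (δ n)
δ-periodic n = ⟦⟧-periodic n n 1 (sym (ℕₚ.+-identityʳ n))

opaque
  conv : ℕ → (ℤ → ℤ) → (ℤ → ℤ) → ℤ → ℤ
  conv n f g x = ∑ n (λ i → f i * g (x - i))

  conv-def : ∀ n f g x → conv n f g x ≡ ∑ n (λ i → f i * g (x - i))
  conv-def n f g x = refl

  conv-cong : ∀ n {f f′ g g′} → (∀ x → f x ≡ f′ x) → (∀ x → g x ≡ g′ x) → ∀ x → conv n f g x ≡ conv n f′ g′ x
  conv-cong n e e′ x = ∑-cong n (λ i → cong₂ _*_ (e i) (e′ (x - i)))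

  conv-periodic : ∀ n f {g} → Periodic n g → Periodic n (conv n f g)
  conv-periodic n f {g} per x = ∑-cong n (λ i → cong (f i *_) (trans (cong g (lem x (+ n) i)) (per (x - i))))
    where
    lem : ∀ x n i → x + n - i ≡ (x - i) + n
    lem = solve-∀

  conv-comm : ∀ n {f g} → Periodic n f → Periodic n g → ∀ x → conv n f g x ≡ conv n g f x
  conv-comm n {f} {g} pf pg x = begin
    ∑ n F                   ≡⟨ ∑-shift n F-per x ⟨
    ∑ n (λ i → F (i + x))   ≡⟨ ∑-neg n (periodic-+ n x F-per) ⟨
    ∑ n (λ i → F (- i + x)) ≡⟨ ∑-cong n (λ i → trans (cong₂ _*_ (cong f (+-comm (- i) x)) (cong g (lem x i))) (*-comm (f (x - i)) (g i))) ⟩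
    conv n g f x            ∎
    where
    open ≡-Reasoning
    F : ℤ → ℤ
    F i = f i * g (x - i)
    F-per : Periodic n F
    F-per = periodic-* n pf (periodic-reflect n x pg)
    lem : ∀ x i → x - (- i + x) ≡ i
    lem = solve-∀

  conv-assoc : ∀ n {f g h} → Periodic n g → Periodic n h →
    ∀ x → conv n (conv n f g) h x ≡ conv n f (conv n g h) x
  conv-assoc n {f} {g} {h} pg ph x = begin
    ∑ n (λ i → ∑ n (λ j → f j * g (i - j)) * h (x - i))
      ≡⟨ ∑-cong n (λ i → sym (∑-*ʳ n (h (x - i)) _)) ⟩
    ∑ n (λ i → ∑ n (λ j → f j * g (i - j) * h (x - i)))
      ≡⟨ ∑-swap n n _ ⟩
    ∑ n (λ j → ∑ n (λ i → f j * g (i - j) * h (x - i)))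
      ≡⟨ ∑-cong n (λ j → trans (∑-cong n (λ i → *-assoc (f j) _ _)) (∑-*ˡ n (f j) _)) ⟩
    ∑ n (λ j → f j * ∑ n (λ i → g (i - j) * h (x - i)))
      ≡⟨ ∑-cong n (λ j → cong (f j *_) (trans
           (sym (∑-shift n (periodic-* n (periodic-+ n (- j) pg) (periodic-reflect n x ph)) j))
           (∑-cong n (λ i → cong₂ _*_ (cong g (lem₁ i j)) (cong h (lem₂ x i j)))))) ⟩
    conv n f (conv n g h) x ∎
    where
    open ≡-Reasoning
    lem₁ : ∀ i j → (i + j) - j ≡ i
    lem₁ = solve-∀
    lem₂ : ∀ x i j → x - (i + j) ≡ (x - j) - i
    lem₂ = solve-∀

  conv-+ˡ : ∀ n f g h x → conv n (λ i → f i + g i) h x ≡ conv n f h x + conv n g h x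
  conv-+ˡ n f g h x = trans (∑-cong n (λ i → *-distribʳ-+ (h (x - i)) (f i) (g i))) (∑-+ n _ _)

  conv-+ʳ : ∀ n f g h x → conv n f (λ i → g i + h i) x ≡ conv n f g x + conv n f h x
  conv-+ʳ n f g h x = trans (∑-cong n (λ i → *-distribˡ-+ (f i) (g (x - i)) (h (x - i)))) (∑-+ n _ _)

  conv-*ˡ : ∀ n c f g x → conv n (λ i → c * f i) g x ≡ c * conv n f g x
  conv-*ˡ n c f g x = trans (∑-cong n (λ i → *-assoc c (f i) (g (x - i)))) (∑-*ˡ n c _)

  conv-*ʳ : ∀ n c f g x → conv n f (λ i → c * g i) x ≡ c * conv n f g x
  conv-*ʳ n c f g x = trans (∑-cong n (λ i → lem c (f i) (g (x - i)))) (∑-*ˡ n c _)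
    where
    lem : ∀ c a b → a * (c * b) ≡ c * (a * b)
    lem = solve-∀

  conv-constʳ : ∀ n f c x → conv n f (λ _ → c) x ≡ ∑ n f * c
  conv-constʳ n f c x = ∑-*ʳ n c f

  conv-zeroˡ : ∀ n g x → conv n (λ _ → 0ℤ) g x ≡ 0ℤ
  conv-zeroˡ n g x = trans (∑-cong n (λ i → *-zeroˡ (g (x - i)))) (trans (∑-const n 0ℤ) (*-zeroʳ (+ n)))

  conv-δʳ : ∀ n → 0 ℕ.< n → ∀ {f} → Periodic n f → ∀ x → conv n f (δ n) x ≡ f x
  conv-δʳ n 0<n {f} pf x = trans (∑-cong n (λ i → *-comm (f i) _)) (pick x)
    where
    pick : ∀ x → ∑ n (λ i → ⟦ + n ∣ x - i ⟧ * f i) ≡ f x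
    pick = ∑-⟦⟧-pick n 0<n pf

module ConvolutionRing (n : ℕ) (0<n : 0 ℕ.< n) where

  -- The group ring of ℤ/n over ℤ, with pointwise equality, packaged so that `freshman` and the
  -- powers of a semiring apply to it.
  convSemiring : CommutativeSemiring 0ℓ 0ℓ
  convSemiring = record
    { Carrier = ∃ (Periodic n)
    ; _≈_ = λ f g → ∀ x → proj₁ f x ≡ proj₁ g x
    ; _+_ = λ { (f , p) (g , q) → (λ x → f x + g x) , λ x → cong₂ _+_ (p x) (q x) }
    ; _*_ = λ { (f , p) (g , q) → conv n f g , conv-periodic n f q }
    ; 0# = (λ _ → 0ℤ) , λ _ → refl
    ; 1# = δ n , δ-periodic n
    ; isCommutativeSemiring = isCommutativeSemiringˡ record
      { +-isCommutativeMonoid = record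
        { isMonoid = record
          { isSemigroup = record
            { isMagma = record
              { isEquivalence = equiv
              ; ∙-cong = λ e e′ x → cong₂ _+_ (e x) (e′ x) }
            ; assoc = λ f g h x → +-assoc (proj₁ f x) (proj₁ g x) (proj₁ h x) }
          ; identity = (λ f x → +-identityˡ (proj₁ f x)) , (λ f x → +-identityʳ (proj₁ f x)) }
        ; comm = λ f g x → +-comm (proj₁ f x) (proj₁ g x) }
      ; *-isCommutativeMonoid = record
        { isMonoid = record
          { isSemigroup = record
            { isMagma = record
              { isEquivalence = equiv
              ; ∙-cong = λ e e′ → conv-cong n e e′ }
            ; assoc = λ { (f , _) (g , pg) (h , ph) → conv-assoc n {f} pg ph } }
          ; identity = (λ { (f , pf) x → trans (conv-comm n (δ-periodic n) pf x) (conv-δʳ n 0<n pf x) })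
                     , (λ { (f , pf) → conv-δʳ n 0<n pf }) }
        ; comm = λ { (f , pf) (g , pg) → conv-comm n pf pg } }
      ; distribʳ = λ { (h , _) (f , _) (g , _) → conv-+ˡ n f g h }
      ; zeroˡ = λ { (f , _) → conv-zeroˡ n f }
      }
    }
    where
    equiv : IsEquivalence (λ (f g : ∃ (Periodic n)) → ∀ x → proj₁ f x ≡ proj₁ g x)
    equiv = record { refl = λ _ → refl ; sym = λ e x → sym (e x) ; trans = λ e e′ x → trans (e x) (e′ x) }

  open CommutativeSemiring convSemiring using (semiring; _≈_; Carrier) renaming (_+_ to _⊕_; _*_ to _⊛_)
  open SemiringMult semiring using () renaming (_×_ to _·_)
  open SemiringExp semiring using (^-congˡ) renaming (_^_ to _↑_)

  -- The group ring element c X^j.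
  monomial : ℤ → ℤ → Carrier
  monomial c j = (λ x → c * ⟦ + n ∣ x - j ⟧) , λ x → cong (c *_) (periodic-+ n (- j) (δ-periodic n) x)

  monomial-↑ : ∀ c j k x → proj₁ (monomial c j ↑ k) x ≡ c ^ k * ⟦ + n ∣ x - + k * j ⟧
  monomial-↑ c j zero    x = trans (cong ⟦ + n ∣_⟧ (lem x j)) (sym (*-identityˡ _))
    where
    lem : ∀ x j → x ≡ x - 0ℤ * j
    lem = solve-∀
  monomial-↑ c j (suc k) x = begin
    conv n (λ i → c * ⟦ + n ∣ i - j ⟧) (proj₁ (monomial c j ↑ k)) x
      ≡⟨ conv-def n _ _ x ⟩
    ∑ n (λ i → c * ⟦ + n ∣ i - j ⟧ * proj₁ (monomial c j ↑ k) (x - i))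
      ≡⟨ ∑-cong n (λ i → trans (cong₂ (λ u v → c * u * v) (⟦⟧-flip i) (monomial-↑ c j k (x - i)))
            (lem₁ c ⟦ + n ∣ j - i ⟧ (c ^ k) (⟦ + n ∣ x - i - + k * j ⟧))) ⟩
    ∑ n (λ i → c * c ^ k * (⟦ + n ∣ j - i ⟧ * ⟦ + n ∣ x - i - + k * j ⟧))
      ≡⟨ ∑-*ˡ n (c * c ^ k) _ ⟩
    c * c ^ k * ∑ n (λ i → ⟦ + n ∣ j - i ⟧ * ⟦ + n ∣ x - i - + k * j ⟧)
      ≡⟨ cong (c * c ^ k *_) (∑-⟦⟧-pick n 0<n (periodic-reflect n x (periodic-+ n (- (+ k * j)) (δ-periodic n))) j) ⟩
    c * c ^ k * ⟦ + n ∣ x - j - + k * j ⟧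
      ≡⟨ cong (λ z → c * c ^ k * ⟦ + n ∣ z ⟧) (lem₂ x j (+ k)) ⟩
    c * c ^ k * ⟦ + n ∣ x - + suc k * j ⟧ ∎
    where
    open ≡-Reasoning
    lem₁ : ∀ c u d v → c * u * (d * v) ≡ c * d * (u * v)
    lem₁ = solve-∀
    lem₂ : ∀ x j k → x - j - k * j ≡ x - (1ℤ + k) * j
    lem₂ = solve-∀
    ⟦⟧-flip : ∀ i → ⟦ + n ∣ i - j ⟧ ≡ ⟦ + n ∣ j - i ⟧
    ⟦⟧-flip i = ⟦⟧-⇔ {+ n} {+ n} {i - j} {j - i} (∣-flip i j) (∣-flip j i)

  -- The truncation f(0) + f(1) X + ... + f(m-1) X^(m-1). Adding one monomial at a time fits the two
  -- summands of `freshman`.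
  partial : (ℤ → ℤ) → ℕ → Carrier
  partial f m = (λ x → ∑ m (λ i → f i * ⟦ + n ∣ x - i ⟧)) ,
    λ x → ∑-cong m (λ i → cong (f i *_) (periodic-+ n (- i) (δ-periodic n) x))

  ·-apply : ∀ k (f : Carrier) x → proj₁ (k · f) x ≡ proj₁ f x * + k
  ·-apply zero    f x = sym (*-zeroʳ (proj₁ f x))
  ·-apply (suc k) f x = trans (cong (λ z → proj₁ f x + z) (·-apply k f x)) (lem (proj₁ f x) (+ k))
    where
    lem : ∀ c k → c + c * k ≡ c * (1ℤ + k)
    lem = solve-∀

  pow : (ℤ → ℤ) → ℕ → ℤ → ℤ
  pow f zero    = δ n
  pow f (suc k) = conv n f (pow f k)

  ↑-pow : ∀ {f} (pf : Periodic n f) k x → proj₁ ((f , pf) ↑ k) x ≡ pow f k x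
  ↑-pow pf zero    x = refl
  ↑-pow {f} pf (suc k) x = conv-cong n {f} {f} {proj₁ ((f , pf) ↑ k)} {pow f k} (λ _ → refl) (↑-pow pf k) x

  opaque
    -- Each new monomial contributes f(m)^p X^(p m) up to a multiple of `p`, and `fermat` replaces
    -- f(m)^p by f(m).
    frobenius : ∀ {p} → Prime p → ∀ {f} → Periodic n f → ∀ y →
      + p ∣ pow f p y - ∑ n (λ i → f i * ⟦ + n ∣ y - + p * i ⟧)
    frobenius {p} pr {f} pf y =
      subst (λ z → + p ∣ z - ∑ n (λ i → f i * ⟦ + n ∣ y - + p * i ⟧))
            (trans (^-congˡ p {partial f n} {f , pf} (λ x → trans (sym (conv-def n f (δ n) x)) (conv-δʳ n 0<n pf x)) y) (↑-pow pf p y)) (go n)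
      where
      zero↑ : ∀ {p} → Prime p → ∀ x → proj₁ (partial f 0 ↑ p) x ≡ 0ℤ
      zero↑ {zero}  pr x = contradiction (prime⇒nonTrivial pr) λ ()
      zero↑ {suc p} pr x = CommutativeSemiring.zeroˡ convSemiring (partial f 0 ↑ p) x
      go : ∀ m → + p ∣ proj₁ (partial f m ↑ p) y - ∑ m (λ i → f i * ⟦ + n ∣ y - + p * i ⟧)
      go zero    = divides 0ℤ (trans (cong (_- 0ℤ) (zero↑ pr y)) (sym (*-zeroˡ (+ p))))
      go (suc m) with Freshman.freshman convSemiring pr (partial f m) (monomial (f (+ m)) (+ m))
      ... | z , e = subst (+ p ∣_) (sym eq)
                      (∣m∣n⇒∣m+n (∣m∣n⇒∣m+n (go m) (∣m⇒∣m*n X (fermat pr c))) (∣n⇒∣m*n (proj₁ z y) (∣-refl {+ p})))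
        where
        c X A B : ℤ
        c = f (+ m)
        X = ⟦ + n ∣ y - + p * + m ⟧
        A = proj₁ (partial f m ↑ p) y
        B = ∑ m (λ i → f i * ⟦ + n ∣ y - + p * i ⟧)
        lem : ∀ A B c c′ X w → (A + c′ * X + w) - (B + c * X) ≡ ((A - B) + (c′ - c) * X) + w
        lem = solve-∀
        eq : proj₁ (partial f (suc m) ↑ p) y - (B + c * X) ≡ ((A - B) + (c ^ p - c) * X) + proj₁ z y * + p
        eq = trans (cong (_- (B + c * X)) (trans (e y) (cong₂ _+_ (cong (λ w → A + w) (monomial-↑ c (+ m) p y)) (·-apply p z y))))
                   (lem A B c (c ^ p) X (proj₁ z y * + p))

-- Primes

prime>1 : ∀ {p} → Prime p → 1 ℕ.< p
prime>1 {p} pr = ℕ.nonTrivial⇒n>1 p {{prime⇒nonTrivial pr}}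

prime∤1 : ∀ {p} → Prime p → ¬ p ℕ∣.∣ 1
prime∤1 pr d = ℕₚ.<⇒≢ (prime>1 pr) (sym (ℕ∣.∣1⇒≡1 d))

prime∣prime : ∀ {p q} → Prime p → Prime q → p ℕ∣.∣ q → p ≡ q
prime∣prime pp pq d with prime⇒irreducible pq d
... | inj₁ refl = contradiction (ℕ∣.∣-refl) (prime∤1 pp)
... | inj₂ e = e

prime∣^ : ∀ {p q} → Prime p → Prime q → ∀ e → p ℕ∣.∣ q ℕ.^ e → p ≡ q
prime∣^ pp pq zero    d = contradiction d (prime∤1 pp)
prime∣^ {p} {q} pp pq (suc e) d with euclidsLemma q (q ℕ.^ e) pp d
... | inj₁ d₁ = prime∣prime pp pq d₁
... | inj₂ d₂ = prime∣^ pp pq e d₂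

opaque
  euclidℤ : ∀ {p} → Prime p → ∀ x y → + p ∣ x * y → + p ∣ x ⊎ + p ∣ y
  euclidℤ {p} pr x y d with euclidsLemma (abs x) (abs y) pr (subst (p ℕ∣.∣_) (abs-* x y) (∣⇒∣ᵤ d))
  ... | inj₁ e = inj₁ (∣ᵤ⇒∣ e)
  ... | inj₂ e = inj₂ (∣ᵤ⇒∣ e)

prime-factor : ∀ n → n ≢ 0 → n ≢ 1 → ∃ λ p → Prime p × p ℕ∣.∣ n
prime-factor n n≢0 n≢1 with factorise n {{ℕ.≢-nonZero n≢0}}
... | record { factors = [] ; isFactorisation = e } = contradiction e n≢1
... | record { factors = p ∷ ps ; isFactorisation = e ; factorsPrime = pr ∷ _ } =
  p , pr , ℕ∣.divides (product ps) (trans e (ℕₚ.*-comm p (product ps)))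

exact-power : ∀ {p} → Prime p → ∀ n → 0 ℕ.< n → ∃ λ e → ∃ λ m → n ≡ m ℕ.* p ℕ.^ e × ¬ p ℕ∣.∣ m
exact-power {p} pr = <-rec _ go
  where
  go : ∀ n → (∀ {k} → k ℕ.< n → 0 ℕ.< k → ∃ λ e → ∃ λ m → k ≡ m ℕ.* p ℕ.^ e × ¬ p ℕ∣.∣ m) →
       0 ℕ.< n → ∃ λ e → ∃ λ m → n ≡ m ℕ.* p ℕ.^ e × ¬ p ℕ∣.∣ m
  go n rec 0<n with p ℕ∣.∣? n
  ... | no p∤n = 0 , n , sym (ℕₚ.*-identityʳ n) , p∤n
  ... | yes (ℕ∣.divides (suc k) e) with rec {suc k} k<n (ℕ.s≤s ℕ.z≤n)
    where
    k<n : suc k ℕ.< n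
    k<n = subst (suc k ℕ.<_) (sym e) (ℕₚ.m<m*n (suc k) p (prime>1 pr))
  ... | e′ , m , eq , p∤m = suc e′ , m ,
    trans e (trans (cong (ℕ._* p) eq) (trans (ℕₚ.*-assoc m _ p) (cong (m ℕ.*_) (ℕₚ.*-comm _ p)))) , p∤m
  go n rec 0<n | yes (ℕ∣.divides zero e) = contradiction (sym e) (ℕₚ.<⇒≢ 0<n)

halve : ∀ n → ∃ λ j → n ≡ j ℕ.+ j ⊎ n ≡ suc (j ℕ.+ j)
halve zero = 0 , inj₁ refl
halve (suc n) with halve n
... | j , inj₁ e = j , inj₂ (cong suc e)
... | j , inj₂ e = suc j , inj₁ (trans (cong suc e) (cong suc (sym (ℕₚ.+-suc j j))))

odd-prime : ∀ {p} → Prime p → p ≢ 2 → ∃ λ j → p ≡ suc (suc j ℕ.+ suc j)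
odd-prime {p} pr p≢2 with halve p
... | j , inj₁ e = contradiction (sym (prime∣prime prime[2] pr (ℕ∣.divides j (trans e (trans (cong (j ℕ.+_) (sym (ℕₚ.+-identityʳ j))) (ℕₚ.*-comm 2 j)))))) p≢2
... | zero , inj₂ refl = contradiction (ℕ∣.∣-refl) (prime∤1 pr)
... | suc j , inj₂ e = j , e

opaque
  -- By Fermat the inverse is x^(p-2). It is reduced modulo `p` to a natural number because it
  -- becomes a factor of a natural multiplier.
  modular-inverse : ∀ {p} → Prime p → ∀ x → ¬ + p ∣ x → ∃ λ i → + p ∣ + i * x - 1ℤ
  modular-inverse {zero}        pr x p∤x = contradiction (prime>1 pr) λ ()
  modular-inverse {suc zero}    pr x p∤x = contradiction (prime>1 pr) (ℕₚ.<-irrefl refl)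
  modular-inverse {p@(suc (suc q))} pr x p∤x = i , subst (+ p ∣_) (sym eq) (∣m∣n⇒∣m-n p∣A (∣n⇒∣m*n (y /ℕ p * x) (∣-refl {+ p})))
    where
    y : ℤ
    y = x ^ q
    i : ℕ
    i = y %ℕ p
    p∣A : + p ∣ x * y - 1ℤ
    p∣A with euclidℤ pr x (x * y - 1ℤ) (subst (+ p ∣_) (lem x y) (fermat pr x))
      where
      lem : ∀ x y → x * (x * y) - x ≡ x * (x * y - 1ℤ)
      lem = solve-∀
    ... | inj₁ d = contradiction d p∤x
    ... | inj₂ d = d
    lem : ∀ r d p x → r * x - 1ℤ ≡ (x * (r + d * p) - 1ℤ) - d * x * p
    lem = solve-∀
    eq : + i * x - 1ℤ ≡ (x * y - 1ℤ) - y /ℕ p * x * + p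
    eq = trans (lem (+ i) (y /ℕ p) (+ p) x) (cong (λ z → (x * z - 1ℤ) - y /ℕ p * x * + p) (sym (a≡a%ℕn+[a/ℕn]*n y p)))

-- `v` is the `p`-adic valuation of `x`. That it lies below `f` is recorded as the positive gap
-- `suc w`, so that `p ^ suc w` is visibly divisible by `p`.
low-valuation : ∀ p f x → ¬ + (p ℕ.^ f) ∣ x →
  ∃ λ v → ∃ λ w → ∃ λ y → f ≡ suc w ℕ.+ v × x ≡ + (p ℕ.^ v) * y × ¬ + p ∣ y
low-valuation p zero    x h = contradiction (divides x (sym (*-identityʳ x))) h
low-valuation p (suc f) x h with + p ∣? x
... | no p∤x = 0 , f , x , cong suc (sym (ℕₚ.+-identityʳ f)) , sym (*-identityˡ x) , p∤x
... | yes (divides q refl) with low-valuation p f q (λ { (divides r refl) → h (divides r (trans (lem r (+ (p ℕ.^ f)) (+ p)) (cong (r *_) (sym (pos-* p (p ℕ.^ f)))))) })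
  where
  lem : ∀ r a b → r * a * b ≡ r * (b * a)
  lem = solve-∀
... | v , w , y , refl , refl , p∤y = suc v , w , y , cong suc (sym (ℕₚ.+-suc w v)) ,
    trans (lem (+ (p ℕ.^ v)) y (+ p)) (cong (_* y) (sym (pos-* p (p ℕ.^ v)))) , p∤y
  where
  lem : ∀ a y p → a * y * p ≡ p * a * y
  lem = solve-∀

-- Functions satisfying a cubic equation under convolution

Small : ℤ → Set
Small v = v ≡ 0ℤ ⊎ v ≡ 1ℤ ⊎ v ≡ + 2

-- Values among 0, 1, 2 differ by at most 2, so any modulus above 2 separates them. This is how
-- congruences become equalities.
small-≡ : ∀ {p u v} → 2 ℕ.< p → Small u → Small v → + p ∣ u - v → u ≡ v
small-≡ 2<p (inj₁ refl) (inj₁ refl) d = refl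
small-≡ 2<p (inj₁ refl) (inj₂ (inj₁ refl)) d = contradiction (∣⇒∣ᵤ d) (ℕ∣.>⇒∤ (ℕₚ.<-trans (ℕₚ.n<1+n 1) 2<p))
small-≡ 2<p (inj₁ refl) (inj₂ (inj₂ refl)) d = contradiction (∣⇒∣ᵤ d) (ℕ∣.>⇒∤ 2<p)
small-≡ 2<p (inj₂ (inj₁ refl)) (inj₁ refl) d = contradiction (∣⇒∣ᵤ d) (ℕ∣.>⇒∤ (ℕₚ.<-trans (ℕₚ.n<1+n 1) 2<p))
small-≡ 2<p (inj₂ (inj₁ refl)) (inj₂ (inj₁ refl)) d = refl
small-≡ 2<p (inj₂ (inj₁ refl)) (inj₂ (inj₂ refl)) d = contradiction (∣⇒∣ᵤ d) (ℕ∣.>⇒∤ (ℕₚ.<-trans (ℕₚ.n<1+n 1) 2<p))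
small-≡ 2<p (inj₂ (inj₂ refl)) (inj₁ refl) d = contradiction (∣⇒∣ᵤ d) (ℕ∣.>⇒∤ 2<p)
small-≡ 2<p (inj₂ (inj₂ refl)) (inj₂ (inj₁ refl)) d = contradiction (∣⇒∣ᵤ d) (ℕ∣.>⇒∤ (ℕₚ.<-trans (ℕₚ.n<1+n 1) 2<p))
small-≡ 2<p (inj₂ (inj₂ refl)) (inj₂ (inj₂ refl)) d = refl

Cubic : ℕ → ℤ → (ℤ → ℤ) → Set
Cubic n Δ Y = ∃ λ c → ∀ x → conv n Y (conv n Y Y) x ≡ Δ * Δ * Y x + c

^-*-odd : ∀ Δ j → Δ ^ suc (j ℕ.+ j) ≡ Δ * (Δ * Δ) ^ j
^-*-odd Δ zero    = refl
^-*-odd Δ (suc j) = trans (cong (λ k → Δ * (Δ * Δ ^ k)) (ℕₚ.+-suc j j))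
  (trans (cong (λ z → Δ * (Δ * z)) (^-*-odd Δ j)) (lem Δ ((Δ * Δ) ^ j)))
  where
  lem : ∀ d e → d * (d * (d * e)) ≡ d * (d * d * e)
  lem = solve-∀

module CubicFunction (n : ℕ) (0<n : 0 ℕ.< n) (Δ : ℤ) (Y : ℤ → ℤ)
  (perY : Periodic n Y) (cubic : Cubic n Δ Y) where

  open ConvolutionRing n 0<n

  opaque
    -- Two more factors `Y` turn `Y` into Δ² `Y` plus a constant, and a constant function stays
    -- constant under convolution, so a single constant has to be tracked.
    odd-power : ∀ j → ∃ λ c → ∀ x → pow Y (suc (j ℕ.+ j)) x ≡ (Δ * Δ) ^ j * Y x + c
    odd-power zero    = 0ℤ , λ x → trans (conv-δʳ n 0<n perY x) (lem (Y x))
      where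
      lem : ∀ y → y ≡ 1ℤ * y + 0ℤ
      lem = solve-∀
    odd-power (suc j) with odd-power j
    ... | c , e = d * c₀ + c * s * s , λ x →
          trans (cong (λ k → conv n Y (conv n Y (pow Y k)) x) (ℕₚ.+-suc j j))
          (trans (conv-cong n (λ _ → refl) (conv-cong n (λ _ → refl) e) x)
          (trans (conv-cong n (λ _ → refl) inner x)
          (trans (conv-+ʳ n Y (λ x → d * conv n Y Y x) (λ _ → s * c) x)
          (trans (cong₂ _+_ (trans (conv-*ʳ n d Y (conv n Y Y) x) (cong (d *_) (proj₂ cubic x))) (conv-constʳ n Y (s * c) x))
                 (lem d (Δ * Δ) (Y x) c₀ c s)))))
      where
      c₀ d s : ℤ
      c₀ = proj₁ cubic
      d = (Δ * Δ) ^ j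
      s = ∑ n Y
      inner : ∀ x → conv n Y (λ x → d * Y x + c) x ≡ d * conv n Y Y x + s * c
      inner x = trans (conv-+ʳ n Y (λ x → d * Y x) (λ _ → c) x)
                      (cong₂ _+_ (conv-*ʳ n d Y Y x) (conv-constʳ n Y c x))
      lem : ∀ d D y c₀ c s → d * (D * y + c₀) + s * (s * c) ≡ D * d * y + (d * c₀ + c * s * s)
      lem = solve-∀

    -- `d` is Δ^(p-1), known modulo `p` from Fermat. Oddness of `p` is what makes the `p`-th power
    -- linear in `Y`.
    frobenius-congruence : ∀ {p} → Prime p → p ≢ 2 → ∃ λ d → ∃ λ c →
      (+ p ∣ Δ → + p ∣ d) × (¬ + p ∣ Δ → + p ∣ d - 1ℤ) ×
      (∀ y → + p ∣ (d * Y y + c) - ∑ n (λ i → Y i * ⟦ + n ∣ y - + p * i ⟧))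
    frobenius-congruence {p} pr p≢2 with odd-prime pr p≢2
    ... | j , p≡ with odd-power (suc j)
    ...   | c , e = d , c , (λ p∣Δ → ∣m⇒∣m*n ((Δ * Δ) ^ j) (∣m⇒∣m*n Δ p∣Δ)) , unit ,
            λ y → subst (λ z → + p ∣ z - ∑ n (λ i → Y i * ⟦ + n ∣ y - + p * i ⟧))
                        (trans (cong (λ k → pow Y k y) p≡) (e y)) (frobenius pr perY y)
      where
      d : ℤ
      d = (Δ * Δ) ^ suc j
      lem : ∀ a b → a * b - a ≡ a * (b - 1ℤ)
      lem = solve-∀
      Δ^p-Δ : Δ ^ p - Δ ≡ Δ * (d - 1ℤ)
      Δ^p-Δ = trans (cong (_- Δ) (trans (cong (Δ ^_) p≡) (^-*-odd Δ (suc j)))) (lem Δ d)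
      unit : ¬ + p ∣ Δ → + p ∣ d - 1ℤ
      unit p∤Δ with euclidℤ pr Δ (d - 1ℤ) (subst (+ p ∣_) Δ^p-Δ (fermat pr Δ))
      ... | inj₁ p∣Δ = contradiction p∣Δ p∤Δ
      ... | inj₂ p∣d = p∣d

  sum-coprime : ∀ {q} → Prime q → ¬ q ℕ∣.∣ n → ∀ x →
    ∑ n (λ i → Y i * ⟦ + n ∣ + q * x - + q * i ⟧) ≡ Y x
  sum-coprime {q} pr q∤n x = trans (∑-cong n (λ i → trans (*-comm (Y i) _) (cong (_* Y i) (eq i)))) (∑-⟦⟧-pick n 0<n perY x)
    where
    lem : ∀ q x i → q * x - q * i ≡ q * (x - i)
    lem = solve-∀
    coprime : Coprime n q
    coprime (d₁ , d₂) with prime⇒irreducible pr d₂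
    ... | inj₁ e = e
    ... | inj₂ refl = contradiction d₁ q∤n
    eq : ∀ i → ⟦ + n ∣ + q * x - + q * i ⟧ ≡ ⟦ + n ∣ x - i ⟧
    eq i = ⟦⟧-⇔ {+ n} {+ n} {+ q * x - + q * i} {x - i}
      (λ d → ∣ᵤ⇒∣ (coprime-divisor coprime (subst (n ℕ∣.∣_) (trans (cong abs (lem (+ q) x i)) (abs-* (+ q) (x - i))) (∣⇒∣ᵤ d))))
      (λ d → subst (+ n ∣_) (sym (lem (+ q) x i)) (∣n⇒∣m*n (+ q) d))

  -- At `+ q * x` the congruence reads d Y(q x) + c ≡ Y(x). If `q` divides `Δ`, the first term drops
  -- out and `Y` is constant modulo `q`; otherwise d ≡ 1, and x = 0 shows c ≡ 0.
  multiplier-congruence : ∀ {q} → Prime q → q ≢ 2 → ¬ q ℕ∣.∣ n → ∀ x → + q ∣ Y x - Y (+ q * x)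
  multiplier-congruence {q} pr q≢2 q∤n x with frobenius-congruence pr q≢2
  ... | d , c , div , unit , cong-y = go (+ q ∣? Δ)
    where
    at : ∀ x → + q ∣ (d * Y (+ q * x) + c) - Y x
    at x = subst (λ z → + q ∣ (d * Y (+ q * x) + c) - z) (sum-coprime pr q∤n x) (cong-y (+ q * x))
    go : Dec (+ q ∣ Δ) → + q ∣ Y x - Y (+ q * x)
    go (yes q∣Δ) = subst (+ q ∣_) (lem d (Y (+ q * x)) (Y (+ q * (+ q * x))) c (Y x))
                     (∣m∣n⇒∣m+n (∣m∣n⇒∣m-n (at (+ q * x)) (at x)) (∣m⇒∣m*n (Y (+ q * x) - Y (+ q * (+ q * x))) (div q∣Δ)))
      where
      lem : ∀ d b b′ c a → ((d * b′ + c) - b) - ((d * b + c) - a) + d * (b - b′) ≡ a - b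
      lem = solve-∀
    go (no q∤Δ) = subst (+ q ∣_) (lem d (Y (+ q * x)) (Y 0ℤ) c (Y x))
                     (∣m∣n⇒∣m+n (∣m∣n⇒∣m-n at0 (at x)) (∣n⇒∣m*n (Y (+ q * x) - Y 0ℤ) (unit q∤Δ)))
      where
      at0 : + q ∣ (d * Y 0ℤ + c) - Y 0ℤ
      at0 = subst (λ z → + q ∣ (d * Y z + c) - Y 0ℤ) (*-zeroʳ (+ q)) (at 0ℤ)
      lem : ∀ d b y₀ c a → ((d * y₀ + c) - y₀) - ((d * b + c) - a) + (b - y₀) * (d - 1ℤ) ≡ a - b
      lem = solve-∀

  -- Multiplication by `p` on ℤ/n has its kernel generated by `h`, so the coefficient at `+ p * x`
  -- collects a whole coset of the subgroup of order `p`.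
  sum-multiple : ∀ {p h} → Prime p → n ≡ p ℕ.* h → ∀ x →
    ∑ n (λ i → Y i * ⟦ + n ∣ + p * x - + p * i ⟧) ≡ ∑ p (λ j → Y (x + j * + h))
  sum-multiple {p} {h} pr n≡ph x =
    trans (∑-cong n (λ i → trans (*-comm (Y i) _) (cong (_* Y i) (eq i))))
          (∑-⟦⟧-coset n p h n≡ph 0<h perY x)
    where
    0<h : 0 ℕ.< h
    0<h = ℕₚ.n≢0⇒n>0 λ { refl → ℕₚ.<⇒≢ 0<n (sym (trans n≡ph (ℕₚ.*-zeroʳ p))) }
    instance _ = prime⇒nonZero pr
    lem : ∀ q x i → q * x - q * i ≡ q * (x - i)
    lem = solve-∀
    eq : ∀ i → ⟦ + n ∣ + p * x - + p * i ⟧ ≡ ⟦ + h ∣ x - i ⟧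
    eq i = ⟦⟧-⇔ {+ n} {+ h} {+ p * x - + p * i} {x - i}
      (λ d → *-cancelˡ-∣ (+ p) (subst₂ _∣_ (trans (cong +_ n≡ph) (pos-* p h)) (lem (+ p) x i) d))
      (λ d → subst₂ _∣_ (sym (trans (cong +_ n≡ph) (pos-* p h))) (sym (lem (+ p) x i)) (*-monoʳ-∣ (+ p) d))

  sum-nonmultiple : ∀ {p} → p ℕ∣.∣ n → ∀ y → ¬ + p ∣ y → ∑ n (λ i → Y i * ⟦ + n ∣ y - + p * i ⟧) ≡ 0ℤ
  sum-nonmultiple {p} p∣n y p∤y = trans (∑-cong n (λ i → trans (cong (Y i *_) (⟦⟧-no {+ n} {y - + p * i} (λ d →
      p∤y (∣m+n∣n⇒∣m (∣-trans (∣ᵤ⇒∣ p∣n) d) (∣m⇒∣-m (∣m⇒∣m*n i (∣-refl {+ p}))))))) (*-zeroʳ (Y i))))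
    (trans (∑-const n 0ℤ) (*-zeroʳ (+ n)))

odd-prime>2 : ∀ {p} → Prime p → p ≢ 2 → 2 ℕ.< p
odd-prime>2 pr p≢2 = ℕₚ.≤∧≢⇒< (prime>1 pr) (p≢2 ∘ sym)

-- `small` leaves out the multiples of `n`, because there the value of `U` will be `- β`, about
-- which nothing is known at first.
module SmallCubic (n : ℕ) (0<n : 0 ℕ.< n) (2∤n : ¬ 2 ℕ∣.∣ n) (Δ : ℤ) (Y : ℤ → ℤ)
  (perY : Periodic n Y) (cubic : Cubic n Δ Y) (small : ∀ x → ¬ + n ∣ x → Small (Y x)) where

  open CubicFunction n 0<n Δ Y perY cubic

  ≡-of-congruence : ∀ {p} → Prime p → p ≢ 2 → ∀ x y → ¬ + n ∣ x → ¬ + n ∣ y → + p ∣ Y x - Y y → Y x ≡ Y y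
  ≡-of-congruence pr p≢2 x y n∤x n∤y = small-≡ (odd-prime>2 pr p≢2) (small x n∤x) (small y n∤y)

  prime-multiplier : ∀ {q} → Prime q → q ≢ 2 → ¬ q ℕ∣.∣ n → ∀ x → Y (+ q * x) ≡ Y x
  prime-multiplier {q} pr q≢2 q∤n x with + n ∣? x
  ... | yes n∣x = periodic-≡ perY {+ q * x} {x} (∣m∣n⇒∣m-n (∣n⇒∣m*n (+ q) n∣x) n∣x)
  ... | no n∤x = sym (≡-of-congruence pr q≢2 x (+ q * x) n∤x n∤qx (multiplier-congruence pr q≢2 q∤n x))
    where
    coprime : Coprime n q
    coprime (d₁ , d₂) with prime⇒irreducible pr d₂
    ... | inj₁ e = e
    ... | inj₂ refl = contradiction d₁ q∤n
    n∤qx : ¬ + n ∣ + q * x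
    n∤qx d = n∤x (∣ᵤ⇒∣ (coprime-divisor coprime (subst (n ℕ∣.∣_) (abs-* (+ q) x) (∣⇒∣ᵤ d))))

  odd-multiplier : ∀ t → t ≢ 0 → ¬ 2 ℕ∣.∣ t → (∀ {q} → Prime q → q ℕ∣.∣ t → ¬ q ℕ∣.∣ n) → ∀ x → Y (+ t * x) ≡ Y x
  odd-multiplier t t≢0 2∤t cop x = trans (cong (λ s → Y (+ s * x)) eq)
      (go factors factorsPrime (2∤t ∘ subst (2 ℕ∣.∣_) (sym eq)) (λ pr d → cop pr (subst (_ ℕ∣.∣_) (sym eq) d)) x)
    where
    open PrimeFactorisation (factorise t {{ℕ.≢-nonZero t≢0}}) renaming (isFactorisation to eq)
    go : ∀ ps → All Prime ps → ¬ 2 ℕ∣.∣ product ps → (∀ {q} → Prime q → q ℕ∣.∣ product ps → ¬ q ℕ∣.∣ n) →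
         ∀ x → Y (+ product ps * x) ≡ Y x
    go [] [] _ _ x = cong Y (*-identityˡ x)
    go (p ∷ ps) (pr ∷ prs) 2∤ cop x =
      trans (cong Y (trans (cong (_* x) (pos-* p (product ps))) (*-assoc (+ p) (+ product ps) x)))
      (trans (prime-multiplier pr (λ { refl → 2∤ (ℕ∣.m∣m*n (product ps)) }) (cop pr (ℕ∣.m∣m*n (product ps))) (+ product ps * x))
             (go ps prs (λ d → 2∤ (ℕ∣.∣n⇒∣m*n p d)) (λ prq d → cop prq (ℕ∣.∣n⇒∣m*n p d)) x))

  multiplier : ∀ t → t ≢ 0 → (∀ {q} → Prime q → q ℕ∣.∣ t → ¬ q ℕ∣.∣ n) → ∀ x → Y (+ t * x) ≡ Y x
  multiplier t t≢0 cop x with 2 ℕ∣.∣? t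
  ... | no 2∤t = odd-multiplier t t≢0 2∤t cop x
  -- An even `t` is replaced by `t + n`: this is odd because `n` is, is still coprime to `n`, has
  -- the same effect on residues, and avoids the prime 2.
  ... | yes 2∣t = trans (sym (trans (cong Y (trans (cong (_* x) (pos-+ t n)) (lem (+ t) (+ n) x))) (periodic-multiple perY x (+ t * x))))
      (odd-multiplier (t ℕ.+ n) (t≢0 ∘ ℕₚ.m+n≡0⇒m≡0 t)
        (λ d → 2∤n (ℕ∣.∣m+n∣m⇒∣n d 2∣t))
        (λ {q} pr d e → cop pr (ℕ∣.∣m+n∣m⇒∣n (subst (q ℕ∣.∣_) (ℕₚ.+-comm t n) d) e) e) x)
    where
    lem : ∀ t n x → (t + n) * x ≡ t * x + x * n
    lem = solve-∀

  -- `p ^ suc e` is the exact power of `p` in `n`, and `h` = n/p generates the subgroup of order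
  -- `p`.
  module AtPrime {p} (pr : Prime p) (e m : ℕ) (n≡ : n ≡ m ℕ.* p ℕ.^ suc e) (p∤m : ¬ p ℕ∣.∣ m) where

    h : ℕ
    h = m ℕ.* p ℕ.^ e

    n≡ph : n ≡ p ℕ.* h
    n≡ph = trans n≡ (trans (sym (ℕₚ.*-assoc m p _)) (trans (cong (ℕ._* p ℕ.^ e) (ℕₚ.*-comm m p)) (ℕₚ.*-assoc p m _)))

    p∣n : p ℕ∣.∣ n
    p∣n = ℕ∣.divides h (trans n≡ph (ℕₚ.*-comm p h))

    p≢2 : p ≢ 2
    p≢2 refl = 2∤n p∣n

    +h≡ : + h ≡ + m * + (p ℕ.^ e)
    +h≡ = pos-* m (p ℕ.^ e)

    +n≡ph : + n ≡ + p * + h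
    +n≡ph = trans (cong +_ n≡ph) (pos-* p h)

    +p^≡ : + (p ℕ.^ suc e) ≡ + p * + (p ℕ.^ e)
    +p^≡ = pos-* p (p ℕ.^ e)

    p^e∣h : + (p ℕ.^ e) ∣ + h
    p^e∣h = divides (+ m) +h≡

    -- Being 1 modulo `m`, the multiplier can share no prime with `n` except `p`.
    multiplier₁ : ∀ i → ¬ p ℕ∣.∣ suc (m ℕ.* i) → ∀ x → Y (+ suc (m ℕ.* i) * x) ≡ Y x
    multiplier₁ i p∤t = multiplier (suc (m ℕ.* i)) (λ ()) cop
      where
      cop : ∀ {q} → Prime q → q ℕ∣.∣ suc (m ℕ.* i) → ¬ q ℕ∣.∣ n
      cop {q} prq q∣t q∣n with euclidsLemma m (p ℕ.^ suc e) prq (subst (q ℕ∣.∣_) n≡ q∣n)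
      ... | inj₁ q∣m = prime∤1 prq (ℕ∣.∣m+n∣m⇒∣n (subst (q ℕ∣.∣_) (ℕₚ.+-comm 1 (m ℕ.* i)) q∣t) (ℕ∣.∣m⇒∣m*n i q∣m))
      ... | inj₂ q∣p with prime∣^ prq pr (suc e) q∣p
      ...   | refl = p∤t q∣t

    -- Multiplication by 1 + m i with p ∣ i and i x ≡ p ^ e (mod p ^ (e + 1)) moves x to x + h.
    shift-low : ∀ x → ¬ + (p ℕ.^ e) ∣ x → Y (x + + h) ≡ Y x
    shift-low x p^e∤x with low-valuation p e x p^e∤x
    ... | v , w , y , e≡ , x≡ , p∤y with modular-inverse pr y p∤y
    ...   | i₀ , divides z inv = trans (sym (periodic-≡ perY {+ suc (m ℕ.* i) * x} {x + + h} n∣)) (multiplier₁ i p∤t x)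
      where
      i : ℕ
      i = p ℕ.^ suc w ℕ.* i₀
      p∤t : ¬ p ℕ∣.∣ suc (m ℕ.* i)
      p∤t d = prime∤1 pr (ℕ∣.∣m+n∣m⇒∣n (subst (p ℕ∣.∣_) (ℕₚ.+-comm 1 (m ℕ.* i)) d)
                (ℕ∣.∣n⇒∣m*n m (ℕ∣.∣m⇒∣m*n i₀ (ℕ∣.m∣m*n (p ℕ.^ w)))))
      p^e≡ : + (p ℕ.^ e) ≡ + (p ℕ.^ suc w) * + (p ℕ.^ v)
      p^e≡ = trans (cong (λ k → + (p ℕ.^ k)) e≡) (trans (cong +_ (ℕₚ.^-distribˡ-+-* p (suc w) v)) (pos-* (p ℕ.^ suc w) (p ℕ.^ v)))
      lem : ∀ m a i₀ b y → (1ℤ + m * (a * i₀)) * (b * y) - (b * y + m * (a * b)) ≡ m * (a * b) * (i₀ * y - 1ℤ)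
      lem = solve-∀
      lem₂ : ∀ P z p → P * (z * p) ≡ z * (p * P)
      lem₂ = solve-∀
      +t≡ : + suc (m ℕ.* i) ≡ 1ℤ + + m * (+ (p ℕ.^ suc w) * + i₀)
      +t≡ = cong (λ k → 1ℤ + k) (trans (pos-* m i) (cong (+ m *_) (pos-* (p ℕ.^ suc w) i₀)))
      h≡ : + h ≡ + m * (+ (p ℕ.^ suc w) * + (p ℕ.^ v))
      h≡ = trans +h≡ (cong (+ m *_) p^e≡)
      n∣ : + n ∣ + suc (m ℕ.* i) * x - (x + + h)
      n∣ = divides z (trans (cong₂ _-_ (cong₂ _*_ +t≡ x≡) (cong₂ _+_ x≡ h≡))
             (trans (lem (+ m) (+ (p ℕ.^ suc w)) (+ i₀) (+ (p ℕ.^ v)) y)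
             (trans (cong₂ _*_ (sym h≡) inv) (trans (lem₂ (+ h) z (+ p)) (cong (z *_) (sym +n≡ph))))))

    -- Multiplication by t ≡ 1 (mod m), t ≡ j (mod p) fixes x and moves h to j h.
    shift-high : ∀ x → + (p ℕ.^ suc e) ∣ x → ∀ j → ¬ p ℕ∣.∣ suc j → Y (x + + suc j * + h) ≡ Y (x + + h)
    shift-high x (divides r x≡) j p∤j with modular-inverse pr (+ m) (λ d → p∤m (∣⇒∣ᵤ d))
    ... | i₀ , divides z inv = trans (sym (periodic-≡ perY {+ suc (m ℕ.* i) * (x + + h)} {x + + suc j * + h} n∣)) (multiplier₁ i p∤t (x + + h))
      where
      i : ℕ
      i = i₀ ℕ.* j
      j′ : ℤ
      j′ = + j
      mi≡ : + (m ℕ.* i) ≡ j′ + j′ * z * + p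
      mi≡ = trans (trans (pos-* m i) (cong (+ m *_) (pos-* i₀ j))) (lin₁ j′ inv (lem (+ m) (+ i₀) j′ (z * + p) z (+ p)))
        where
        lem : ∀ m i₀ j zp z p → m * (i₀ * j) - (j + j * z * p) ≡ j * ((i₀ * m - 1ℤ) - z * p)
        lem = solve-∀
      p∤t : ¬ p ℕ∣.∣ suc (m ℕ.* i)
      p∤t d = p∤j (∣⇒∣ᵤ (subst (+ p ∣_) (trans (cong (λ k → 1ℤ + k - j′ * z * + p) mi≡) (lem j′ (j′ * z * + p)))
                 (∣m∣n⇒∣m-n (∣ᵤ⇒∣ {+ p} {+ suc (m ℕ.* i)} d) (∣n⇒∣m*n (j′ * z) (∣-refl {+ p})))))
        where
        lem : ∀ j′ k → 1ℤ + (j′ + k) - k ≡ 1ℤ + j′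
        lem = solve-∀
      n∣ : + n ∣ + suc (m ℕ.* i) * (x + + h) - (x + + suc j * + h)
      n∣ = divides (+ i * r + j′ * z) (begin
        (1ℤ + + (m ℕ.* i)) * (x + + h) - (x + (1ℤ + j′) * + h)
          ≡⟨ lem (+ (m ℕ.* i)) x (+ h) j′ ⟩
        + (m ℕ.* i) * x + (+ (m ℕ.* i) - j′) * + h
          ≡⟨ cong₂ _+_ (cong₂ _*_ (pos-* m i) (trans x≡ (cong (r *_) +p^≡))) (cong (λ k → (k - j′) * + h) mi≡) ⟩
        + m * + i * (r * (+ p * + (p ℕ.^ e))) + (j′ + j′ * z * + p - j′) * + h
          ≡⟨ lem₂ (+ m) (+ i) r (+ p) (+ (p ℕ.^ e)) j′ z (+ h) ⟩
        + i * r * (+ p * (+ m * + (p ℕ.^ e))) + j′ * z * (+ p * + h)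
          ≡⟨ cong₂ _+_ (cong (λ k → + i * r * k) (trans (cong (+ p *_) (sym +h≡)) (sym +n≡ph))) (cong (j′ * z *_) (sym +n≡ph)) ⟩
        + i * r * + n + j′ * z * + n
          ≡⟨ *-distribʳ-+ (+ n) (+ i * r) (j′ * z) ⟨
        (+ i * r + j′ * z) * + n ∎)
        where
        open ≡-Reasoning
        lem : ∀ t x h j → (1ℤ + t) * (x + h) - (x + (1ℤ + j) * h) ≡ t * x + (t - j) * h
        lem = solve-∀
        lem₂ : ∀ m i r p q j′ z h → m * i * (r * (p * q)) + (j′ + j′ * z * p - j′) * h ≡ i * r * (p * (m * q)) + j′ * z * (p * h)
        lem₂ = solve-∀

    shift-low-iterate : ∀ x → ¬ + (p ℕ.^ e) ∣ x → ∀ j → Y (x + + j * + h) ≡ Y x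
    shift-low-iterate x p^e∤x zero    = cong Y (+-identityʳ x)
    shift-low-iterate x p^e∤x (suc j) = trans (cong Y (lem x (+ j) (+ h)))
      (trans (shift-low (x + + j * + h) (λ d → p^e∤x (∣m+n∣n⇒∣m d (∣n⇒∣m*n (+ j) p^e∣h)))) (shift-low-iterate x p^e∤x j))
      where
      lem : ∀ x j h → x + (1ℤ + j) * h ≡ (x + j * h) + h
      lem = solve-∀

    -- The Frobenius sum at `y` is 0 modulo `p`: it vanishes if `p` does not divide `y`, and for y =
    -- p x the power p^e does not divide `x`, so `shift-low` makes it a sum of `p` equal terms. With
    -- d ≡ 1 this leaves `Y y + c`.
    nondividing : ¬ + p ∣ Δ → ∃ λ c → ∀ y → ¬ + (p ℕ.^ suc e) ∣ y → + p ∣ Y y + c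
    nondividing p∤Δ with frobenius-congruence pr p≢2
    ... | d , c , _ , unit , congr = c , go
      where
      finish : ∀ y s → + p ∣ (d * Y y + c) - s → + p ∣ s → + p ∣ Y y + c
      finish y s k l = subst (+ p ∣_) (lem d (Y y) c s) (∣m∣n⇒∣m-n (∣m∣n⇒∣m+n k l) (∣n⇒∣m*n (Y y) (unit p∤Δ)))
        where
        lem : ∀ d y c s → ((d * y + c) - s) + s - y * (d - 1ℤ) ≡ y + c
        lem = solve-∀
      go : ∀ y → ¬ + (p ℕ.^ suc e) ∣ y → + p ∣ Y y + c
      go y P∤y with + p ∣? y
      ... | no p∤y = finish y 0ℤ (subst (λ s → + p ∣ (d * Y y + c) - s) (sum-nonmultiple p∣n y p∤y) (congr y)) (divides 0ℤ refl)
      ... | yes (divides x y≡xp) = finish y (+ p * Y x) (subst (λ s → + p ∣ (d * Y y + c) - s) sum≡ (congr y)) (∣m⇒∣m*n (Y x) (∣-refl {+ p}))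
        where
        y≡ : y ≡ + p * x
        y≡ = trans y≡xp (*-comm x (+ p))
        p^e∤x : ¬ + (p ℕ.^ e) ∣ x
        p^e∤x k = P∤y (subst₂ _∣_ (sym +p^≡) (sym y≡) (*-monoʳ-∣ (+ p) k))
        sum≡ : ∑ n (λ i → Y i * ⟦ + n ∣ y - + p * i ⟧) ≡ + p * Y x
        sum≡ = trans (cong (λ y → ∑ n (λ i → Y i * ⟦ + n ∣ y - + p * i ⟧)) y≡)
               (trans (sum-multiple pr n≡ph x)
               (trans (∑-cong< p (λ j _ → shift-low-iterate x p^e∤x j)) (∑-const p (Y x))))

    -- As d ≡ 0, all Frobenius sums are congruent to `c`, and the one at 1 vanishes because 1 is not
    -- a multiple of `p`.
    coset-sum : + p ∣ Δ → ∀ x → + p ∣ ∑ p (λ j → Y (x + j * + h))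
    coset-sum p∣Δ x with frobenius-congruence pr p≢2
    ... | d , c , div , _ , congr = subst (+ p ∣_) (lem d (Y (+ p * x)) c (∑ p (λ j → Y (x + j * + h))))
            (∣m∣n⇒∣m-n (∣m∣n⇒∣m+n (∣m⇒∣m*n (Y (+ p * x)) (div p∣Δ)) p∣c) at-px)
      where
      at-px : + p ∣ (d * Y (+ p * x) + c) - ∑ p (λ j → Y (x + j * + h))
      at-px = subst (λ s → + p ∣ (d * Y (+ p * x) + c) - s) (sum-multiple pr n≡ph x) (congr (+ p * x))
      at-1 : + p ∣ (d * Y 1ℤ + c) - 0ℤ
      at-1 = subst (λ s → + p ∣ (d * Y 1ℤ + c) - s) (sum-nonmultiple p∣n 1ℤ (λ k → prime∤1 pr (∣⇒∣ᵤ k))) (congr 1ℤ)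
      p∣c : + p ∣ c
      p∣c = subst (+ p ∣_) (lem₁ d (Y 1ℤ) c) (∣m∣n⇒∣m-n at-1 (∣m⇒∣m*n (Y 1ℤ) (div p∣Δ)))
        where
        lem₁ : ∀ d y c → (d * y + c) - 0ℤ - d * y ≡ c
        lem₁ = solve-∀
      lem : ∀ d y c s → (d * y + c) - ((d * y + c) - s) ≡ s
      lem = solve-∀

    -- By `shift-high` all terms of the coset sum except the first agree, so it equals Y(x) + (p -
    -- 1) Y(x + h), and it is 0 modulo `p`.
    high-congruence₁ : + p ∣ Δ → ∀ x → + (p ℕ.^ suc e) ∣ x → + p ∣ Y x - Y (x + + h)
    high-congruence₁ p∣Δ x P∣x = subst (+ p ∣_) lem′ (∣m∣n⇒∣m-n (coset-sum p∣Δ x) (∣n⇒∣m*n (Y (x + + h)) (∣-refl {+ p})))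
      where
      q : ℕ
      q = ℕ.pred p
      p≡ : p ≡ suc q
      p≡ = sym (ℕₚ.suc-pred p {{prime⇒nonZero pr}})
      sum≡ : ∑ p (λ j → Y (x + j * + h)) ≡ Y x + + q * Y (x + + h)
      sum≡ = trans (cong (λ k → ∑ k (λ j → Y (x + j * + h))) p≡)
        (trans (∑-front q (λ j → Y (x + j * + h)))
        (cong₂ _+_ (cong Y (+-identityʳ x))
          (trans (∑-cong< q (λ j j<q → trans (cong (λ k → Y (x + k * + h)) (+-comm (+ j) 1ℤ))
                    (shift-high x P∣x j (ℕ∣.>⇒∤ (subst (suc j ℕ.<_) (sym p≡) (ℕ.s≤s j<q))))))
                 (∑-const q (Y (x + + h))))))
      lem : ∀ a q b → (a + q * b) - b * (1ℤ + q) ≡ a - b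
      lem = solve-∀
      lem′ : ∑ p (λ j → Y (x + j * + h)) - Y (x + + h) * + p ≡ Y x - Y (x + + h)
      lem′ = trans (cong₂ (λ s k → s - Y (x + + h) * + k) sum≡ p≡) (lem (Y x) (+ q) (Y (x + + h)))

    high-congruence : + p ∣ Δ → ∀ x → + (p ℕ.^ suc e) ∣ x → ∀ j → + p ∣ Y x - Y (x + + j * + h)
    high-congruence p∣Δ x P∣x j with p ℕ∣.∣? j
    ... | yes (ℕ∣.divides k j≡) = subst (+ p ∣_) (sym (i≡j⇒i-j≡0 (sym eq))) (divides 0ℤ refl)
      where
      lem : ∀ k p h → k * p * h ≡ k * (p * h)
      lem = solve-∀
      eq : Y (x + + j * + h) ≡ Y x
      eq = trans (cong (λ z → Y (x + z)) (trans (cong (λ j → + j * + h) j≡) (trans (cong (_* + h) (pos-* k p))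
             (trans (lem (+ k) (+ p) (+ h)) (cong (+ k *_) (sym +n≡ph)))))) (periodic-multiple perY (+ k) x)
    high-congruence p∣Δ x P∣x zero    | no p∤j = contradiction (p ℕ∣.∣0) p∤j
    high-congruence p∣Δ x P∣x (suc j) | no p∤j =
      subst (λ z → + p ∣ Y x - z) (sym (shift-high x P∣x j p∤j)) (high-congruence₁ p∣Δ x P∣x)

    -- Either `shift-low` applies, or the coset of `x` contains a multiple `x₀` of `p ^ suc e`, with
    -- which both `x` and `x + h` are compared.
    dividing : + p ∣ Δ → ∀ x → + p ∣ Y x - Y (x + + h)
    dividing p∣Δ x with + (p ℕ.^ e) ∣? x
    ... | no p^e∤x = subst (+ p ∣_) (sym (i≡j⇒i-j≡0 (sym (shift-low x p^e∤x)))) (divides 0ℤ refl)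
    ... | yes (divides x₁ x≡) with modular-inverse pr (+ m) (λ d → p∤m (∣⇒∣ᵤ d))
    ...   | i₀ , divides z inv = subst₂ (λ a b → + p ∣ Y a - Y b) (lem₃ x (+ j * + h)) (lem₄ x (+ j) (+ h))
              (subst (+ p ∣_) (lem₅ (Y x₀) (Y (x₀ + + j * + h)) (Y (x₀ + + suc j * + h)))
                (∣m∣n⇒∣m-n (high-congruence p∣Δ x₀ P∣x₀ (suc j)) (high-congruence p∣Δ x₀ P∣x₀ j)))
      where
      instance _ = prime⇒nonZero pr
      -- With x = x₁ p^e and h = m p^e, the difference x - j h is divisible by p^(e+1) as soon as j
      -- m ≡ x₁ modulo `p`; so `j` is x₁ times the inverse of `m`.
      y : ℤ
      y = + i₀ * x₁
      j : ℕ
      j = y %ℕ p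
      x₀ : ℤ
      x₀ = x - + j * + h
      lem₁ : ∀ x₁ P j m r p i₀ z → x₁ * P - j * (m * P) - (r * m - z * x₁) * (p * P)
             ≡ (i₀ * x₁ - (j + r * p)) * (m * P) + (- (x₁ * P)) * (i₀ * m - 1ℤ - z * p)
      lem₁ = solve-∀
      P∣x₀ : + (p ℕ.^ suc e) ∣ x₀
      P∣x₀ = divides (y /ℕ p * + m - z * x₁) (trans (cong₂ (λ a b → a - + j * b) x≡ +h≡)
               (trans (lin₂ (+ m * + (p ℕ.^ e)) (- (x₁ * + (p ℕ.^ e))) (a≡a%ℕn+[a/ℕn]*n y p) inv
                  (trans (lem₁ x₁ (+ (p ℕ.^ e)) (+ j) (+ m) (y /ℕ p) (+ p) (+ i₀) z)
                     (cong₂ _+_ (*-comm (y - (+ j + y /ℕ p * + p)) (+ m * + (p ℕ.^ e))) refl)))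
                  (cong ((y /ℕ p * + m - z * x₁) *_) (sym +p^≡))))
      lem₃ : ∀ x y → x - y + y ≡ x
      lem₃ = solve-∀
      lem₄ : ∀ x j h → x - j * h + (1ℤ + j) * h ≡ x + h
      lem₄ = solve-∀
      lem₅ : ∀ a b c → (a - c) - (a - b) ≡ b - c
      lem₅ = solve-∀

  exact-divisor : ∀ {p} → Prime p → p ℕ∣.∣ n → ∃ λ e → ∃ λ m → n ≡ m ℕ.* p ℕ.^ suc e × ¬ p ℕ∣.∣ m
  exact-divisor {p} pr p∣n with exact-power pr n 0<n
  ... | zero  , m , n≡ , p∤m = contradiction (subst (p ℕ∣.∣_) (trans n≡ (ℕₚ.*-identityʳ m)) p∣n) p∤m
  ... | suc e , m , n≡ , p∤m = e , m , n≡ , p∤m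

  -- Any prime factor of n / gcd(n, x) will do: if its full power in `n` divided `x`, it would
  -- divide the gcd, and the prime would still divide the cofactor `m`.
  missing-prime-power : ∀ x → ¬ + n ∣ x → ∃ λ p → Prime p × p ℕ∣.∣ n ×
    ∃ λ e → ∃ λ m → n ≡ m ℕ.* p ℕ.^ suc e × ¬ p ℕ∣.∣ m × ¬ + (p ℕ.^ suc e) ∣ x
  missing-prime-power x n∤x with gcd[m,n]∣m n (abs x)
  ... | ℕ∣.divides k n≡kg with prime-factor k k≢0 k≢1
    where
    k≢0 : k ≢ 0
    k≢0 refl = ℕₚ.<⇒≢ 0<n (sym n≡kg)
    k≢1 : k ≢ 1
    k≢1 refl = n∤x (∣ᵤ⇒∣ (subst (ℕ∣._∣ abs x) (sym (trans n≡kg (ℕₚ.+-identityʳ _))) (gcd[m,n]∣n n (abs x))))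
  ... | p , pr , p∣k with exact-divisor pr (subst (p ℕ∣.∣_) (sym n≡kg) (ℕ∣.∣m⇒∣m*n (gcd n (abs x)) p∣k))
  ...   | e , m , n≡ , p∤m = p , pr , subst (p ℕ∣.∣_) (sym n≡kg) (ℕ∣.∣m⇒∣m*n (gcd n (abs x)) p∣k) ,
          e , m , n≡ , p∤m , P∤x
    where
    P∤x : ¬ + (p ℕ.^ suc e) ∣ x
    P∤x d with gcd-greatest {n} {abs x} (ℕ∣.divides m n≡) (∣⇒∣ᵤ d)
    ... | ℕ∣.divides g g≡ = p∤m (subst (p ℕ∣.∣_) kg≡m (ℕ∣.∣m⇒∣m*n g p∣k))
      where
      instance
        _ = prime⇒nonZero pr
        _ = ℕₚ.m^n≢0 p (suc e)
      kg≡m : k ℕ.* g ≡ m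
      kg≡m = ℕₚ.*-cancelʳ-≡ (k ℕ.* g) m (p ℕ.^ suc e)
        (trans (ℕₚ.*-assoc k g _) (trans (cong (k ℕ.*_) (sym g≡)) (trans (sym n≡kg) n≡)))

  -- The prime and the constant `c` depend on `x`, but 1 is divisible by none of the prime powers,
  -- so every `x` is compared with the same value `Y 1ℤ`.
  constant-off-zero : (∀ {p} → Prime p → p ℕ∣.∣ n → ¬ + p ∣ Δ) → ∀ x → ¬ + n ∣ x → Y x ≡ Y 1ℤ
  constant-off-zero cop x n∤x with missing-prime-power x n∤x
  ... | p , pr , p∣n , e , m , n≡ , p∤m , P∤x with AtPrime.nondividing pr e m n≡ p∤m (cop pr p∣n)
  ...   | c , congr = ≡-of-congruence pr (AtPrime.p≢2 pr e m n≡ p∤m) x 1ℤ n∤x n∤1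
            (subst (+ p ∣_) (lem (Y x) (Y 1ℤ) c) (∣m∣n⇒∣m-n (congr x P∤x) (congr 1ℤ P∤1)))
    where
    lem : ∀ a b c → (a + c) - (b + c) ≡ a - b
    lem = solve-∀
    n∤1 : ¬ + n ∣ 1ℤ
    n∤1 d = n∤x (∣-trans d (divides x (sym (*-identityʳ x))))
    P∤1 : ¬ + (p ℕ.^ suc e) ∣ 1ℤ
    P∤1 d = prime∤1 pr (ℕ∣.∣-trans (ℕ∣.m∣m*n (p ℕ.^ e)) (∣⇒∣ᵤ d))

  translate-congruence : ∀ {p} → Prime p → + p ∣ Δ → ∀ h → n ≡ p ℕ.* h → ∀ x → + p ∣ Y x - Y (x + + h)
  translate-congruence {p} pr p∣Δ h n≡ph x with exact-divisor pr (ℕ∣.divides h (trans n≡ph (ℕₚ.*-comm p h)))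
  ... | e , m , n≡ , p∤m = subst (λ h → + p ∣ Y x - Y (x + + h)) h′≡h (AtPrime.dividing pr e m n≡ p∤m p∣Δ x)
    where
    instance _ = prime⇒nonZero pr
    h′≡h : m ℕ.* p ℕ.^ e ≡ h
    h′≡h = ℕₚ.*-cancelˡ-≡ _ h p (trans (sym (AtPrime.n≡ph pr e m n≡ p∤m)) n≡ph)

common-prime? : ∀ n Δ → 0 ℕ.< n →
  (∃ λ p → Prime p × p ℕ∣.∣ n × + p ∣ Δ) ⊎ (∀ {p} → Prime p → p ℕ∣.∣ n → ¬ + p ∣ Δ)
common-prime? n Δ 0<n with gcd n (abs Δ) ℕₚ.≟ 1
... | yes g≡1 = inj₂ λ pr p∣n p∣Δ → prime∤1 pr (subst (_ ℕ∣.∣_) g≡1 (gcd-greatest p∣n (∣⇒∣ᵤ p∣Δ)))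
... | no g≢1 with prime-factor (gcd n (abs Δ)) (λ g≡0 → ℕₚ.<⇒≢ 0<n (sym (gcd[m,n]≡0⇒m≡0 g≡0))) g≢1
...   | p , pr , p∣g = inj₁ (p , pr , ℕ∣.∣-trans p∣g (gcd[m,n]∣m n (abs Δ)) , ∣ᵤ⇒∣ (ℕ∣.∣-trans p∣g (gcd[m,n]∣n n (abs Δ))))

-- The multiples of `h` form the subgroup of order `l` of ℤ/n.
TwoValued : ℕ → (ℤ → ℤ) → Set
TwoValued n Y = ∃ λ l → ∃ λ h → n ≡ l ℕ.* h × ∃ λ u → ∃ λ u′ →
  (∀ x → ¬ + h ∣ x → Y x ≡ u) × (∀ x → + h ∣ x → Y x ≡ u′)

conv-refine : ∀ p h {f g} → Periodic h f → Periodic h g → ∀ x → conv (p ℕ.* h) f g x ≡ + p * conv h f g x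
conv-refine p h {f} {g} pf pg x = trans (conv-def (p ℕ.* h) f g x) (trans (∑-blocks p h _)
  (trans (∑-cong p (λ j → trans (∑-cong h (λ i → cong₂ _*_ (eq₁ j i) (eq₂ j i))) (sym (conv-def h f g x)))) (∑-const p (conv h f g x))))
  where
  lem₁ : ∀ j h i → j * h + i ≡ i + j * h
  lem₁ = solve-∀
  lem₂ : ∀ j h i x → x - (j * h + i) ≡ (x - i) + (- j) * h
  lem₂ = solve-∀
  eq₁ : ∀ j i → f (j * + h + i) ≡ f i
  eq₁ j i = trans (cong f (lem₁ j (+ h) i)) (periodic-multiple pf j i)
  eq₂ : ∀ j i → g (x - (j * + h + i)) ≡ g (x - i)
  eq₂ j i = trans (cong g (lem₂ j (+ h) i x)) (periodic-multiple pg (- j) (x - i))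

-- A prime `p` dividing both `n` and `Δ` makes `Y` periodic modulo n/p, and the cubic equation
-- survives with n/p and Δ/p, because each convolution gives off a factor `p`. When no such prime is
-- left, `Y` is constant off zero.
two-valued : ∀ n → 0 ℕ.< n → ¬ 2 ℕ∣.∣ n → ∀ Δ Y → Periodic n Y → Cubic n Δ Y → (∀ x → Small (Y x)) → TwoValued n Y
two-valued = <-rec _ go
  where
  go : ∀ n → (∀ {k} → k ℕ.< n → 0 ℕ.< k → ¬ 2 ℕ∣.∣ k → ∀ Δ Y → Periodic k Y → Cubic k Δ Y → (∀ x → Small (Y x)) → TwoValued k Y) →
       0 ℕ.< n → ¬ 2 ℕ∣.∣ n → ∀ Δ Y → Periodic n Y → Cubic n Δ Y → (∀ x → Small (Y x)) → TwoValued n Y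
  go n rec 0<n 2∤n Δ Y perY cubic small with common-prime? n Δ 0<n
  ... | inj₂ cop = 1 , n , sym (ℕₚ.+-identityʳ n) , Y 1ℤ , Y 0ℤ ,
        SmallCubic.constant-off-zero n 0<n 2∤n Δ Y perY cubic (λ x _ → small x) cop ,
        λ x n∣x → periodic-≡ perY {x} {0ℤ} (subst (+ n ∣_) (sym (+-identityʳ x)) n∣x)
  ... | inj₁ (p , pr , ℕ∣.divides h n≡hp , divides Δ′ Δ≡) with rec h<n 0<h 2∤h Δ′ Y perh cubic′ small
    where
    open SmallCubic n 0<n 2∤n Δ Y perY cubic (λ x _ → small x)
    n≡ph : n ≡ p ℕ.* h
    n≡ph = trans n≡hp (ℕₚ.*-comm h p)
    0<h : 0 ℕ.< h
    0<h = ℕₚ.n≢0⇒n>0 λ { refl → ℕₚ.<⇒≢ 0<n (sym n≡hp) }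
    h<n : h ℕ.< n
    h<n = subst (h ℕ.<_) (sym n≡hp) (ℕₚ.m<m*n h p {{ℕ.>-nonZero 0<h}} (prime>1 pr))
    2∤h : ¬ 2 ℕ∣.∣ h
    2∤h d = 2∤n (subst (2 ℕ∣.∣_) (sym n≡hp) (ℕ∣.∣m⇒∣m*n p d))
    p≢2 : p ≢ 2
    p≢2 refl = 2∤n (ℕ∣.divides h n≡hp)
    perh : Periodic h Y
    perh x = sym (small-≡ (odd-prime>2 pr p≢2) (small x) (small (x + + h))
                   (translate-congruence pr (divides Δ′ Δ≡) h n≡ph x))
    instance
      _ = prime⇒nonZero pr
      _ = i*j≢0 (+ p) (+ p)
    P : ℤ
    P = + p * + p
    cube : ∀ x → P * conv h Y (conv h Y Y) x ≡ P * (Δ′ * Δ′ * Y x) + proj₁ cubic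
    cube x = trans (lem₁ (+ p) (conv h Y (conv h Y Y) x)) (trans (sym eq) (trans (proj₂ cubic x)
        (cong (_+ proj₁ cubic) (trans (cong (λ d → d * d * Y x) Δ≡) (lem₂ Δ′ (+ p) (Y x))))))
      where
      lem₁ : ∀ p a → p * p * a ≡ p * (p * a)
      lem₁ = solve-∀
      lem₂ : ∀ d p y → d * p * (d * p) * y ≡ p * p * (d * d * y)
      lem₂ = solve-∀
      eq : conv n Y (conv n Y Y) x ≡ + p * (+ p * conv h Y (conv h Y Y) x)
      eq = trans (cong (λ k → conv k Y (conv k Y Y) x) n≡ph)
           (trans (conv-cong (p ℕ.* h) {Y} {Y} {conv (p ℕ.* h) Y Y} {λ x → + p * conv h Y Y x} (λ _ → refl) (conv-refine p h perh perh) x)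
           (trans (conv-*ʳ (p ℕ.* h) (+ p) Y (conv h Y Y) x)
                  (cong (+ p *_) (conv-refine p h perh (conv-periodic h Y perh) x))))
    -- Divisibility of the old constant by p² is not at hand; subtracting the instance at 0 removes
    -- it before `P` is cancelled.
    cubic′ : Cubic h Δ′ Y
    cubic′ = C 0ℤ , λ x → trans (lem₁ (conv h Y (conv h Y Y) x) (Δ′ * Δ′ * Y x)) (cong (λ z → Δ′ * Δ′ * Y x + z) (*-cancelˡ-≡ P (C x) (C 0ℤ) (lin₂ 1ℤ (- 1ℤ) (cube x) (cube 0ℤ)
          (lem₂ P (conv h Y (conv h Y Y) x) (Δ′ * Δ′ * Y x) (conv h Y (conv h Y Y) 0ℤ) (Δ′ * Δ′ * Y 0ℤ) (proj₁ cubic)))))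
      where
      C : ℤ → ℤ
      C x = conv h Y (conv h Y Y) x - Δ′ * Δ′ * Y x
      lem₁ : ∀ a b → a ≡ b + (a - b)
      lem₁ = solve-∀
      lem₂ : ∀ P a b a₀ b₀ c → P * (a - b) - P * (a₀ - b₀) ≡ 1ℤ * (P * a - (P * b + c)) + (- 1ℤ) * (P * a₀ - (P * b₀ + c))
      lem₂ = solve-∀
  ... | l , k , h≡lk , u , u′ , off , on = p ℕ.* l , k ,
        trans n≡hp (trans (ℕₚ.*-comm h p) (trans (cong (p ℕ.*_) h≡lk) (sym (ℕₚ.*-assoc p l k)))) , u , u′ , off , on

-- Group ring equations of a strongly regular bicirculant

Bit : ℤ → Set
Bit v = v ≡ 0ℤ ⊎ v ≡ 1ℤ

bit-nonneg : ∀ {v} → Bit v → 0ℤ ≤ v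
bit-nonneg (inj₁ refl) = ≤-refl
bit-nonneg (inj₂ refl) = 0≤+

bit-square : ∀ {v} → Bit v → v * v ≡ v
bit-square (inj₁ refl) = refl
bit-square (inj₂ refl) = refl

bit-sum : ∀ {v w} → Bit v → Bit w → Small (v + w)
bit-sum (inj₁ refl) (inj₁ refl) = inj₁ refl
bit-sum (inj₁ refl) (inj₂ refl) = inj₂ (inj₁ refl)
bit-sum (inj₂ refl) (inj₁ refl) = inj₂ (inj₁ refl)
bit-sum (inj₂ refl) (inj₂ refl) = inj₂ (inj₂ refl)

∑-δ : ∀ n → 0 ℕ.< n → ∑ n (δ n) ≡ 1ℤ
∑-δ n 0<n = trans (∑-cong n (λ i → sym (*-identityʳ (δ n i)))) (∑-⟦⟧-pick₀ n 0<n (λ _ → 1ℤ))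

∑-conv : ∀ n f {g} → Periodic n g → ∑ n (conv n f g) ≡ ∑ n f * ∑ n g
∑-conv n f {g} pg = trans (∑-cong n (conv-def n f g)) (trans (∑-swap n n (λ x i → f i * g (x - i)))
  (trans (∑-cong n (λ i → trans (∑-*ˡ n (f i) (λ x → g (x - i))) (cong (f i *_) (∑-shift n pg (- i))))) (∑-*ʳ n (∑ n g) f)))

-- `n` is the length of one orbit, half the number of vertices; in `family` the parameter `m` may
-- have either sign.
data Exceptional (n : ℕ) (k lam μ : ℤ) : Set where
  hoffman-singleton : n ≡ 25 → k ≡ + 7 → lam ≡ 0ℤ → μ ≡ 1ℤ → Exceptional n k lam μ
  hoffman-singletonᶜ : n ≡ 25 → k ≡ + 42 → lam ≡ + 35 → μ ≡ + 36 → Exceptional n k lam μ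
  family : ∀ m → + n ≡ + 2 * (m * m) + + 2 * m + 1ℤ → k ≡ + 2 * (m * m) + m → lam ≡ m * m - 1ℤ → μ ≡ m * m →
    Exceptional n k lam μ

-- S, T and R are the indicator functions of the connection sets inside the first orbit, inside the
-- second one, and between them, as n-periodic functions on ℤ.
record BicirculantSRG (n : ℕ) (S T R : ℤ → ℤ) (k lam μ : ℤ) : Set where
  field
    0<n : 0 ℕ.< n
    2∤n : ¬ 2 ℕ∣.∣ n
    perS : Periodic n S
    perT : Periodic n T
    perR : Periodic n R
    bitS : ∀ x → Bit (S x)
    bitT : ∀ x → Bit (T x)
    bitR : ∀ x → Bit (R x)
    evenS : ∀ x → S (- x) ≡ S x
    evenT : ∀ x → T (- x) ≡ T x
    zeroS : ∀ x → + n ∣ x → S x ≡ 0ℤ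
    zeroT : ∀ x → + n ∣ x → T x ≡ 0ℤ
    degreeS : ∑ n S + ∑ n R ≡ k
    degreeT : ∑ n T + ∑ n R ≡ k
    squareS : ∀ x → conv n S S x + conv n R (λ i → R (- i)) x ≡ (lam - μ) * S x + (k - μ) * δ n x + μ
    squareT : ∀ x → conv n T T x + conv n R (λ i → R (- i)) x ≡ (lam - μ) * T x + (k - μ) * δ n x + μ
    mixed : ∀ x → conv n S R x + conv n R T x ≡ (lam - μ) * R x + μ
    μ≢0 : μ ≢ 0ℤ
    k≢μ : k ≢ μ
    lam≢k-1 : lam ≢ k - 1ℤ

module Classification {n S T R k lam μ} (G : BicirculantSRG n S T R k lam μ) where

  open BicirculantSRG G

  β σ ρ Δ : ℤ
  β = lam - μ
  σ = ∑ n S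
  ρ = ∑ n R
  Δ = + 2 * (σ - ρ) - β

  -- U annihilates S - T and takes R to a constant, which makes it a root of a cubic.
  R° U : ℤ → ℤ
  R° x = R (- x)
  U x = S x + T x - β * δ n x

  instance
    n-nonZero : ℕ.NonZero n
    n-nonZero = ℕ.>-nonZero 0<n

  perR° : Periodic n R°
  perR° x = trans (sym (perR (- (x + + n)))) (cong R (lem x (+ n)))
    where
    lem : ∀ x n → - (x + n) + n ≡ - x
    lem = solve-∀

  perU : Periodic n U
  perU x = cong₂ (λ a b → a - β * b) (cong₂ _+_ (perS x) (perT x)) (δ-periodic n x)

  ∑T≡σ : ∑ n T ≡ σ
  ∑T≡σ = lin₁ 1ℤ (trans degreeT (sym degreeS)) (lem (∑ n T) σ ρ)
    where
    lem : ∀ t s r → t - s ≡ 1ℤ * ((t + r) - (s + r))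
    lem = solve-∀

  ∑R°≡ρ : ∑ n R° ≡ ρ
  ∑R°≡ρ = ∑-neg n perR

  conv-U : ∀ F → Periodic n F → ∀ x → conv n F U x ≡ conv n F S x + conv n F T x - β * F x
  conv-U F pF x = trans (conv-cong n {F} {F} {U} {λ i → (S i + T i) + (- β) * δ n i} (λ _ → refl) (λ i → lem (S i) (T i) β (δ n i)) x)
    (trans (conv-+ʳ n F (λ i → S i + T i) (λ i → (- β) * δ n i) x)
    (trans (cong₂ _+_ (conv-+ʳ n F S T x) (trans (conv-*ʳ n (- β) F (δ n) x) (cong ((- β) *_) (conv-δʳ n 0<n pF x))))
           (sym (lem (conv n F S x) (conv n F T x) β (F x)))))
    where
    lem : ∀ s t b d → s + t - b * d ≡ (s + t) + (- b) * d
    lem = solve-∀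

  -- Subtracting `squareT` from `squareS` gives S² - T² = β (S - T), which is (S - T) U = 0.
  conv-SU≡TU : ∀ x → conv n S U x ≡ conv n T U x
  conv-SU≡TU x = trans (conv-U S perS x) (trans (lin₃ 1ℤ (- 1ℤ) 1ℤ (squareS x) (squareT x) (conv-comm n perS perT x)
      (lem (conv n S S x) (conv n T T x) (conv n R R° x) (conv n S T x) (conv n T S x) β (S x) (T x) (k - μ) (δ n x) μ)) (sym (conv-U T perT x)))
    where
    lem : ∀ ss tt rr st ts b s t km d m → (ss + st - b * s) - (ts + tt - b * t) ≡
      1ℤ * ((ss + rr) - (b * s + km * d + m)) + (- 1ℤ) * ((tt + rr) - (b * t + km * d + m)) + 1ℤ * (st - ts)
    lem = solve-∀

  conv-RU : ∀ x → conv n R U x ≡ μ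
  conv-RU x = trans (conv-U R perR x) (lin₂ 1ℤ (- 1ℤ) (mixed x) (conv-comm n perS perR x)
      (lem (conv n R S x) (conv n S R x) (conv n R T x) (β * R x) μ))
    where
    lem : ∀ rs sr rt r m → (rs + rt - r) - m ≡ 1ℤ * ((sr + rt) - (r + m)) + (- 1ℤ) * (sr - rs)
    lem = solve-∀

  ∑-squareS : σ * σ + ρ * ρ ≡ β * σ + (k - μ) + μ * + n
  ∑-squareS = trans (sym (trans (∑-+ n _ _) (cong₂ _+_ (∑-conv n S perS) (trans (∑-conv n R perR°) (cong (ρ *_) ∑R°≡ρ)))))
    (trans (∑-cong n squareS) (trans (∑-+ n _ _) (cong₂ _+_ (trans (∑-+ n _ _) (cong₂ _+_ (∑-*ˡ n β S)
       (trans (∑-*ˡ n (k - μ) (δ n)) (trans (cong ((k - μ) *_) (∑-δ n 0<n)) (*-identityʳ (k - μ))))))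
       (trans (∑-const n μ) (*-comm (+ n) μ)))))

  ∑-mixed : + 2 * (σ * ρ) ≡ β * ρ + μ * + n
  ∑-mixed = trans (lem σ ρ) (trans (sym (trans (∑-+ n _ _) (cong₂ _+_ (∑-conv n S perR) (trans (∑-conv n R perT) (cong (ρ *_) ∑T≡σ)))))
    (trans (∑-cong n mixed) (trans (∑-+ n _ _) (cong₂ _+_ (∑-*ˡ n β R) (trans (∑-const n μ) (*-comm (+ n) μ))))))
    where
    lem : ∀ s r → + 2 * (s * r) ≡ s * r + r * s
    lem = solve-∀

  -- σ - ρ is an eigenvalue of the quotient by the two orbits, so the discriminant is a square.
  Δ²≡ : Δ * Δ ≡ β * β + + 4 * (k - μ)
  Δ²≡ = lin₂ (+ 4) (- (+ 4)) ∑-squareS ∑-mixed (lem σ ρ β (k - μ) (μ * + n))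
    where
    lem : ∀ s r b km mn → (+ 2 * (s - r) - b) * (+ 2 * (s - r) - b) - (b * b + + 4 * km) ≡
      + 4 * ((s * s + r * r) - (b * s + km + mn)) + (- (+ 4)) * (+ 2 * (s * r) - (b * r + mn))
    lem = solve-∀

  -- Put V = S U = T U. Then U² = 2V - β U, and `squareS` gives S V = β V + (k - μ) U + const, since
  -- R° R U is constant. In U³ the terms in V cancel, and β² + 4 (k - μ) = Δ² is left in front of U.
  cubicU : Cubic n Δ U
  cubicU = + 4 * C , eq
    where
    C : ℤ
    C = ∑ n U * μ - ρ * μ
    V : ℤ → ℤ
    V = conv n S U
    perV : Periodic n V
    perV = conv-periodic n S perU
    UU : ∀ x → conv n U U x ≡ + 2 * V x + (- β) * U x
    UU x = trans (conv-U U perU x) (trans (cong₂ (λ a b → a + b - β * U x) (conv-comm n perU perS x)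
             (trans (conv-comm n perU perT x) (sym (conv-SU≡TU x)))) (lem (V x) β (U x)))
      where
      lem : ∀ v b u → v + v - b * u ≡ + 2 * v + (- b) * u
      lem = solve-∀
    conv-UU : ∀ F x → conv n F (conv n U U) x ≡ + 2 * conv n F V x + (- β) * conv n F U x
    conv-UU F x = trans (conv-cong n {F} {F} {conv n U U} {λ x → + 2 * V x + (- β) * U x} (λ _ → refl) UU x)
      (trans (conv-+ʳ n F (λ x → + 2 * V x) (λ x → (- β) * U x) x)
             (cong₂ _+_ (conv-*ʳ n (+ 2) F V x) (conv-*ʳ n (- β) F U x)))
    RR°U : ∀ x → conv n (conv n R R°) U x ≡ ρ * μ
    RR°U x = trans (conv-cong n {conv n R R°} {conv n R° R} {U} {U} (conv-comm n perR perR°) (λ _ → refl) x)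
      (trans (conv-assoc n {R°} {R} {U} perR perU x)
      (trans (conv-cong n {R°} {R°} {conv n R U} {λ _ → μ} (λ _ → refl) conv-RU x)
      (trans (conv-constʳ n R° μ x) (cong (_* μ) ∑R°≡ρ))))
    SV : ∀ x → conv n S V x ≡ β * V x + (k - μ) * U x + C
    SV x = trans (sym (conv-assoc n {S} {S} {U} perS perU x))
      (trans (conv-cong n {conv n S S} {λ x → ((β * S x + (k - μ) * δ n x) + (μ * 1ℤ)) + (- 1ℤ) * conv n R R° x} {U} {U}
                (λ x → lin₁ 1ℤ (squareS x) (lem₁ (conv n S S x) (conv n R R° x) (β * S x) ((k - μ) * δ n x) μ)) (λ _ → refl) x)
      (trans (conv-+ˡ n (λ x → (β * S x + (k - μ) * δ n x) + (μ * 1ℤ)) (λ x → (- 1ℤ) * conv n R R° x) U x)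
      (trans (cong₂ _+_ (trans (conv-+ˡ n (λ x → β * S x + (k - μ) * δ n x) (λ _ → μ * 1ℤ) U x)
            (cong₂ _+_ (trans (conv-+ˡ n (λ x → β * S x) (λ x → (k - μ) * δ n x) U x)
               (cong₂ _+_ (conv-*ˡ n β S U x) (trans (conv-*ˡ n (k - μ) (δ n) U x)
                   (cong ((k - μ) *_) (trans (conv-comm n (δ-periodic n) perU x) (conv-δʳ n 0<n perU x))))))
               (trans (conv-*ˡ n μ (λ _ → 1ℤ) U x) (cong (μ *_) (trans (conv-comm n (λ _ → refl) perU x) (conv-constʳ n U 1ℤ x))))))
            (trans (conv-*ˡ n (- 1ℤ) (conv n R R°) U x) (cong ((- 1ℤ) *_) (RR°U x))))
          (lem₂ (β * V x + (k - μ) * U x) μ (∑ n U) (ρ * μ)))))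
      where
      lem₁ : ∀ ss rr a b m → ss - ((a + b) + m * 1ℤ + (- 1ℤ) * rr) ≡ 1ℤ * ((ss + rr) - (a + b + m))
      lem₁ = solve-∀
      lem₂ : ∀ a m s r → a + m * (s * 1ℤ) + (- 1ℤ) * r ≡ a + (s * m - r)
      lem₂ = solve-∀
    UV : ∀ x → conv n U V x ≡ + 2 * (β * V x + (k - μ) * U x + C) + (- β) * V x
    UV x = trans (sym (conv-assoc n {U} {S} {U} perS perU x))
      (trans (conv-cong n {conv n U S} {V} {U} {U} (conv-comm n perU perS) (λ _ → refl) x)
      (trans (conv-assoc n {S} {U} {U} perU perU x)
      (trans (conv-UU S x) (cong (λ z → + 2 * z + (- β) * V x) (SV x)))))
    eq : ∀ x → conv n U (conv n U U) x ≡ Δ * Δ * U x + + 4 * C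
    eq x = trans (conv-UU U x) (trans (cong₂ (λ a b → + 2 * a + (- β) * b) (UV x) (UU x))
             (trans (lem β (V x) (k - μ) (U x) C) (cong (λ z → z * U x + + 4 * C) (sym Δ²≡))))
      where
      lem : ∀ b v km u c → + 2 * (+ 2 * (b * v + km * u + c) + (- b) * v) + (- b) * (+ 2 * v + (- b) * u) ≡
        (b * b + + 4 * km) * u + + 4 * c
      lem = solve-∀

  U-off : ∀ x → ¬ + n ∣ x → U x ≡ S x + T x
  U-off x n∤x = trans (cong (λ d → S x + T x - β * d) (⟦⟧-no n∤x)) (lem (S x + T x) β)
    where
    lem : ∀ a b → a - b * 0ℤ ≡ a
    lem = solve-∀

  U-zero : ∀ x → + n ∣ x → U x ≡ - β
  U-zero x n∣x = trans (cong₂ (λ a d → a - β * d) (cong₂ _+_ (zeroS x n∣x) (zeroT x n∣x)) (⟦⟧-yes n∣x)) (lem β)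
    where
    lem : ∀ b → 0ℤ + 0ℤ - b * 1ℤ ≡ - b
    lem = solve-∀

  smallU : ∀ x → ¬ + n ∣ x → Small (U x)
  smallU x n∤x = subst Small (sym (U-off x n∤x)) (bit-sum (bitS x) (bitT x))

  evenU : ∀ x → U (- x) ≡ U x
  evenU x = cong₂ (λ a d → a - β * d) (cong₂ _+_ (evenS x) (evenT x)) (⟦⟧-neg (+ n) x)

  -- Under these hypotheses the vertices at positions 0 and `h` of the first orbit have the same
  -- neighbours apart from each other, so all but `S h` of the `k` neighbours of one are common to
  -- both.
  twin-count : ∀ h → ¬ + n ∣ h → (∀ x → R (x + h) ≡ R x) →
    (∀ x → ¬ + n ∣ x → ¬ + n ∣ x + h → S (x + h) ≡ S x) → k - S h ≡ β * S h + μ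
  twin-count h n∤h R-inv S-inv = trans (sym lhs) (trans (squareS h)
      (trans (cong (λ d → β * S h + (k - μ) * d + μ) (⟦⟧-no n∤h)) (lem β (S h) (k - μ) μ)))
    where
    lem : ∀ b s km m → b * s + km * 0ℤ + m ≡ b * s + m
    lem = solve-∀
    lem₁ : ∀ i h → (i - h) + h ≡ i
    lem₁ = solve-∀
    lem₂ : ∀ i h → - (i - h) ≡ h - i
    lem₂ = solve-∀
    lem₃ : ∀ i h → - (h - i) ≡ i - h
    lem₃ = solve-∀
    lem₄ : ∀ s → s ≡ s + (- s) * 1ℤ + s
    lem₄ = solve-∀
    lem₅ : ∀ a s → a * 0ℤ ≡ s + (- s) * 1ℤ
    lem₅ = solve-∀
    lem₆ : ∀ s t → s + (- t) * 0ℤ ≡ s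
    lem₆ = solve-∀
    -- The product is `S i` except at i = h, where `S (h - i)` is S(0) = 0.
    pointwise : ∀ i → S i * S (h - i) ≡ S i + (- S h) * (⟦ + n ∣ h - i ⟧ * 1ℤ)
    pointwise i with + n ∣? i | + n ∣? (h - i)
    ... | yes n∣i | yes n∣h-i = contradiction (∣m+n∣n⇒∣m n∣h-i (∣m⇒∣-m n∣i)) n∤h
    ... | yes n∣i | no n∤h-i = trans (cong (_* S (h - i)) (zeroS i n∣i))
          (sym (trans (cong₂ (λ a d → a + (- S h) * (d * 1ℤ)) (zeroS i n∣i) (⟦⟧-no n∤h-i)) (trans (lem₆ 0ℤ (S h)) refl)))
    ... | no n∤i | yes n∣h-i = trans (cong (S i *_) (zeroS (h - i) n∣h-i)) (trans (lem₅ (S i) (S i))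
          (sym (cong₂ (λ a d → S i + (- a) * (d * 1ℤ)) (periodic-≡ perS {h} {i} n∣h-i) (⟦⟧-yes n∣h-i))))
    ... | no n∤i | no n∤h-i = trans (cong (S i *_) S≡) (trans (bit-square (bitS i))
          (sym (trans (cong (λ d → S i + (- S h) * (d * 1ℤ)) (⟦⟧-no n∤h-i)) (lem₆ (S i) (S h)))))
      where
      S≡ : S (h - i) ≡ S i
      S≡ = trans (cong S (sym (lem₂ i h))) (trans (evenS (i - h))
        (trans (sym (S-inv (i - h) (n∤h-i ∘ ∣-flip i h) (n∤i ∘ subst (+ n ∣_) (lem₁ i h)))) (cong S (lem₁ i h))))
    SS : conv n S S h ≡ σ + (- S h) * 1ℤ
    SS = trans (conv-def n S S h) (trans (∑-cong n pointwise) (trans (∑-+ n S _) (cong (λ z → σ + z)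
           (trans (∑-*ˡ n (- S h) _) (cong ((- S h) *_) (∑-⟦⟧-pick n 0<n {λ _ → 1ℤ} (λ _ → refl) h))))))
    RR : conv n R R° h ≡ ρ
    RR = trans (conv-def n R R° h) (∑-cong n (λ i → trans (cong (R i *_) (trans (cong R (lem₃ i h))
           (trans (sym (R-inv (i - h))) (cong R (lem₁ i h))))) (bit-square (bitR i))))
    lhs : conv n S S h + conv n R R° h ≡ k - S h
    lhs = trans (cong₂ _+_ SS RR) (trans (lem₇ σ (S h) ρ) (cong (_- S h) degreeS))
      where
      lem₇ : ∀ a s b → a + (- s) * 1ℤ + b ≡ (a + b) - s
      lem₇ = solve-∀

  -- Non-adjacent twins give k = μ and adjacent ones give λ = k - 1; both are ruled out by
  -- non-triviality.
  no-twins : ∀ h → ¬ + n ∣ h → (∀ x → R (x + h) ≡ R x) →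
    (∀ x → ¬ + n ∣ x → ¬ + n ∣ x + h → S (x + h) ≡ S x) → ⊥
  no-twins h n∤h R-inv S-inv with bitS h | twin-count h n∤h R-inv S-inv
  ... | inj₁ s≡0 | count = k≢μ (lin₂ 1ℤ (β + 1ℤ) count s≡0 (lem k (S h) β μ))
    where
    lem : ∀ k s b m → k - m ≡ 1ℤ * ((k - s) - (b * s + m)) + (b + 1ℤ) * (s - 0ℤ)
    lem = solve-∀
  ... | inj₂ s≡1 | count = lam≢k-1 (lin₂ (- 1ℤ) (- (β + 1ℤ)) count s≡1 (lem k (S h) lam μ))
    where
    lem : ∀ k s l m → l - (k - 1ℤ) ≡ (- 1ℤ) * ((k - s) - ((l - m) * s + m)) + (- ((l - m) + 1ℤ)) * (s - 1ℤ)
    lem = solve-∀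

  module Translate (h : ℤ) (n∤h : ¬ + n ∣ h)
    (U-inv : ∀ x → ¬ + n ∣ x → ¬ + n ∣ x + h → U x ≡ U (x + h)) where

    w : ℤ
    w = U 0ℤ - U h

    difference : ∀ x → U (x + h) - U x ≡ w * (δ n (x + h) - δ n x)
    difference x with + n ∣? x | + n ∣? (x + h)
    ... | yes n∣x | yes n∣x+h = contradiction (∣m+n∣m⇒∣n n∣x+h n∣x) n∤h
    ... | yes n∣x | no n∤x+h = trans (cong₂ _-_ (periodic-≡ perU {x + h} {h} (subst (+ n ∣_) (sym (lem x h)) n∣x))
            (periodic-≡ perU {x} {0ℤ} (subst (+ n ∣_) (sym (+-identityʳ x)) n∣x)))
          (trans (lem₁ (U h) (U 0ℤ)) (sym (cong₂ (λ a b → w * (a - b)) (⟦⟧-no n∤x+h) (⟦⟧-yes n∣x))))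
      where
      lem : ∀ x h → x + h - h ≡ x
      lem = solve-∀
      lem₁ : ∀ a b → a - b ≡ (b - a) * (0ℤ - 1ℤ)
      lem₁ = solve-∀
    ... | no n∤x | yes n∣x+h = trans (cong₂ _-_ (periodic-≡ perU {x + h} {0ℤ} (subst (+ n ∣_) (sym (+-identityʳ (x + h))) n∣x+h))
            (trans (periodic-≡ perU {x} { - h} (subst (+ n ∣_) (lem x h) n∣x+h)) (evenU h)))
          (trans (lem₁ (U 0ℤ) (U h)) (sym (cong₂ (λ a b → w * (a - b)) (⟦⟧-yes n∣x+h) (⟦⟧-no n∤x))))
      where
      lem : ∀ x h → x + h ≡ x - - h
      lem = solve-∀
      lem₁ : ∀ a b → a - b ≡ (a - b) * (1ℤ - 0ℤ)
      lem₁ = solve-∀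
    ... | no n∤x | no n∤x+h = trans (i≡j⇒i-j≡0 (sym (U-inv x n∤x n∤x+h)))
          (sym (trans (cong₂ (λ a b → w * (a - b)) (⟦⟧-no n∤x+h) (⟦⟧-no n∤x)) (*-zeroʳ w)))

    conv-difference : ∀ F → Periodic n F → ∀ x → conv n F U (x + h) - conv n F U x ≡ w * (F (x + h) - F x)
    conv-difference F pF x = begin
      conv n F U (x + h) - conv n F U x
        ≡⟨ cong₂ _-_ (conv-def n F U (x + h)) (conv-def n F U x) ⟩
      ∑ n (λ i → F i * U (x + h - i)) - ∑ n (λ i → F i * U (x - i))
        ≡⟨ ∑-- n _ _ ⟨
      ∑ n (λ i → F i * U (x + h - i) - F i * U (x - i))
        ≡⟨ ∑-cong n (λ i → trans (cong (λ z → F i * U z - F i * U (x - i)) (lem x h i))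
             (trans (lem₁ (F i) (U (x - i + h)) (U (x - i))) (trans (cong (F i *_) (difference (x - i)))
             (trans (lem₂ (F i) w (δ n (x - i + h)) (δ n (x - i))) (cong (λ z → w * (F i * δ n z - F i * δ n (x - i))) (sym (lem x h i))))))) ⟩
      ∑ n (λ i → w * (F i * δ n (x + h - i) - F i * δ n (x - i)))
        ≡⟨ trans (∑-*ˡ n w _) (cong (w *_) (∑-- n _ _)) ⟩
      w * (∑ n (λ i → F i * δ n (x + h - i)) - ∑ n (λ i → F i * δ n (x - i)))
        ≡⟨ cong₂ (λ a b → w * (a - b)) (trans (sym (conv-def n F (δ n) (x + h))) (conv-δʳ n 0<n pF (x + h)))
                                       (trans (sym (conv-def n F (δ n) x)) (conv-δʳ n 0<n pF x)) ⟩
      w * (F (x + h) - F x) ∎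
      where
      open ≡-Reasoning
      lem : ∀ x h i → x + h - i ≡ x - i + h
      lem = solve-∀
      lem₁ : ∀ f a b → f * a - f * b ≡ f * (a - b)
      lem₁ = solve-∀
      lem₂ : ∀ f w a b → f * (w * (a - b)) ≡ w * (f * a - f * b)
      lem₂ = solve-∀

    -- By `difference`, U - w δ is invariant under translation by `h`. If w ≠ 0, convolving with R
    -- and with S - T, whose products with U are constant and zero, makes R and S - T invariant too;
    -- adding S + T makes S invariant away from zero, and the translate of a vertex by `h` is its
    -- twin.
    U0≡Uh : U 0ℤ ≡ U h
    U0≡Uh with w ≟ 0ℤ
    ... | yes w≡0 = i-j≡0⇒i≡j (U 0ℤ) (U h) w≡0
    ... | no w≢0 = ⊥-elim (no-twins h n∤h R-inv S-inv)
      where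
      cancel : ∀ {a} → w * a ≡ 0ℤ → a ≡ 0ℤ
      cancel {a} e with i*j≡0⇒i≡0∨j≡0 w e
      ... | inj₁ w≡0 = contradiction w≡0 w≢0
      ... | inj₂ a≡0 = a≡0
      R-inv : ∀ x → R (x + h) ≡ R x
      R-inv x = i-j≡0⇒i≡j (R (x + h)) (R x) (cancel (trans (sym (conv-difference R perR x))
                  (i≡j⇒i-j≡0 (trans (conv-RU (x + h)) (sym (conv-RU x))))))
      ST-inv : ∀ x → (S (x + h) - S x) - (T (x + h) - T x) ≡ 0ℤ
      ST-inv x = cancel (trans (lem w (S (x + h) - S x) (T (x + h) - T x))
          (trans (sym (cong₂ _-_ (conv-difference S perS x) (conv-difference T perT x)))
          (i≡j⇒i-j≡0 (cong₂ _-_ (conv-SU≡TU (x + h)) (conv-SU≡TU x)))))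
        where
        lem : ∀ w a b → w * (a - b) ≡ w * a - w * b
        lem = solve-∀
      S-inv : ∀ x → ¬ + n ∣ x → ¬ + n ∣ x + h → S (x + h) ≡ S x
      S-inv x n∤x n∤x+h = *-cancelˡ-≡ (+ 2) (S (x + h)) (S x) (lin₂ 1ℤ (- 1ℤ) (ST-inv x)
          (trans (sym (U-off x n∤x)) (trans (U-inv x n∤x n∤x+h) (U-off (x + h) n∤x+h)))
          (lem (S (x + h)) (S x) (T (x + h)) (T x)))
        where
        lem : ∀ s′ s t′ t → + 2 * s′ - + 2 * s ≡ 1ℤ * ((s′ - s) - (t′ - t) - 0ℤ) + (- 1ℤ) * (s + t - (s′ + t′))
        lem = solve-∀

  -- Smallness of `U` at 0 comes only with the first alternative. In the second, `U` is constant off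
  -- zero while its value `- β` at 0 remains arbitrary.
  two-valuedU : TwoValued n U × (∀ x → Small (U x)) ⊎ (∀ x → ¬ + n ∣ x → U x ≡ U 1ℤ)
  two-valuedU with common-prime? n Δ 0<n
  ... | inj₂ cop = inj₂ (SmallCubic.constant-off-zero n 0<n 2∤n Δ U perU cubicU smallU cop)
  ... | inj₁ (p , pr , ℕ∣.divides h n≡hp , p∣Δ) = inj₁ (two-valued n 0<n 2∤n Δ U perU cubicU small′ , small′)
    where
    open SmallCubic n 0<n 2∤n Δ U perU cubicU smallU
    p≢2 : p ≢ 2
    p≢2 refl = 2∤n (ℕ∣.divides h n≡hp)
    n∤h : ¬ + n ∣ + h
    n∤h = small-∤ (ℕₚ.n≢0⇒n>0 λ { refl → ℕₚ.<⇒≢ 0<n (sym n≡hp) })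
      (subst (h ℕ.<_) (sym n≡hp) (ℕₚ.m<m*n h p {{ℕ.≢-nonZero λ { refl → ℕₚ.<⇒≢ 0<n (sym n≡hp) }}} (prime>1 pr)))
    U-inv : ∀ x → ¬ + n ∣ x → ¬ + n ∣ x + + h → U x ≡ U (x + + h)
    U-inv x n∤x n∤x+h = ≡-of-congruence pr p≢2 x (x + + h) n∤x n∤x+h
      (translate-congruence pr p∣Δ h (trans n≡hp (ℕₚ.*-comm h p)) x)
    small′ : ∀ x → Small (U x)
    small′ x with + n ∣? x
    ... | no n∤x = smallU x n∤x
    ... | yes n∣x = subst Small (sym (trans (periodic-≡ perU {x} {0ℤ} (subst (+ n ∣_) (sym (+-identityʳ x)) n∣x))
                      (Translate.U0≡Uh (+ h) n∤h U-inv))) (smallU (+ h) n∤h)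

-- Signs and cancellation in ℤ

*-nonneg : ∀ {x y} → 0ℤ ≤ x → 0ℤ ≤ y → 0ℤ ≤ x * y
*-nonneg {+ a} {+ b} _ _ = subst (0ℤ ≤_) (pos-* a b) 0≤+

pos+nonneg≢0 : ∀ {x y} → 0ℤ < x → 0ℤ ≤ y → x + y ≢ 0ℤ
pos+nonneg≢0 0<x 0≤y e = <-irrefl (sym e) (+-mono-<-≤ 0<x 0≤y)

*-cancel : ∀ c {x y} → c ≢ 0ℤ → c * x ≡ c * y → x ≡ y
*-cancel c {x} {y} c≢0 = *-cancelˡ-≡ c x y {{≢-nonZero c≢0}}

*-zero-cancel : ∀ {c x} → c ≢ 0ℤ → c * x ≡ 0ℤ → x ≡ 0ℤ
*-zero-cancel {c} c≢0 e with i*j≡0⇒i≡0∨j≡0 c e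
... | inj₁ c≡0 = contradiction c≡0 c≢0
... | inj₂ x≡0 = x≡0

nonneg∧≢0⇒pos : ∀ {x} → 0ℤ ≤ x → x ≢ 0ℤ → 0ℤ < x
nonneg∧≢0⇒pos 0≤x x≢0 = ≤∧≢⇒< 0≤x (x≢0 ∘ sym)

pos⇒≢0 : ∀ {x} → 0ℤ < x → x ≢ 0ℤ
pos⇒≢0 0<x refl = <-irrefl refl 0<x

pos-factor : ∀ {c x} → 0ℤ < c → 0ℤ < c * x → 0ℤ < x
pos-factor {c} {x} 0<c 0<cx = *-cancelˡ-<-nonNeg c {{nonNegative (<⇒≤ 0<c)}} (subst (_< c * x) (sym (*-zeroʳ c)) 0<cx)

∑-⟦⟧ : ∀ n l h → n ≡ l ℕ.* h → 0 ℕ.< h → ∑ n ⟦ + h ∣_⟧ ≡ + l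
∑-⟦⟧ n l h n≡lh 0<h = trans (∑-cong n (λ i → trans (trans (sym (⟦⟧-neg (+ h) i)) (cong ⟦ + h ∣_⟧ (sym (+-identityˡ (- i))))) (sym (*-identityʳ _))))
  (trans (∑-⟦⟧-coset n l h n≡lh 0<h {λ _ → 1ℤ} (λ _ → refl) 0ℤ) (trans (∑-const l 1ℤ) (*-identityʳ (+ l))))

-- The equation is (f - 1)² = 2 - y, so a positive `y` leaves only f = 0, 1, 2.
small-solutions : ∀ f y → 0ℤ < y → + f * + f ≡ + 2 * + f + 1ℤ - y →
  f ≡ 0 ⊎ (f ≡ 1 × y ≡ + 2) ⊎ (f ≡ 2 × y ≡ 1ℤ)
small-solutions zero y 0<y e = inj₁ refl
small-solutions (suc zero) y 0<y e = inj₂ (inj₁ (refl , lin₁ 1ℤ e (lem y)))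
  where
  lem : ∀ y → y - + 2 ≡ 1ℤ * (1ℤ * 1ℤ - (+ 2 * 1ℤ + 1ℤ - y))
  lem = solve-∀
small-solutions (suc (suc zero)) y 0<y e = inj₂ (inj₂ (refl , lin₁ 1ℤ e (lem y)))
  where
  lem : ∀ y → y - 1ℤ ≡ 1ℤ * (+ 2 * + 2 - (+ 2 * + 2 + 1ℤ - y))
  lem = solve-∀
small-solutions (suc (suc (suc j))) y 0<y e = contradiction
  (lin₁ 1ℤ e (lem (+ j) y))
  (pos+nonneg≢0 0<y (+-mono-≤ {0ℤ} {+ 2} 0≤+ (+-mono-≤ {0ℤ} {+ 4 * + j} (*-nonneg {+ 4} {+ j} 0≤+ 0≤+) (*-nonneg {+ j} {+ j} 0≤+ 0≤+))))
  where
  lem : ∀ j y → y + (+ 2 + (+ 4 * j + j * j)) - 0ℤ ≡ 1ℤ * ((+ 3 + j) * (+ 3 + j) - (+ 2 * (+ 3 + j) + 1ℤ - y))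
  lem = solve-∀

2h≢3 : ∀ h → + 2 * h ≢ + 3
2h≢3 h e = from-no (2 ℕ∣.∣? 3) (∣⇒∣ᵤ (divides {+ 2} {+ 3} h (trans (sym e) (*-comm (+ 2) h))))

-- Constant `U`, and coset sums for non-constant `U`

module Cases {n S T R k lam μ} (G : BicirculantSRG n S T R k lam μ) where

  open BicirculantSRG G
  open Classification G

  private
    +n≢0 : + n ≢ 0ℤ
    +n≢0 = pos⇒≢0 (+<+ 0<n)

  lam≡ : lam ≡ μ + β
  lam≡ = lem lam μ
    where
    lem : ∀ l m → l ≡ m + (l - m)
    lem = solve-∀

  -- Summing `U` gives 2σ = -β (n - 1), and `∑-mixed` then gives μ = -β ρ. For n > 1 the value -β is
  -- small: 0 contradicts μ ≠ 0, 1 yields the family, and 2 leaves only trivial graphs.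
  constant-case : (∀ x → U x ≡ - β) → Exceptional n k lam μ
  constant-case U-const = result
    where
    2σ : + 2 * σ ≡ - β * (+ n - 1ℤ)
    2σ = lin₂ 1ℤ (- 1ℤ) ∑U ∑T≡σ (lem σ (∑ n T) β (+ n))
      where
      lem : ∀ s t b n → + 2 * s - (- b * (n - 1ℤ)) ≡ 1ℤ * ((s + t - b) - n * (- b)) + (- 1ℤ) * (t - s)
      lem = solve-∀
      ∑U : σ + ∑ n T - β ≡ + n * (- β)
      ∑U = trans (sym (trans (∑-- n (λ x → S x + T x) (λ x → β * δ n x)) (cong₂ _-_ (∑-+ n S T)
             (trans (∑-*ˡ n β (δ n)) (trans (cong (β *_) (∑-δ n 0<n)) (*-identityʳ β))))))
           (trans (∑-cong n U-const) (∑-const n (- β)))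
    μ≡ : μ ≡ - β * ρ
    μ≡ = *-cancel (+ n) +n≢0 (lin₂ (- 1ℤ) ρ ∑-mixed 2σ (lem σ ρ β μ (+ n)))
      where
      lem : ∀ s r b m n → n * m - n * (- b * r) ≡ (- 1ℤ) * (+ 2 * (s * r) - (b * r + m * n)) + r * (+ 2 * s - (- b * (n - 1ℤ)))
      lem = solve-∀
    case-β : Small (- β) → Exceptional n k lam μ
    case-β (inj₁ -β≡0) = contradiction (trans μ≡ (trans (cong (_* ρ) -β≡0) (*-zeroˡ ρ))) μ≢0
    case-β (inj₂ (inj₁ -β≡1)) = family m n≡ k≡ lamₘ (sym m²≡μ)
      where
      -- Here μ = ρ and n = 2σ + 1, so the summed square equation becomes (σ - μ)² = μ.
      m : ℤ
      m = σ - μ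
      μ≡ρ : μ ≡ ρ
      μ≡ρ = trans μ≡ (trans (cong (_* ρ) -β≡1) (*-identityˡ ρ))
      β≡-1 : β ≡ - 1ℤ
      β≡-1 = trans (sym (neg-involutive β)) (cong -_ -β≡1)
      2σ≡ : + 2 * σ ≡ + n - 1ℤ
      2σ≡ = trans 2σ (trans (cong (_* (+ n - 1ℤ)) -β≡1) (*-identityˡ (+ n - 1ℤ)))
      k≡σ+μ : k ≡ σ + μ
      k≡σ+μ = trans (sym degreeS) (cong (λ z → σ + z) (sym μ≡ρ))
      square : σ * σ + μ * μ ≡ - 1ℤ * σ + (σ + μ - μ) + μ * + n
      square = subst₂ (λ r b → σ * σ + r * r ≡ b * σ + (σ + μ - μ) + μ * + n) (sym μ≡ρ) β≡-1
        (subst (λ κ → σ * σ + ρ * ρ ≡ β * σ + (κ - μ) + μ * + n) k≡σ+μ ∑-squareS)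
      m²≡μ : m * m ≡ μ
      m²≡μ = lin₂ 1ℤ (- μ) square 2σ≡ (lem σ μ (+ n))
        where
        lem : ∀ s m n → (s - m) * (s - m) - m ≡ 1ℤ * ((s * s + m * m) - (- 1ℤ * s + (s + m - m) + m * n)) + (- m) * (+ 2 * s - (n - 1ℤ))
        lem = solve-∀
      n≡ : + n ≡ + 2 * (m * m) + + 2 * m + 1ℤ
      n≡ = lin₂ (- 1ℤ) (- (+ 2)) 2σ≡ m²≡μ (lem σ μ (+ n))
        where
        lem : ∀ s u n → n - (+ 2 * ((s - u) * (s - u)) + + 2 * (s - u) + 1ℤ) ≡ (- 1ℤ) * (+ 2 * s - (n - 1ℤ)) + (- (+ 2)) * ((s - u) * (s - u) - u)
        lem = solve-∀
      k≡ : k ≡ + 2 * (m * m) + m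
      k≡ = trans k≡σ+μ (lin₁ (- (+ 2)) m²≡μ (lem σ μ))
        where
        lem : ∀ s u → s + u - (+ 2 * ((s - u) * (s - u)) + (s - u)) ≡ (- (+ 2)) * ((s - u) * (s - u) - u)
        lem = solve-∀
      lamₘ : lam ≡ m * m - 1ℤ
      lamₘ = trans lam≡ (cong₂ _+_ (sym m²≡μ) β≡-1)
    case-β (inj₂ (inj₂ -β≡2)) = ⊥-elim (absurd (i*j≡0⇒i≡0∨j≡0 (+ n - ρ) product≡0))
      where
      β≡-2 : β ≡ - (+ 2)
      β≡-2 = trans (sym (neg-involutive β)) (cong -_ -β≡2)
      σ≡ : σ ≡ + n - 1ℤ
      σ≡ = *-cancelˡ-≡ (+ 2) σ (+ n - 1ℤ) (trans 2σ (cong (_* (+ n - 1ℤ)) -β≡2))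
      μ≡2ρ : μ ≡ + 2 * ρ
      μ≡2ρ = trans μ≡ (cong (_* ρ) -β≡2)
      k≡ : k ≡ (+ n - 1ℤ) + ρ
      k≡ = trans (sym degreeS) (cong (_+ ρ) σ≡)
      square : (+ n - 1ℤ) * (+ n - 1ℤ) + ρ * ρ ≡ - (+ 2) * (+ n - 1ℤ) + ((+ n - 1ℤ) + ρ - + 2 * ρ) + + 2 * ρ * + n
      square = subst₂ (λ s b → s * s + ρ * ρ ≡ b * s + ((+ n - 1ℤ) + ρ - + 2 * ρ) + + 2 * ρ * + n) σ≡ β≡-2
        (subst₂ (λ κ m → σ * σ + ρ * ρ ≡ β * σ + (κ - m) + m * + n) k≡ μ≡2ρ ∑-squareS)
      product≡0 : (+ n - ρ) * (+ n - ρ - 1ℤ) ≡ 0ℤ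
      product≡0 = lin₁ 1ℤ square (lem (+ n) ρ)
        where
        lem : ∀ n r → (n - r) * (n - r - 1ℤ) - 0ℤ ≡ 1ℤ * (((n - 1ℤ) * (n - 1ℤ) + r * r) - (- (+ 2) * (n - 1ℤ) + ((n - 1ℤ) + r - + 2 * r) + + 2 * r * n))
        lem = solve-∀
      -- ρ = n belongs to the complete graph, ρ = n - 1 to the complement of a perfect matching.
      absurd : + n - ρ ≡ 0ℤ ⊎ + n - ρ - 1ℤ ≡ 0ℤ → ⊥
      absurd (inj₁ e) = lam≢k-1 (trans lam≡ (trans (cong₂ _+_ μ≡2ρ β≡-2) (trans (lin₁ (- 1ℤ) e (lem (+ n) ρ)) (cong (_- 1ℤ) (sym k≡)))))
        where
        lem : ∀ n r → + 2 * r + - (+ 2) - ((n - 1ℤ) + r - 1ℤ) ≡ (- 1ℤ) * ((n - r) - 0ℤ)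
        lem = solve-∀
      absurd (inj₂ e) = k≢μ (trans k≡ (trans (lin₁ 1ℤ e (lem (+ n) ρ)) (sym μ≡2ρ)))
        where
        lem : ∀ n r → (n - 1ℤ) + r - + 2 * r ≡ 1ℤ * ((n - r - 1ℤ) - 0ℤ)
        lem = solve-∀
    -- With n = 1 there is no non-zero residue at which smallness could bound `β`; instead ρ² = ρ,
    -- and both roots are excluded.
    one-case : n ≡ 1 → ⊥
    one-case n≡1 = absurd (i*j≡0⇒i≡0∨j≡0 ρ ρ²≡ρ)
      where
      +n≡1 : + n ≡ 1ℤ
      +n≡1 = cong +_ n≡1
      σ≡0 : σ ≡ 0ℤ
      σ≡0 = *-cancelˡ-≡ (+ 2) σ 0ℤ (trans 2σ (trans (cong (λ z → - β * (z - 1ℤ)) +n≡1) (*-zeroʳ (- β))))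
      k≡ρ : k ≡ ρ
      k≡ρ = trans (sym degreeS) (trans (cong (_+ ρ) σ≡0) (+-identityˡ ρ))
      ρ²≡ρ : ρ * (ρ - 1ℤ) ≡ 0ℤ
      ρ²≡ρ = lin₃ 1ℤ (β - σ) (μ) ∑-squareS σ≡0 +n≡1 (trans (lem ρ σ β μ (+ n)) (cong (λ κ → 1ℤ * ((σ * σ + ρ * ρ) - (β * σ + (κ - μ) + μ * + n)) + (β - σ) * (σ - 0ℤ) + μ * (+ n - 1ℤ)) (sym k≡ρ)))
        where
        lem : ∀ r s b m n → r * (r - 1ℤ) - 0ℤ ≡ 1ℤ * ((s * s + r * r) - (b * s + (r - m) + m * n)) + (b - s) * (s - 0ℤ) + m * (n - 1ℤ)
        lem = solve-∀
      absurd : ρ ≡ 0ℤ ⊎ ρ - 1ℤ ≡ 0ℤ → ⊥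
      absurd (inj₁ ρ≡0) = μ≢0 (trans μ≡ (trans (cong (- β *_) ρ≡0) (*-zeroʳ (- β))))
      absurd (inj₂ e) = lam≢k-1 (trans lam≡ (trans (lin₂ 1ℤ (- β - 1ℤ) μ≡ e (lem μ β ρ)) (cong (_- 1ℤ) (sym k≡ρ))))
        where
        lem : ∀ m b r → (m + b) - (r - 1ℤ) ≡ 1ℤ * (m - (- b * r)) + (- b - 1ℤ) * ((r - 1ℤ) - 0ℤ)
        lem = solve-∀
    result : Exceptional n k lam μ
    result with n ℕₚ.≟ 1
    ... | yes n≡1 = ⊥-elim (one-case n≡1)
    ... | no n≢1 = case-β (subst Small (U-const 1ℤ) (smallU 1ℤ (λ d → n≢1 (ℕ∣.∣1⇒≡1 (∣⇒∣ᵤ d)))))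

  -- Convolution with `H` sums over cosets of the multiples of `h`. Since w ≠ 0, the equations for
  -- `U` pass to `H`: R meets every coset in `ρ₀` points, while S and T have equal coset counts,
  -- `s₁ + e` on the subgroup and `s₁` on every other coset. As h ≠ 1, the residue 1 is a sample off
  -- the subgroup.
  module Coset (l h : ℕ) (n≡lh : n ≡ l ℕ.* h) (u u′ : ℤ) (h≢1 : h ≢ 1) (u≢u′ : u ≢ u′)
    (off : ∀ x → ¬ + h ∣ x → U x ≡ u) (on : ∀ x → + h ∣ x → U x ≡ u′) where

    L hh w : ℤ
    L = + l
    hh = + h
    w = u′ - u

    H : ℤ → ℤ
    H x = ⟦ + h ∣ x ⟧

    0<h : 0 ℕ.< h
    0<h = ℕₚ.n≢0⇒n>0 λ { refl → ℕₚ.<⇒≢ 0<n (sym (trans n≡lh (ℕₚ.*-zeroʳ l))) }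

    0<l : 0 ℕ.< l
    0<l = ℕₚ.n≢0⇒n>0 λ { refl → ℕₚ.<⇒≢ 0<n (sym n≡lh) }

    0<L : 0ℤ < L
    0<L = +<+ 0<l

    0<hh : 0ℤ < hh
    0<hh = +<+ 0<h

    +n≡ : + n ≡ L * hh
    +n≡ = trans (cong +_ n≡lh) (pos-* l h)

    w≢0 : w ≢ 0ℤ
    w≢0 e = u≢u′ (sym (i-j≡0⇒i≡j u′ u e))

    perH : Periodic n H
    perH = ⟦⟧-periodic n h l n≡lh

    H1 : H 1ℤ ≡ 0ℤ
    H1 = ⟦⟧-no (λ d → h≢1 (ℕ∣.∣1⇒≡1 (∣⇒∣ᵤ d)))

    H0 : H 0ℤ ≡ 1ℤ
    H0 = ⟦⟧-yes (divides 0ℤ refl)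

    U≡ : ∀ x → U x ≡ u + w * H x
    U≡ x with + h ∣? x
    ... | yes d = trans (on x d) (trans (lem u u′) (cong (λ z → u + w * z) (sym (⟦⟧-yes d))))
      where
      lem : ∀ u v → v ≡ u + (v - u) * 1ℤ
      lem = solve-∀
    ... | no ¬d = trans (off x ¬d) (trans (lem u w) (cong (λ z → u + w * z) (sym (⟦⟧-no ¬d))))
      where
      lem : ∀ u w → u ≡ u + w * 0ℤ
      lem = solve-∀

    u′≡-β : u′ ≡ - β
    u′≡-β = trans (sym (on 0ℤ (divides 0ℤ refl))) (U-zero 0ℤ (divides 0ℤ refl))

    ∑H : ∑ n H ≡ L
    ∑H = ∑-⟦⟧ n l h n≡lh 0<h

    conv-U-H : ∀ F x → conv n F U x ≡ ∑ n F * u + w * conv n F H x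
    conv-U-H F x = trans (conv-cong n {F} {F} {U} {λ i → u + w * H i} (λ _ → refl) U≡ x)
      (trans (conv-+ʳ n F (λ _ → u) (λ i → w * H i) x) (cong₂ _+_ (conv-constʳ n F u x) (conv-*ʳ n w F H x)))

    ρ₀ s₁ e : ℤ
    ρ₀ = conv n R H 0ℤ
    s₁ = conv n S H 1ℤ
    e = conv n S H 0ℤ - s₁

    RH : ∀ x → conv n R H x ≡ ρ₀
    RH x = *-cancel w w≢0 (lin₂ 1ℤ (- 1ℤ)
        (trans (sym (conv-U-H R x)) (conv-RU x)) (trans (sym (conv-U-H R 0ℤ)) (conv-RU 0ℤ))
        (lem w (conv n R H x) ρ₀ (ρ * u) μ))
      where
      lem : ∀ w a b c m → w * a - w * b ≡ 1ℤ * ((c + w * a) - m) + (- 1ℤ) * ((c + w * b) - m)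
      lem = solve-∀

    SH≡TH : ∀ x → conv n S H x ≡ conv n T H x
    SH≡TH x = *-cancel w w≢0 (lin₂ 1ℤ u
        (trans (sym (conv-U-H S x)) (trans (conv-SU≡TU x) (conv-U-H T x))) ∑T≡σ
        (lem w (conv n S H x) (conv n T H x) u σ (∑ n T)))
      where
      lem : ∀ w a b u s t → w * a - w * b ≡ 1ℤ * ((s * u + w * a) - (t * u + w * b)) + u * (t - s)
      lem = solve-∀

    HH : ∀ x → conv n H H x ≡ L * H x
    HH x = trans (conv-def n H H x) (trans (∑-cong n eq) (trans (∑-*ʳ n (H x) H) (cong (_* H x) ∑H)))
      where
      eq : ∀ i → H i * H (x - i) ≡ H i * H x
      eq i with + h ∣? i
      ... | yes d = cong (H i *_) (⟦⟧-resp (+ h) (x - i) x (subst (+ h ∣_) (lem x i) (∣m⇒∣-m d)))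
        where
        lem : ∀ x i → - i ≡ x - i - x
        lem = solve-∀
      ... | no ¬d = trans (cong (_* H (x - i)) (⟦⟧-no ¬d)) (sym (cong (_* H x) (⟦⟧-no ¬d)))

    2SH : ∀ x → + 2 * conv n S H x ≡ u * L + (w * L + β) * H x
    2SH x = lin₃ 1ℤ 1ℤ 1ℤ (SH≡TH x) ST UH′ (lem (conv n S H x) (conv n T H x) (conv n H U x) u w L β (H x))
      where
      UH : conv n H U x ≡ conv n H S x + conv n H T x - β * H x
      UH = conv-U H perH x
      UH′ : conv n H U x ≡ L * u + w * (L * H x)
      UH′ = trans (conv-U-H H x) (cong₂ (λ a b → a * u + w * b) ∑H (HH x))
      ST : conv n S H x + conv n T H x ≡ conv n H U x + β * H x
      ST = trans (cong₂ _+_ (conv-comm n perS perH x) (conv-comm n perT perH x))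
             (trans (lem₀ (conv n H S x) (conv n H T x) (β * H x)) (cong (_+ β * H x) (sym UH)))
        where
        lem₀ : ∀ a b c → a + b ≡ a + b - c + c
        lem₀ = solve-∀
      lem : ∀ s t v u w L b H → + 2 * s - (u * L + (w * L + b) * H) ≡
        1ℤ * (s - t) + 1ℤ * ((s + t) - (v + b * H)) + 1ℤ * (v - (L * u + w * (L * H)))
      lem = solve-∀

    2s₁ : + 2 * s₁ ≡ u * L
    2s₁ = trans (2SH 1ℤ) (trans (cong (λ z → u * L + (w * L + β) * z) H1) (lem (u * L) (w * L + β)))
      where
      lem : ∀ a b → a + b * 0ℤ ≡ a
      lem = solve-∀

    2e : + 2 * e ≡ w * L + β
    2e = lin₂ 1ℤ (- 1ℤ) (trans (2SH 0ℤ) (cong (λ z → u * L + (w * L + β) * z) H0)) 2s₁ (lem (conv n S H 0ℤ) s₁ (u * L) (w * L + β))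
      where
      lem : ∀ a s b c → + 2 * (a - s) - c ≡ 1ℤ * (+ 2 * a - (b + c * 1ℤ)) + (- 1ℤ) * (+ 2 * s - b)
      lem = solve-∀

    SH : ∀ x → conv n S H x ≡ s₁ + e * H x
    SH x = *-cancelˡ-≡ (+ 2) (conv n S H x) (s₁ + e * H x) (lin₃ 1ℤ (- 1ℤ) (- H x) (2SH x) 2s₁ 2e
        (lem (conv n S H x) s₁ e (H x) (u * L) (w * L + β)))
      where
      lem : ∀ a s e H b c → + 2 * a - + 2 * (s + e * H) ≡ 1ℤ * (+ 2 * a - (b + c * H)) + (- 1ℤ) * (+ 2 * s - b) + (- H) * (+ 2 * e - c)
      lem = solve-∀

    σ≡ : σ ≡ hh * s₁ + e
    σ≡ = *-cancel L (pos⇒≢0 0<L) (lin₂ 1ℤ s₁ (trans (sym (trans (∑-conv n S perH) (cong (σ *_) ∑H)))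
          (trans (∑-cong n SH) (trans (∑-+ n _ _) (cong₂ _+_ (∑-const n s₁) (trans (∑-*ˡ n e H) (cong (e *_) ∑H)))))) +n≡
          (lem L σ hh s₁ e (+ n)))
      where
      lem : ∀ L s h s₁ e n → L * s - L * (h * s₁ + e) ≡ 1ℤ * (s * L - (n * s₁ + e * L)) + s₁ * (n - L * h)
      lem = solve-∀

    ρ≡ : ρ ≡ hh * ρ₀
    ρ≡ = *-cancel L (pos⇒≢0 0<L) (lin₂ 1ℤ ρ₀ (trans (sym (trans (∑-conv n R perH) (cong (ρ *_) ∑H)))
          (trans (∑-cong n RH) (∑-const n ρ₀))) +n≡ (lem L ρ hh ρ₀ (+ n)))
      where
      lem : ∀ L r h r₀ n → L * r - L * (h * r₀) ≡ 1ℤ * (r * L - n * r₀) + r₀ * (n - L * h)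
      lem = solve-∀

    -- The equation `squareS` summed over cosets. Its value off the subgroup is `eqB`; subtracting
    -- that from the value at 0 gives `eqA`, which makes `e` a root of x² - β x - (k - μ).
    square-H : ∀ x → σ * s₁ + e * (s₁ + e * H x) + ρ * ρ₀ ≡ β * (s₁ + e * H x) + (k - μ) * H x + μ * L
    square-H x = trans (sym (cong₂ _+_ SSH RRH)) (trans (sym (conv-+ˡ n (conv n S S) (conv n R R°) H x))
      (trans (conv-cong n {λ x → conv n S S x + conv n R R° x} {λ x → (β * S x + (k - μ) * δ n x) + μ * 1ℤ} {H} {H}
          (λ x → trans (squareS x) (cong (λ z → β * S x + (k - μ) * δ n x + z) (sym (*-identityʳ μ)))) (λ _ → refl) x)
      (trans (conv-+ˡ n (λ x → β * S x + (k - μ) * δ n x) (λ _ → μ * 1ℤ) H x)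
      (cong₂ _+_ (trans (conv-+ˡ n (λ x → β * S x) (λ x → (k - μ) * δ n x) H x)
                   (cong₂ _+_ (trans (conv-*ˡ n β S H x) (cong (β *_) (SH x)))
                              (trans (conv-*ˡ n (k - μ) (δ n) H x) (cong ((k - μ) *_) (trans (conv-comm n (δ-periodic n) perH x) (conv-δʳ n 0<n perH x))))))
                 (trans (conv-*ˡ n μ (λ _ → 1ℤ) H x) (cong (μ *_) (trans (conv-comm n (λ _ → refl) perH x) (trans (conv-constʳ n H 1ℤ x) (trans (*-identityʳ _) ∑H)))))))))
      where
      SSH : conv n (conv n S S) H x ≡ σ * s₁ + e * (s₁ + e * H x)
      SSH = trans (conv-assoc n {S} {S} {H} perS perH x)
        (trans (conv-cong n {S} {S} {conv n S H} {λ x → s₁ + e * H x} (λ _ → refl) SH x)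
        (trans (conv-+ʳ n S (λ _ → s₁) (λ x → e * H x) x)
        (cong₂ _+_ (conv-constʳ n S s₁ x) (trans (conv-*ʳ n e S H x) (cong (e *_) (SH x))))))
      RRH : conv n (conv n R R°) H x ≡ ρ * ρ₀
      RRH = trans (conv-cong n {conv n R R°} {conv n R° R} {H} {H} (conv-comm n perR perR°) (λ _ → refl) x)
        (trans (conv-assoc n {R°} {R} {H} perR perH x)
        (trans (conv-cong n {R°} {R°} {conv n R H} {λ _ → ρ₀} (λ _ → refl) RH x)
        (trans (conv-constʳ n R° ρ₀ x) (cong (_* ρ₀) ∑R°≡ρ))))

    eqB : σ * s₁ + e * s₁ + ρ * ρ₀ ≡ β * s₁ + μ * L
    eqB = lin₂ 1ℤ (β * e + (k - μ) - e * e) (square-H 1ℤ) H1 (lem (σ * s₁) e s₁ (ρ * ρ₀) β (k - μ) (μ * L) (H 1ℤ))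
      where
      lem : ∀ a e s c b km d H → (a + e * s + c) - (b * s + d) ≡
        1ℤ * ((a + e * (s + e * H) + c) - (b * (s + e * H) + km * H + d)) + (b * e + km - e * e) * (H - 0ℤ)
      lem = solve-∀

    eqA : e * e ≡ β * e + (k - μ)
    eqA = lin₃ 1ℤ (- 1ℤ) (β * e + (k - μ) - e * e) (square-H 0ℤ) eqB H0 (lem (σ * s₁) e s₁ (ρ * ρ₀) β (k - μ) (μ * L) (H 0ℤ))
      where
      lem : ∀ a e s c b km d H → e * e - (b * e + km) ≡
        1ℤ * ((a + e * (s + e * H) + c) - (b * (s + e * H) + km * H + d)) + (- 1ℤ) * ((a + e * s + c) - (b * s + d)) + (b * e + km - e * e) * (H - 1ℤ)
      lem = solve-∀

    eqC : + 2 * (σ * ρ) ≡ β * ρ + μ * (L * hh)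
    eqC = trans ∑-mixed (cong (λ z → β * ρ + μ * z) +n≡)

    0≤ρ₀ : 0ℤ ≤ ρ₀
    0≤ρ₀ = subst (0ℤ ≤_) (sym (conv-def n R H 0ℤ)) (∑-nonneg n (λ i → *-nonneg (bit-nonneg (bitR i)) (H≥0 (0ℤ - i))))
      where
      H≥0 : ∀ x → 0ℤ ≤ H x
      H≥0 x with + h ∣? x
      ... | yes d = subst (0ℤ ≤_) (sym (⟦⟧-yes d)) 0≤+
      ... | no ¬d = subst (0ℤ ≤_) (sym (⟦⟧-no ¬d)) ≤-refl

    -- For l = 1 the indicator `H` is the unit for convolution, so e = - S(1) is 0 or -1, and `eqA`
    -- becomes k = μ or λ = k - 1.
    trivial-coset : l ≡ 1 → ⊥
    trivial-coset refl = absurd (bitS 1ℤ)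
      where
      h≡n : h ≡ n
      h≡n = sym (trans n≡lh (ℕₚ.+-identityʳ h))
      SH≡S : ∀ x → conv n S H x ≡ S x
      SH≡S x = trans (cong (λ m → conv n S ⟦ + m ∣_⟧ x) h≡n) (conv-δʳ n 0<n perS x)
      e≡ : e ≡ - S 1ℤ
      e≡ = trans (cong₂ _-_ (trans (SH≡S 0ℤ) (zeroS 0ℤ (divides 0ℤ refl))) (SH≡S 1ℤ)) (+-identityˡ (- S 1ℤ))
      absurd : Bit (S 1ℤ) → ⊥
      absurd (inj₁ s≡0) = k≢μ (lin₂ (- 1ℤ) (e - β) eqA (trans e≡ (cong -_ s≡0)) (lem e β k μ))
        where
        lem : ∀ e b k m → k - m ≡ (- 1ℤ) * (e * e - (b * e + (k - m))) + (e - b) * (e - 0ℤ)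
        lem = solve-∀
      absurd (inj₂ s≡1) = lam≢k-1 (lin₂ 1ℤ (β + 1ℤ - e) eqA (trans e≡ (cong -_ s≡1)) (lem e lam k μ))
        where
        lem : ∀ e l k m → l - (k - 1ℤ) ≡ 1ℤ * (e * e - ((l - m) * e + (k - m))) + ((l - m) + 1ℤ - e) * (e - (- 1ℤ))
        lem = solve-∀

-- Integer solutions of the coset equations

record CosetEquations (L h ρ₀ s₁ e σ ρ k μ β : ℤ) : Set where
  field
    σ≡ : σ ≡ h * s₁ + e
    ρ≡ : ρ ≡ h * ρ₀
    k≡ : k ≡ σ + ρ
    eqA : e * e ≡ β * e + (k - μ)
    eqB : σ * s₁ + e * s₁ + ρ * ρ₀ ≡ β * s₁ + μ * L
    eqC : + 2 * (σ * ρ) ≡ β * ρ + μ * (L * h)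
    0<h : 0ℤ < h
    0≤ρ₀ : 0ℤ ≤ ρ₀
    μ≢0 : μ ≢ 0ℤ

odd : ℕ → ℤ
odd f = 1ℤ + + 2 * + f

0<odd : ∀ f → 0ℤ < odd f
0<odd f = +-mono-<-≤ {0ℤ} {1ℤ} 0<+ (*-nonneg {+ 2} {+ f} 0≤+ 0≤+)

-- 2f² - f - 1 = (2f + 1)(f - 1) is non-negative for f ≥ 1.
quadratic-absurd : ∀ f y → f ≢ 0 → 0ℤ < y → + 2 * (+ f * + f) - + f - 1ℤ + y ≢ 0ℤ
quadratic-absurd zero    y f≢0 _   = contradiction refl f≢0
quadratic-absurd (suc j) y _   0<y e = pos+nonneg≢0 0<y
  (+-mono-≤ (*-nonneg {+ 3} {+ j} 0≤+ 0≤+) (*-nonneg {+ 2} 0≤+ (*-nonneg {+ j} {+ j} 0≤+ 0≤+)))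
  (trans (lem (+ j) y) e)
  where
  lem : ∀ j y → y + (+ 3 * j + + 2 * (j * j)) ≡ + 2 * ((1ℤ + j) * (1ℤ + j)) - (1ℤ + j) - 1ℤ + y
  lem = solve-∀

-- The indices in these names are the values of `U` off and on the subgroup. Here S and T partition
-- the non-zero elements of a subgroup of order 2f + 1. The equations reduce to ρ₀ = μ, h μ = 2f + 1
-- and (f - 1)² = 2 - μ; f = 1 fails by parity.
coset-case₀₁ : ∀ f {h ρ₀ σ ρ k μ} → f ≢ 0 → CosetEquations (odd f) h ρ₀ 0ℤ (+ f) σ ρ k μ (- 1ℤ) →
  f ≡ 2 × h ≡ + 5 × k ≡ + 7 × μ ≡ 1ℤ
coset-case₀₁ f {h} {ρ₀} {μ = μ} f≢0 record { σ≡ = refl ; ρ≡ = refl ; k≡ = refl ; eqA = A ; eqB = B ; eqC = C ; 0<h = 0<h ; 0≤ρ₀ = 0≤ρ₀ ; μ≢0 = μ≢0 } =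
  finish (small-solutions f μ 0<μ A′)
  where
  L = odd f
  ρ₀≡μ : ρ₀ ≡ μ
  ρ₀≡μ = *-cancel (h * L) (λ e → pos⇒≢0 (0<odd f) (*-zero-cancel (pos⇒≢0 0<h) e)) (lin₁ 1ℤ C (lem h ρ₀ μ (+ f)))
    where
    lem : ∀ h r m f → h * (1ℤ + + 2 * f) * r - h * (1ℤ + + 2 * f) * m ≡
      1ℤ * (+ 2 * ((h * 0ℤ + f) * (h * r)) - ((- 1ℤ) * (h * r) + m * ((1ℤ + + 2 * f) * h)))
    lem = solve-∀
  0<μ : 0ℤ < μ
  0<μ = nonneg∧≢0⇒pos (subst (0ℤ ≤_) ρ₀≡μ 0≤ρ₀) μ≢0
  hμ≡L : h * μ ≡ L
  hμ≡L = *-cancel μ μ≢0 (lin₂ 1ℤ (- (h * (ρ₀ + μ))) B ρ₀≡μ (lem h ρ₀ μ (+ f)))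
    where
    lem : ∀ h r m f → m * (h * m) - m * (1ℤ + + 2 * f) ≡
      1ℤ * ((h * 0ℤ + f) * 0ℤ + f * 0ℤ + h * r * r - ((- 1ℤ) * 0ℤ + m * (1ℤ + + 2 * f))) + (- (h * (r + m))) * (r - m)
    lem = solve-∀
  A′ : + f * + f ≡ + 2 * + f + 1ℤ - μ
  A′ = lin₃ 1ℤ h 1ℤ A ρ₀≡μ hμ≡L (lem h ρ₀ μ (+ f))
    where
    lem : ∀ h r m f → f * f - (+ 2 * f + 1ℤ - m) ≡
      1ℤ * (f * f - ((- 1ℤ) * f + ((h * 0ℤ + f) + h * r - m))) + h * (r - m) + 1ℤ * (h * m - (1ℤ + + 2 * f))
    lem = solve-∀
  finish : f ≡ 0 ⊎ (f ≡ 1 × μ ≡ + 2) ⊎ (f ≡ 2 × μ ≡ 1ℤ) → f ≡ 2 × h ≡ + 5 × (h * 0ℤ + + f) + h * ρ₀ ≡ + 7 × μ ≡ 1ℤ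
  finish (inj₁ f≡0) = contradiction f≡0 f≢0
  finish (inj₂ (inj₁ (refl , μ≡2))) = contradiction (trans (*-comm (+ 2) h) (trans (cong (h *_) (sym μ≡2)) hμ≡L)) (2h≢3 h)
  finish (inj₂ (inj₂ (refl , μ≡1))) = refl , h≡5 , trans (cong₂ (λ h r → h * 0ℤ + + 2 + h * r) h≡5 (trans ρ₀≡μ μ≡1)) refl , μ≡1
    where
    h≡5 : h ≡ + 5
    h≡5 = trans (sym (*-identityʳ h)) (trans (cong (h *_) (sym μ≡1)) hμ≡L)

-- S and T both consist of all non-zero elements of the subgroup. Then μ = 2ρ₀ and h ρ₀ = 2 (2f +
-- 1), which turns `eqA` into the equation of `quadratic-absurd`.
coset-case₀₂ : ∀ f {h ρ₀ σ ρ k μ} → f ≢ 0 → ¬ CosetEquations (odd f) h ρ₀ 0ℤ (+ 2 * + f) σ ρ k μ (- (+ 2))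
coset-case₀₂ f {h} {ρ₀} {μ = μ} f≢0 record { σ≡ = refl ; ρ≡ = refl ; k≡ = refl ; eqA = A ; eqB = B ; eqC = C ; 0<h = 0<h ; 0≤ρ₀ = 0≤ρ₀ ; μ≢0 = μ≢0 } =
  quadratic-absurd f ρ₀ f≢0 (nonneg∧≢0⇒pos 0≤ρ₀ ρ₀≢0) A′
  where
  L = odd f
  μ≡2ρ₀ : μ ≡ + 2 * ρ₀
  μ≡2ρ₀ = *-cancel (h * L) (λ e → pos⇒≢0 (0<odd f) (*-zero-cancel (pos⇒≢0 0<h) e)) (lin₁ (- 1ℤ) C (lem h ρ₀ μ (+ f)))
    where
    lem : ∀ h r m f → h * (1ℤ + + 2 * f) * m - h * (1ℤ + + 2 * f) * (+ 2 * r) ≡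
      (- 1ℤ) * (+ 2 * ((h * 0ℤ + + 2 * f) * (h * r)) - ((- (+ 2)) * (h * r) + m * ((1ℤ + + 2 * f) * h)))
    lem = solve-∀
  ρ₀≢0 : ρ₀ ≢ 0ℤ
  ρ₀≢0 e = μ≢0 (trans μ≡2ρ₀ (cong (+ 2 *_) e))
  hρ₀≡2L : h * ρ₀ ≡ + 2 * L
  hρ₀≡2L = *-cancel ρ₀ ρ₀≢0 (lin₂ 1ℤ L B μ≡2ρ₀ (lem h ρ₀ μ (+ f)))
    where
    lem : ∀ h r m f → r * (h * r) - r * (+ 2 * (1ℤ + + 2 * f)) ≡
      1ℤ * ((h * 0ℤ + + 2 * f) * 0ℤ + + 2 * f * 0ℤ + h * r * r - ((- (+ 2)) * 0ℤ + m * (1ℤ + + 2 * f))) + (1ℤ + + 2 * f) * (m - + 2 * r)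
    lem = solve-∀
  A′ : + 2 * (+ f * + f) - + f - 1ℤ + ρ₀ ≡ 0ℤ
  A′ = *-cancelˡ-≡ (+ 2) _ 0ℤ (lin₃ 1ℤ (- 1ℤ) 1ℤ A μ≡2ρ₀ hρ₀≡2L (lem h ρ₀ μ (+ f)))
    where
    lem : ∀ h r m f → + 2 * (+ 2 * (f * f) - f - 1ℤ + r) - + 2 * 0ℤ ≡
      1ℤ * (+ 2 * f * (+ 2 * f) - ((- (+ 2)) * (+ 2 * f) + ((h * 0ℤ + + 2 * f) + h * r - m))) + (- 1ℤ) * (m - + 2 * r) + 1ℤ * (h * r - + 2 * (1ℤ + + 2 * f))
    lem = solve-∀

-- Complementary to `coset-case₀₁`: r = L - ρ₀ is the coset count of the complement of R. Either r =
-- 0, which forces f = 0, or `r` satisfies the equations that μ satisfied there.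
coset-case₂₁ : ∀ f {h ρ₀ σ ρ k μ} → f ≢ 0 → CosetEquations (odd f) h ρ₀ (odd f) (- 1ℤ - + f) σ ρ k μ (- 1ℤ) →
  f ≡ 2 × h ≡ + 5 × k ≡ + 42 × μ ≡ + 36
coset-case₂₁ f {h} {ρ₀} {μ = μ} f≢0 record { σ≡ = refl ; ρ≡ = refl ; k≡ = refl ; eqA = A ; eqB = B ; eqC = C ; 0<h = 0<h } =
  finish (i*j≡0⇒i≡0∨j≡0 r rr)
  where
  L r : ℤ
  L = odd f
  r = L - ρ₀
  μ≡ : μ ≡ ρ₀ * (+ 2 * h - 1ℤ)
  μ≡ = *-cancel (h * L) (λ e → pos⇒≢0 (0<odd f) (*-zero-cancel (pos⇒≢0 0<h) e)) (lin₁ (- 1ℤ) C (lem h ρ₀ μ (+ f)))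
    where
    lem : ∀ h r m f → h * (1ℤ + + 2 * f) * m - h * (1ℤ + + 2 * f) * (r * (+ 2 * h - 1ℤ)) ≡
      (- 1ℤ) * (+ 2 * ((h * (1ℤ + + 2 * f) + (- 1ℤ - f)) * (h * r)) - ((- 1ℤ) * (h * r) + m * ((1ℤ + + 2 * f) * h)))
    lem = solve-∀
  rr : r * (h * r - L) ≡ 0ℤ
  rr = lin₂ 1ℤ L B μ≡ (lem h ρ₀ μ (+ f))
    where
    lem : ∀ h r m f → (1ℤ + + 2 * f - r) * (h * (1ℤ + + 2 * f - r) - (1ℤ + + 2 * f)) - 0ℤ ≡
      1ℤ * ((h * (1ℤ + + 2 * f) + (- 1ℤ - f)) * (1ℤ + + 2 * f) + (- 1ℤ - f) * (1ℤ + + 2 * f) + h * r * r - ((- 1ℤ) * (1ℤ + + 2 * f) + m * (1ℤ + + 2 * f)))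
      + (1ℤ + + 2 * f) * (m - r * (+ 2 * h - 1ℤ))
    lem = solve-∀
  A′ : (1ℤ + + f) * (1ℤ + + f) ≡ h * r + L - r
  A′ = lin₂ 1ℤ (- 1ℤ) A μ≡ (lem h ρ₀ μ (+ f))
    where
    lem : ∀ h r m f → (1ℤ + f) * (1ℤ + f) - (h * (1ℤ + + 2 * f - r) + (1ℤ + + 2 * f) - (1ℤ + + 2 * f - r)) ≡
      1ℤ * ((- 1ℤ - f) * (- 1ℤ - f) - ((- 1ℤ) * (- 1ℤ - f) + ((h * (1ℤ + + 2 * f) + (- 1ℤ - f)) + h * r - m))) + (- 1ℤ) * (m - r * (+ 2 * h - 1ℤ))
    lem = solve-∀
  finish : r ≡ 0ℤ ⊎ h * r - L ≡ 0ℤ →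
    f ≡ 2 × h ≡ + 5 × (h * L + (- 1ℤ - + f)) + h * ρ₀ ≡ + 42 × μ ≡ + 36
  finish (inj₁ r≡0) = contradiction (*-zero-cancel f′≢0 (lin₂ 1ℤ (h - 1ℤ) A′ r≡0 (lem h r (+ f)))) f′≢0
    where
    f′≢0 : + f ≢ 0ℤ
    f′≢0 e = f≢0 (+-injective e)
    lem : ∀ h r f → f * f - 0ℤ ≡ 1ℤ * ((1ℤ + f) * (1ℤ + f) - (h * r + (1ℤ + + 2 * f) - r)) + (h - 1ℤ) * (r - 0ℤ)
    lem = solve-∀
  finish (inj₂ e) = finish′ (small-solutions f r 0<r (lin₂ 1ℤ 1ℤ A′ hr≡L (lem h r (+ f))))
    where
    hr≡L : h * r ≡ L
    hr≡L = i-j≡0⇒i≡j (h * r) L e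
    0<r : 0ℤ < r
    0<r = pos-factor 0<h (subst (0ℤ <_) (sym hr≡L) (0<odd f))
    lem : ∀ h r f → f * f - (+ 2 * f + 1ℤ - r) ≡ 1ℤ * ((1ℤ + f) * (1ℤ + f) - (h * r + (1ℤ + + 2 * f) - r)) + 1ℤ * (h * r - (1ℤ + + 2 * f))
    lem = solve-∀
    finish′ : f ≡ 0 ⊎ (f ≡ 1 × r ≡ + 2) ⊎ (f ≡ 2 × r ≡ 1ℤ) →
      f ≡ 2 × h ≡ + 5 × (h * L + (- 1ℤ - + f)) + h * ρ₀ ≡ + 42 × μ ≡ + 36
    finish′ (inj₁ f≡0) = contradiction f≡0 f≢0
    finish′ (inj₂ (inj₁ (refl , r≡2))) = contradiction (trans (*-comm (+ 2) h) (trans (cong (h *_) (sym r≡2)) hr≡L)) (2h≢3 h)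
    finish′ (inj₂ (inj₂ (refl , r≡1))) = refl , h≡5 , trans (cong₂ (λ h r → h * + 5 + (- 1ℤ - + 2) + h * r) h≡5 ρ₀≡4) refl ,
        trans μ≡ (cong₂ (λ h r → r * (+ 2 * h - 1ℤ)) h≡5 ρ₀≡4)
      where
      h≡5 : h ≡ + 5
      h≡5 = trans (sym (*-identityʳ h)) (trans (cong (h *_) (sym r≡1)) hr≡L)
      ρ₀≡4 : ρ₀ ≡ + 4
      ρ₀≡4 = lin₁ (- 1ℤ) r≡1 (lem₂ ρ₀)
        where
        lem₂ : ∀ r → r - + 4 ≡ (- 1ℤ) * (+ 5 - r - 1ℤ)
        lem₂ = solve-∀

-- Complementary to `coset-case₀₂`, again through r = L - ρ₀.
coset-case₂₀ : ∀ f {h ρ₀ σ ρ k μ} → f ≢ 0 → ¬ CosetEquations (odd f) h ρ₀ (odd f) (- odd f) σ ρ k μ 0ℤ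
coset-case₂₀ f {h} {ρ₀} {μ = μ} f≢0 record { σ≡ = refl ; ρ≡ = refl ; k≡ = refl ; eqA = A ; eqB = B ; eqC = C ; 0<h = 0<h } =
  finish (i*j≡0⇒i≡0∨j≡0 r rr)
  where
  L r : ℤ
  L = odd f
  r = L - ρ₀
  μ≡ : μ ≡ + 2 * (h - 1ℤ) * ρ₀
  μ≡ = *-cancel (h * L) (λ e → pos⇒≢0 (0<odd f) (*-zero-cancel (pos⇒≢0 0<h) e)) (lin₁ (- 1ℤ) C (lem h ρ₀ μ (+ f)))
    where
    lem : ∀ h r m f → h * (1ℤ + + 2 * f) * m - h * (1ℤ + + 2 * f) * (+ 2 * (h - 1ℤ) * r) ≡
      (- 1ℤ) * (+ 2 * ((h * (1ℤ + + 2 * f) + - (1ℤ + + 2 * f)) * (h * r)) - (0ℤ * (h * r) + m * ((1ℤ + + 2 * f) * h)))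
    lem = solve-∀
  rr : r * (h * r - + 2 * L) ≡ 0ℤ
  rr = lin₂ 1ℤ L B μ≡ (lem h ρ₀ μ (+ f))
    where
    lem : ∀ h r m f → (1ℤ + + 2 * f - r) * (h * (1ℤ + + 2 * f - r) - + 2 * (1ℤ + + 2 * f)) - 0ℤ ≡
      1ℤ * ((h * (1ℤ + + 2 * f) + - (1ℤ + + 2 * f)) * (1ℤ + + 2 * f) + - (1ℤ + + 2 * f) * (1ℤ + + 2 * f) + h * r * r - (0ℤ * (1ℤ + + 2 * f) + m * (1ℤ + + 2 * f)))
      + (1ℤ + + 2 * f) * (m - + 2 * (h - 1ℤ) * r)
    lem = solve-∀
  A′ : L * L ≡ h * r + L - + 2 * r
  A′ = lin₂ 1ℤ (- 1ℤ) A μ≡ (lem h ρ₀ μ (+ f))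
    where
    lem : ∀ h r m f → (1ℤ + + 2 * f) * (1ℤ + + 2 * f) - (h * (1ℤ + + 2 * f - r) + (1ℤ + + 2 * f) - + 2 * (1ℤ + + 2 * f - r)) ≡
      1ℤ * ((- (1ℤ + + 2 * f)) * (- (1ℤ + + 2 * f)) - (0ℤ * (- (1ℤ + + 2 * f)) + ((h * (1ℤ + + 2 * f) + - (1ℤ + + 2 * f)) + h * r - m))) + (- 1ℤ) * (m - + 2 * (h - 1ℤ) * r)
    lem = solve-∀
  finish : r ≡ 0ℤ ⊎ h * r - + 2 * L ≡ 0ℤ → ⊥
  finish (inj₁ r≡0) = f≢0 (+-injective (*-zero-cancel (pos⇒≢0 (0<odd f))
      (*-cancelˡ-≡ (+ 2) (L * + f) 0ℤ (lin₂ 1ℤ (h - + 2) A′ r≡0 (lem h r (+ f))))))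
    where
    lem : ∀ h r f → + 2 * ((1ℤ + + 2 * f) * f) - + 2 * 0ℤ ≡
      1ℤ * ((1ℤ + + 2 * f) * (1ℤ + + 2 * f) - (h * r + (1ℤ + + 2 * f) - + 2 * r)) + (h - + 2) * (r - 0ℤ)
    lem = solve-∀
  finish (inj₂ e) = quadratic-absurd f r f≢0 0<r (*-cancelˡ-≡ (+ 2) _ 0ℤ (lin₂ 1ℤ 1ℤ A′ e (lem h r (+ f))))
    where
    0<r : 0ℤ < r
    0<r = pos-factor 0<h (subst (0ℤ <_) (sym (i-j≡0⇒i≡j (h * r) (+ 2 * L) e))
            (subst (0ℤ <_) (lem₀ L) (+-mono-<-≤ (0<odd f) (<⇒≤ (0<odd f)))))
      where
      lem₀ : ∀ L → L + L ≡ + 2 * L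
      lem₀ = solve-∀
    lem : ∀ h r f → + 2 * (+ 2 * (f * f) - f - 1ℤ + r) - + 2 * 0ℤ ≡
      1ℤ * ((1ℤ + + 2 * f) * (1ℤ + + 2 * f) - (h * r + (1ℤ + + 2 * f) - + 2 * r)) + 1ℤ * (h * r - + 2 * (1ℤ + + 2 * f) - 0ℤ)
    lem = solve-∀

-- The classification of parameters

module _ {n S T R k lam μ} (G : BicirculantSRG n S T R k lam μ) where

  open BicirculantSRG G
  open Classification G
  open Cases G

  -- For l = 1 there may be no bound on `u′`; `trivial-coset` refutes that case directly. In all
  -- others both values are small.
  coset-case : ∀ l h (n≡lh : n ≡ l ℕ.* h) u u′ → h ≢ 1 → u ≢ u′ →
    (∀ x → ¬ + h ∣ x → U x ≡ u) → (∀ x → + h ∣ x → U x ≡ u′) → l ≡ 1 ⊎ Small u × Small u′ → Exceptional n k lam μ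
  coset-case l h n≡lh u u′ h≢1 u≢u′ off on cases with halve l
  ... | f , inj₁ refl = contradiction (ℕ∣.∣-trans (ℕ∣.divides f (trans (cong (f ℕ.+_) (sym (ℕₚ.+-identityʳ f))) (ℕₚ.*-comm 2 f))) (ℕ∣.divides h (trans n≡lh (ℕₚ.*-comm l h)))) 2∤n
  ... | f , inj₂ l≡ = go cases
    where
    open Coset l h n≡lh u u′ h≢1 u≢u′ off on
    L≡ : L ≡ odd f
    L≡ = trans (cong +_ l≡) (cong (λ z → 1ℤ + z) (trans (pos-+ f f) (lem (+ f))))
      where
      lem : ∀ f → f + f ≡ + 2 * f
      lem = solve-∀
    f≢0 : l ≢ 1 → f ≢ 0
    f≢0 l≢1 refl = l≢1 l≡
    equations : ∀ {s e′ b} → s₁ ≡ s → e ≡ e′ → β ≡ b → CosetEquations (odd f) hh ρ₀ s e′ σ ρ k μ b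
    equations refl refl refl = record
      { σ≡ = σ≡ ; ρ≡ = ρ≡ ; k≡ = sym degreeS ; eqA = eqA
      ; eqB = trans eqB (cong (λ z → β * s₁ + μ * z) L≡)
      ; eqC = trans eqC (cong (λ z → β * ρ + μ * (z * hh)) L≡)
      ; 0<h = 0<hh ; 0≤ρ₀ = 0≤ρ₀ ; μ≢0 = μ≢0 }
    half : ∀ {x y} → + 2 * x ≡ + 2 * y → x ≡ y
    half {x} {y} = *-cancelˡ-≡ (+ 2) x y
    β≡ : ∀ {v} → u′ ≡ v → β ≡ - v
    β≡ e = trans (sym (neg-involutive β)) (cong -_ (trans (sym u′≡-β) e))
    s≡ : ∀ {v y} → u ≡ v → v * odd f ≡ + 2 * y → s₁ ≡ y
    s≡ refl e = half (trans 2s₁ (trans (cong (u *_) L≡) e))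
    e≡ : ∀ {v v′ y} → u ≡ v → u′ ≡ v′ → (v′ - v) * odd f + - v′ ≡ + 2 * y → e ≡ y
    e≡ refl refl eq = half (trans 2e (trans (cong₂ (λ a b → w * a + b) L≡ (β≡ refl)) eq))
    n≡25 : f ≡ 2 → hh ≡ + 5 → n ≡ 25
    n≡25 refl hh≡5 = +-injective (trans +n≡ (cong₂ _*_ L≡ hh≡5))
    go : l ≡ 1 ⊎ Small u × Small u′ → Exceptional n k lam μ
    go (inj₁ l≡1) = ⊥-elim (trivial-coset l≡1)
    go (inj₂ (us , us′)) with l ℕₚ.≟ 1
    ... | yes l≡1 = ⊥-elim (trivial-coset l≡1)
    ... | no l≢1 = go′ us us′
      where
      go′ : Small u → Small u′ → Exceptional n k lam μ
      go′ (inj₁ u≡0) (inj₁ u′≡0) = contradiction (trans u≡0 (sym u′≡0)) u≢u′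
      go′ (inj₁ u≡0) (inj₂ (inj₁ u′≡1)) with coset-case₀₁ f (f≢0 l≢1) (equations (s≡ u≡0 refl) (e≡ u≡0 u′≡1 (lem (+ f))) (β≡ u′≡1))
        where
        lem : ∀ f → (1ℤ - 0ℤ) * (1ℤ + + 2 * f) + - 1ℤ ≡ + 2 * f
        lem = solve-∀
      ... | f≡2 , h≡5 , k≡7 , μ≡1 = hoffman-singleton (n≡25 f≡2 h≡5) k≡7 (trans lam≡ (cong₂ _+_ μ≡1 (β≡ u′≡1))) μ≡1
      go′ (inj₁ u≡0) (inj₂ (inj₂ u′≡2)) =
        contradiction (equations (s≡ u≡0 refl) (e≡ u≡0 u′≡2 (lem (+ f))) (β≡ u′≡2)) (coset-case₀₂ f (f≢0 l≢1))
        where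
        lem : ∀ f → (+ 2 - 0ℤ) * (1ℤ + + 2 * f) + - (+ 2) ≡ + 2 * (+ 2 * f)
        lem = solve-∀
      -- u = 1 would give 2 s₁ = l, while `l` divides the odd `n`.
      go′ (inj₂ (inj₁ u≡1)) _ = contradiction (ℕ∣.∣-trans 2∣l (ℕ∣.divides h (trans n≡lh (ℕₚ.*-comm l h)))) 2∤n
        where
        2∣l : 2 ℕ∣.∣ l
        2∣l = ∣⇒∣ᵤ (divides {+ 2} {+ l} s₁ (trans (sym (trans 2s₁ (trans (cong (_* L) u≡1) (*-identityˡ L)))) (*-comm (+ 2) s₁)))
      go′ (inj₂ (inj₂ u≡2)) (inj₁ u′≡0) =
        contradiction (equations (s≡ u≡2 refl) (e≡ u≡2 u′≡0 (lem (+ f))) (β≡ u′≡0)) (coset-case₂₀ f (f≢0 l≢1))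
        where
        lem : ∀ f → (0ℤ - + 2) * (1ℤ + + 2 * f) + - 0ℤ ≡ + 2 * (- (1ℤ + + 2 * f))
        lem = solve-∀
      go′ (inj₂ (inj₂ u≡2)) (inj₂ (inj₁ u′≡1)) with coset-case₂₁ f (f≢0 l≢1) (equations (s≡ u≡2 refl) (e≡ u≡2 u′≡1 (lem (+ f))) (β≡ u′≡1))
        where
        lem : ∀ f → (1ℤ - + 2) * (1ℤ + + 2 * f) + - 1ℤ ≡ + 2 * (- 1ℤ - f)
        lem = solve-∀
      ... | f≡2 , h≡5 , k≡42 , μ≡36 = hoffman-singletonᶜ (n≡25 f≡2 h≡5) k≡42 (trans lam≡ (cong₂ _+_ μ≡36 (β≡ u′≡1))) μ≡36
      go′ (inj₂ (inj₂ u≡2)) (inj₂ (inj₂ u′≡2)) = contradiction (trans u≡2 (sym u′≡2)) u≢u′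

  classification : Exceptional n k lam μ
  classification with two-valuedU
  ... | inj₂ const = go (n ℕₚ.≟ 1) (U 1ℤ ≟ U 0ℤ)
    where
    U₀ : ∀ x → + n ∣ x → U x ≡ U 0ℤ
    U₀ x n∣x = trans (U-zero x n∣x) (sym (U-zero 0ℤ (divides 0ℤ refl)))
    go : Dec (n ≡ 1) → Dec (U 1ℤ ≡ U 0ℤ) → Exceptional n k lam μ
    go (yes refl) _ = constant-case (λ x → U-zero x (divides x (sym (*-identityʳ x))))
    go (no n≢1) (no U₁≢U₀) = coset-case 1 n (sym (ℕₚ.+-identityʳ n)) (U 1ℤ) (U 0ℤ) n≢1 U₁≢U₀ const U₀ (inj₁ refl)
    go (no n≢1) (yes e) = constant-case all
      where
      all : ∀ x → U x ≡ - β
      all x with + n ∣? x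
      ... | yes n∣x = U-zero x n∣x
      ... | no n∤x = trans (const x n∤x) (trans e (U-zero 0ℤ (divides 0ℤ refl)))
  ... | inj₁ ((l , h , n≡lh , u , u′ , off , on) , small) = go (h ℕₚ.≟ 1) (u ≟ u′)
    where
    u′≡-β : u′ ≡ - β
    u′≡-β = trans (sym (on 0ℤ (divides 0ℤ refl))) (U-zero 0ℤ (divides 0ℤ refl))
    go : Dec (h ≡ 1) → Dec (u ≡ u′) → Exceptional n k lam μ
    go (yes refl) _ = constant-case (λ x → trans (on x (divides x (sym (*-identityʳ x)))) u′≡-β)
    go (no h≢1) (no u≢u′) = coset-case l h n≡lh u u′ h≢1 u≢u′ off on (inj₂
      (subst Small (off 1ℤ (λ d → h≢1 (ℕ∣.∣1⇒≡1 (∣⇒∣ᵤ d)))) (small 1ℤ) , subst Small (on 0ℤ (divides 0ℤ refl)) (small 0ℤ)))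
    go (no h≢1) (yes u≡u′) = constant-case all
      where
      all : ∀ x → U x ≡ - β
      all x with + h ∣? x
      ... | yes h∣x = trans (on x h∣x) u′≡-β
      ... | no h∤x = trans (off x h∤x) (trans u≡u′ u′≡-β)

-- A pair x, y with t = [x ~ y] and τ common neighbours: a third vertex z adjacent to both,
-- exactly one or none of x and y has a, b or c neighbours among the common neighbours.
-- The equations count edges from the common neighbours to the neighbours of x, to all vertices,
-- and paths of length two between common neighbours.
record IsoregularCounts (N k lam μ t τ : ℤ) : Set where
  field
    a b c : ℤ
    0≤a : 0ℤ ≤ a
    0≤b : 0ℤ ≤ b
    0≤c : 0ℤ ≤ c
    c≤τ : c ≤ τ
    neighbours : lam * τ ≡ t * τ + a * τ + b * (k - τ - t)
    all-vertices : k * τ ≡ + 2 * τ + a * τ + + 2 * (b * (k - τ - t)) + c * (N - + 2 * k + τ - + 2 + + 2 * t)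
    paths : (k - μ) * τ + (lam - μ) * (a * τ) + μ * (τ * τ) ≡
      + 2 * (τ * τ) + a * a * τ + + 2 * (b * b * (k - τ - t)) + c * c * (N - + 2 * k + τ - + 2 + + 2 * t)

-- Refuting the double counts for each exceptional parameter set

nonneg-factor : ∀ {c x} → 0ℤ < c → 0ℤ ≤ c * x → 0ℤ ≤ x
nonneg-factor {c} {x} 0<c 0≤cx = *-cancelˡ-≤-pos 0ℤ x c {{positive 0<c}} (subst (_≤ c * x) (sym (*-zeroʳ c)) 0≤cx)

nonneg-sub : ∀ {x y} → x ≤ y → 0ℤ ≤ y - x
nonneg-sub {x} {y} x≤y = subst (_≤ y - x) (+-inverseʳ x) (+-monoˡ-≤ (- x) x≤y)

range₁ : ∀ g → 0ℤ < g → 0ℤ < + 2 - g → g ≡ 1ℤ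
range₁ (+ zero)  (+<+ ()) _
range₁ (+ suc zero) _ _ = refl
range₁ (+ suc (suc zero)) _ (+<+ ())
range₁ (+ suc (suc (suc j))) _ ()

range₀₁ : ∀ g → 0ℤ ≤ g → 0ℤ ≤ 1ℤ - g → g ≡ 0ℤ ⊎ g ≡ 1ℤ
range₀₁ (+ zero) _ _ = inj₁ refl
range₀₁ (+ suc zero) _ _ = inj₂ refl
range₀₁ (+ suc (suc j)) _ ()

range₀₁₂ : ∀ g → 0ℤ ≤ g → 0ℤ ≤ + 2 - g → g ≡ 0ℤ ⊎ g ≡ 1ℤ ⊎ g ≡ + 2
range₀₁₂ (+ zero) _ _ = inj₁ refl
range₀₁₂ (+ suc zero) _ _ = inj₂ (inj₁ refl)
range₀₁₂ (+ suc (suc zero)) _ _ = inj₂ (inj₂ refl)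
range₀₁₂ (+ suc (suc (suc j))) _ ()

pos×pos : ∀ {x y} → 0ℤ < x → 0ℤ < y → 0ℤ < x * y
pos×pos {x} {y} 0<x 0<y = nonneg∧≢0⇒pos (*-nonneg (<⇒≤ 0<x) (<⇒≤ 0<y)) (λ e → pos⇒≢0 0<y (*-zero-cancel (pos⇒≢0 0<x) e))

pos⇒0≤-1 : ∀ {x} → 0ℤ < x → 0ℤ ≤ x - 1ℤ
pos⇒0≤-1 {+ zero}  (+<+ ())
pos⇒0≤-1 {+ suc k} _ = 0≤+

-- As λ = 0, the first equation reads 0 = a + 6b, so a = b = 0, and the second becomes 7 = 2 + 35c.
hs-absurd : ¬ IsoregularCounts (+ 50) (+ 7) 0ℤ 1ℤ 0ℤ 1ℤ
hs-absurd record { a = a ; b = b ; c = c ; 0≤a = 0≤a ; 0≤b = 0≤b ; neighbours = E₁ ; all-vertices = E₂ } =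
  from-no (35 ℕ∣.∣? 5) (∣⇒∣ᵤ (divides {+ 35} {+ 5} c (lin₃ 1ℤ (- 1ℤ) (+ 6) E₂ E₁ b≡0 (lem a b c))))
  where
  b≡0 : b ≡ 0ℤ
  b≡0 with b ≟ 0ℤ
  ... | yes e = e
  ... | no b≢0 = contradiction (lin₁ (- 1ℤ) E₁ (lem₀ a b)) (pos+nonneg≢0 (pos×pos {+ 6} 0<+ (nonneg∧≢0⇒pos 0≤b b≢0)) 0≤a)
    where
    lem₀ : ∀ a b → + 6 * b + a - 0ℤ ≡ (- 1ℤ) * (0ℤ * 1ℤ - (0ℤ * 1ℤ + a * 1ℤ + b * (+ 7 - 1ℤ - 0ℤ)))
    lem₀ = solve-∀
  lem : ∀ a b c → + 5 - c * + 35 ≡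
    1ℤ * (+ 7 * 1ℤ - (+ 2 * 1ℤ + a * 1ℤ + + 2 * (b * (+ 7 - 1ℤ - 0ℤ)) + c * (+ 50 - + 2 * + 7 + 1ℤ - + 2 + + 2 * 0ℤ)))
    + (- 1ℤ) * (0ℤ * 1ℤ - (0ℤ * 1ℤ + a * 1ℤ + b * (+ 7 - 1ℤ - 0ℤ))) + + 6 * (b - 0ℤ)
  lem = solve-∀

-- The first two equations give c = 35 (a - 28), and 0 ≤ c ≤ 35 leaves two values: a = 28 violates
-- `paths`, and a = 29 makes 6b = 175.
hsᶜ-absurd : ¬ IsoregularCounts (+ 50) (+ 42) (+ 35) (+ 36) 1ℤ (+ 35)
hsᶜ-absurd record { a = a ; b = b ; c = c ; 0≤c = 0≤c ; c≤τ = c≤τ ; neighbours = E₁ ; all-vertices = E₂ ; paths = E₃ } =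
  go (range₀₁ g (nonneg-factor {+ 35} 0<35 (subst (0ℤ ≤_) c≡ 0≤c))
        (nonneg-factor {+ 35} 0<35 (subst (0ℤ ≤_) (trans (cong (λ c → + 35 - c) c≡) (lem₁ g)) (nonneg-sub c≤τ))))
  where
  0<35 : 0ℤ < + 35
  0<35 = 0<+
  g : ℤ
  g = a - + 28
  lem₀ : ∀ a b c → c - + 35 * (a - + 28) ≡
    (- 1ℤ) * (+ 42 * + 35 - (+ 2 * + 35 + a * + 35 + + 2 * (b * (+ 42 - + 35 - 1ℤ)) + c * (+ 50 - + 2 * + 42 + + 35 - + 2 + + 2 * 1ℤ)))
    + + 2 * (+ 35 * + 35 - (1ℤ * + 35 + a * + 35 + b * (+ 42 - + 35 - 1ℤ)))
  lem₀ = solve-∀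
  c≡ : c ≡ + 35 * g
  c≡ = lin₂ (- 1ℤ) (+ 2) E₂ E₁ (lem₀ a b c)
  lem₁ : ∀ g → + 35 - + 35 * g ≡ + 35 * (1ℤ - g)
  lem₁ = solve-∀
  lem₂ : ∀ a b → + 175 - b * + 6 ≡
    1ℤ * (+ 35 * + 35 - (1ℤ * + 35 + a * + 35 + b * (+ 42 - + 35 - 1ℤ))) + + 35 * (a - + 28 - 1ℤ)
  lem₂ = solve-∀
  lem₃ : ∀ a b → b * + 6 - + 210 ≡
    (- 1ℤ) * (+ 35 * + 35 - (1ℤ * + 35 + a * + 35 + b * (+ 42 - + 35 - 1ℤ))) + (- (+ 35)) * (a - + 28 - 0ℤ)
  lem₃ = solve-∀
  numeric : ∀ {a b c} → a ≡ + 28 → b ≡ + 35 → c ≡ 0ℤ →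
    (+ 42 - + 36) * + 35 + (+ 35 - + 36) * (a * + 35) + + 36 * (+ 35 * + 35) ≢
    + 2 * (+ 35 * + 35) + a * a * + 35 + + 2 * (b * b * (+ 42 - + 35 - 1ℤ)) + c * c * (+ 50 - + 2 * + 42 + + 35 - + 2 + + 2 * 1ℤ)
  numeric refl refl refl ()
  go : g ≡ 0ℤ ⊎ g ≡ 1ℤ → ⊥
  go (inj₁ g≡0) = numeric (i-j≡0⇒i≡j a (+ 28) g≡0)
    (*-cancelʳ-≡ b (+ 35) (+ 6) (lin₂ (- 1ℤ) (- (+ 35)) E₁ g≡0 (lem₃ a b))) (trans c≡ (cong (+ 35 *_) g≡0)) E₃
  go (inj₂ g≡1) = from-no (6 ℕ∣.∣? 175) (∣⇒∣ᵤ (divides {+ 6} {+ 175} b (lin₂ 1ℤ (+ 35) E₁ g≡1 (lem₂ a b))))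

-- Counts⁻ M is Counts⁺ (- M): complementation exchanges m and - m - 1.
Counts⁺ : ℤ → ℤ → ℤ → Set
Counts⁺ m = IsoregularCounts (+ 2 * (+ 2 * (m * m) + + 2 * m + 1ℤ)) (+ 2 * (m * m) + m) (m * m - 1ℤ) (m * m)

Counts⁻ : ℤ → ℤ → ℤ → Set
Counts⁻ M = IsoregularCounts (+ 2 * (+ 2 * (M * M) - + 2 * M + 1ℤ)) (+ 2 * (M * M) - M) (M * M - 1ℤ) (M * M)

module PositiveFamily (m : ℤ) (0<m : 0ℤ < m) where

  m≢0 : m ≢ 0ℤ
  m≢0 = pos⇒≢0 0<m
  0<m+1 : 0ℤ < m + 1ℤ
  0<m+1 = +-mono-< {0ℤ} {m} {0ℤ} {1ℤ} 0<m 0<+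
  0<m+2 : 0ℤ < m + + 2
  0<m+2 = +-mono-< {0ℤ} {m} {0ℤ} {+ 2} 0<m 0<+

  -- Coprimality of m and m + 1 solves the first equation as a = (m + 1) u, b = m (m - 1 - u). The
  -- second becomes 2 (u + 2) = (m + 2) g, and 0 ≤ u ≤ m - 1 leaves only g = 1.
  nonadjacent : Counts⁺ m 0ℤ (m * m) → ∃ λ u → 0ℤ ≤ u × m ≡ + 2 * u + + 2
  nonadjacent record { a = a ; b = b ; c = c ; 0≤a = 0≤a ; 0≤b = 0≤b ; neighbours = E₁ ; all-vertices = E₂ } =
    u , 0≤u , lin₂ (- 1ℤ) (- (m + + 2)) 2u+4 g≡1 (lem₇ m u g)
    where
    u g : ℤ
    -- The quotient of `a` by m + 1, written as a polynomial by means of (m + 1) - m = 1; `g` comes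
    -- from polynomial division by m + 2.
    u = m - m * m + a + b
    g = c - m + + 2 - u * (m - 1ℤ)
    e₁ : m * (m * m - 1ℤ - a) ≡ (m + 1ℤ) * b
    e₁ = *-cancel m m≢0 (lin₁ 1ℤ E₁ (lem m a b))
      where
      lem : ∀ m a b → m * (m * (m * m - 1ℤ - a)) - m * ((m + 1ℤ) * b) ≡
        1ℤ * ((m * m - 1ℤ) * (m * m) - (0ℤ * (m * m) + a * (m * m) + b * (+ 2 * (m * m) + m - m * m - 0ℤ)))
      lem = solve-∀
    a≡ : a ≡ (m + 1ℤ) * u
    a≡ = lin₁ 1ℤ e₁ (lem m a b)
      where
      lem : ∀ m a b → a - (m + 1ℤ) * (m - m * m + a + b) ≡ 1ℤ * (m * (m * m - 1ℤ - a) - (m + 1ℤ) * b)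
      lem = solve-∀
    b≡ : b ≡ m * (m - 1ℤ - u)
    b≡ = *-cancel (m + 1ℤ) (pos⇒≢0 0<m+1) (lin₂ (- 1ℤ) (- m) e₁ a≡ (lem m a b u))
      where
      lem : ∀ m a b u → (m + 1ℤ) * b - (m + 1ℤ) * (m * (m - 1ℤ - u)) ≡
        (- 1ℤ) * (m * (m * m - 1ℤ - a) - (m + 1ℤ) * b) + (- m) * (a - (m + 1ℤ) * u)
      lem = solve-∀
    e₂ : m * (m + a) ≡ (m + + 2) * c
    e₂ = *-cancel m m≢0 (lin₂ 1ℤ (- (+ 2)) E₂ E₁ (lem m a b c))
      where
      lem : ∀ m a b c → m * (m * (m + a)) - m * ((m + + 2) * c) ≡
        1ℤ * ((+ 2 * (m * m) + m) * (m * m) - (+ 2 * (m * m) + a * (m * m) + + 2 * (b * (+ 2 * (m * m) + m - m * m - 0ℤ))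
               + c * (+ 2 * (+ 2 * (m * m) + + 2 * m + 1ℤ) - + 2 * (+ 2 * (m * m) + m) + m * m - + 2 + + 2 * 0ℤ)))
        + (- (+ 2)) * ((m * m - 1ℤ) * (m * m) - (0ℤ * (m * m) + a * (m * m) + b * (+ 2 * (m * m) + m - m * m - 0ℤ)))
      lem = solve-∀
    2u+4 : + 2 * (u + + 2) ≡ (m + + 2) * g
    2u+4 = lin₂ 1ℤ (- m) e₂ a≡ (lem m a u c)
      where
      lem : ∀ m a u c → + 2 * (u + + 2) - (m + + 2) * (c - m + + 2 - u * (m - 1ℤ)) ≡
        1ℤ * (m * (m + a) - (m + + 2) * c) + (- m) * (a - (m + 1ℤ) * u)
      lem = solve-∀
    0≤u : 0ℤ ≤ u
    0≤u = nonneg-factor 0<m+1 (subst (0ℤ ≤_) a≡ 0≤a)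
    0≤m-1-u : 0ℤ ≤ m - 1ℤ - u
    0≤m-1-u = nonneg-factor 0<m (subst (0ℤ ≤_) b≡ 0≤b)
    g≡1 : g ≡ 1ℤ
    g≡1 = range₁ g
      (pos-factor 0<m+2 (subst (0ℤ <_) 2u+4 (pos×pos {+ 2} 0<+ (+-mono-≤-< {0ℤ} {u} {0ℤ} {+ 2} 0≤u 0<+))))
      (pos-factor 0<m+2 (subst (0ℤ <_) (lin₁ (- 1ℤ) 2u+4 (lem m u g))
         (pos×pos {+ 2} 0<+ (+-mono-≤-< {0ℤ} {m - 1ℤ - u} {0ℤ} {1ℤ} 0≤m-1-u 0<+))))
      where
      lem : ∀ m u g → + 2 * (m - 1ℤ - u + 1ℤ) - (m + + 2) * (+ 2 - g) ≡ (- 1ℤ) * (+ 2 * (u + + 2) - (m + + 2) * g)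
      lem = solve-∀
    lem₇ : ∀ m u g → m - (+ 2 * u + + 2) ≡ (- 1ℤ) * (+ 2 * (u + + 2) - (m + + 2) * g) + (- (m + + 2)) * (g - 1ℤ)
    lem₇ = solve-∀

  -- The equations give a + 2 = m v, b = (m - 1)(m - v) and 2 (1 + v) = (m + 1) g. As m is even, m +
  -- 1 divides 1 + v, and 0 < v ≤ m leaves v = m. Then the two sides of `paths` differ by a positive
  -- product.
  adjacent : ∀ u → 0ℤ ≤ u → m ≡ + 2 * u + + 2 → ¬ Counts⁺ m 1ℤ (m * m - 1ℤ)
  adjacent u 0≤u m≡ record { a = a ; b = b ; c = c ; 0≤a = 0≤a ; 0≤b = 0≤b ; neighbours = E₁ ; all-vertices = E₂ ; paths = E₃ } =
    final a≡m²-2 b≡0 c≡ E₃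
    where
    v g g′ : ℤ
    v = m - m * m + + 2 + a + b
    g = c - (m - + 2) * (1ℤ + v)
    -- 1 + v = (m + 1)(1 + v) - m (1 + v), and m = 2 (u + 1) makes the last term (u + 1)(m + 1) g.
    g′ = 1ℤ + v - (u + 1ℤ) * g
    0<m-1 : 0ℤ < m - 1ℤ
    0<m-1 = subst (0ℤ <_) (lin₁ (- 1ℤ) m≡ (lem m u)) (+-mono-≤-< {0ℤ} {+ 2 * u} {0ℤ} {1ℤ} (*-nonneg {+ 2} 0≤+ 0≤u) 0<+)
      where
      lem : ∀ m u → + 2 * u + 1ℤ - (m - 1ℤ) ≡ (- 1ℤ) * (m - (+ 2 * u + + 2))
      lem = solve-∀
    e₁ : (m - 1ℤ) * (m * m - + 2 - a) ≡ m * b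
    e₁ = *-cancel (m + 1ℤ) (pos⇒≢0 0<m+1) (lin₁ 1ℤ E₁ (lem m a b))
      where
      lem : ∀ m a b → (m + 1ℤ) * ((m - 1ℤ) * (m * m - + 2 - a)) - (m + 1ℤ) * (m * b) ≡
        1ℤ * ((m * m - 1ℤ) * (m * m - 1ℤ) - (1ℤ * (m * m - 1ℤ) + a * (m * m - 1ℤ) + b * (+ 2 * (m * m) + m - (m * m - 1ℤ) - 1ℤ)))
      lem = solve-∀
    a≡ : a + + 2 ≡ m * v
    a≡ = lin₁ 1ℤ e₁ (lem m a b)
      where
      lem : ∀ m a b → a + + 2 - m * (m - m * m + + 2 + a + b) ≡ 1ℤ * ((m - 1ℤ) * (m * m - + 2 - a) - m * b)
      lem = solve-∀
    b≡ : b ≡ (m - 1ℤ) * (m - v)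
    b≡ = *-cancel m m≢0 (lin₂ (- 1ℤ) (- (m - 1ℤ)) e₁ a≡ (lem m a b v))
      where
      lem : ∀ m a b v → m * b - m * ((m - 1ℤ) * (m - v)) ≡
        (- 1ℤ) * ((m - 1ℤ) * (m * m - + 2 - a) - m * b) + (- (m - 1ℤ)) * (a + + 2 - m * v)
      lem = solve-∀
    e₂ : (m - 1ℤ) * (m + + 2 + a) ≡ (m + 1ℤ) * c
    e₂ = *-cancel (m + 1ℤ) (pos⇒≢0 0<m+1) (lin₂ 1ℤ (- (+ 2)) E₂ E₁ (lem m a b c))
      where
      lem : ∀ m a b c → (m + 1ℤ) * ((m - 1ℤ) * (m + + 2 + a)) - (m + 1ℤ) * ((m + 1ℤ) * c) ≡
        1ℤ * ((+ 2 * (m * m) + m) * (m * m - 1ℤ) - (+ 2 * (m * m - 1ℤ) + a * (m * m - 1ℤ) + + 2 * (b * (+ 2 * (m * m) + m - (m * m - 1ℤ) - 1ℤ)) + c * (+ 2 * (+ 2 * (m * m) + + 2 * m + 1ℤ) - + 2 * (+ 2 * (m * m) + m) + (m * m - 1ℤ) - + 2 + + 2 * 1ℤ)))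
        + (- (+ 2)) * ((m * m - 1ℤ) * (m * m - 1ℤ) - (1ℤ * (m * m - 1ℤ) + a * (m * m - 1ℤ) + b * (+ 2 * (m * m) + m - (m * m - 1ℤ) - 1ℤ)))
      lem = solve-∀
    2v+2 : + 2 * (1ℤ + v) ≡ (m + 1ℤ) * g
    2v+2 = lin₂ 1ℤ (- (m - 1ℤ)) e₂ a≡ (lem m a c v)
      where
      lem : ∀ m a c v → + 2 * (1ℤ + v) - (m + 1ℤ) * (c - (m - + 2) * (1ℤ + v)) ≡
        1ℤ * ((m - 1ℤ) * (m + + 2 + a) - (m + 1ℤ) * c) + (- (m - 1ℤ)) * (a + + 2 - m * v)
      lem = solve-∀
    v+1 : 1ℤ + v ≡ (m + 1ℤ) * g′
    v+1 = lin₂ (- (1ℤ + v)) (- (u + 1ℤ)) m≡ 2v+2 (lem m u v g)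
      where
      lem : ∀ m u v g → 1ℤ + v - (m + 1ℤ) * (1ℤ + v - (u + 1ℤ) * g) ≡
        (- (1ℤ + v)) * (m - (+ 2 * u + + 2)) + (- (u + 1ℤ)) * (+ 2 * (1ℤ + v) - (m + 1ℤ) * g)
      lem = solve-∀
    0<v : 0ℤ < v
    0<v = pos-factor 0<m (subst (0ℤ <_) a≡ (+-mono-≤-< {0ℤ} {a} {0ℤ} {+ 2} 0≤a 0<+))
    0≤m-v : 0ℤ ≤ m - v
    0≤m-v = nonneg-factor 0<m-1 (subst (0ℤ ≤_) b≡ 0≤b)
    g′≡1 : g′ ≡ 1ℤ
    g′≡1 = range₁ g′ (pos-factor 0<m+1 (subst (0ℤ <_) v+1 (+-mono-< {0ℤ} {1ℤ} {0ℤ} {v} 0<+ 0<v)))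
      (pos-factor 0<m+1 (subst (0ℤ <_) (lin₁ (- 1ℤ) v+1 (lem m v g′)) (+-mono-≤-< {0ℤ} {m - v} {0ℤ} {m + 1ℤ} 0≤m-v 0<m+1)))
      where
      lem : ∀ m v g → m - v + (m + 1ℤ) - (m + 1ℤ) * (+ 2 - g) ≡ (- 1ℤ) * (1ℤ + v - (m + 1ℤ) * g)
      lem = solve-∀
    v≡m : v ≡ m
    v≡m = lin₂ 1ℤ (m + 1ℤ) v+1 g′≡1 (lem m v g′)
      where
      lem : ∀ m v g → v - m ≡ 1ℤ * (1ℤ + v - (m + 1ℤ) * g) + (m + 1ℤ) * (g - 1ℤ)
      lem = solve-∀
    a≡m²-2 : a ≡ m * m - + 2
    a≡m²-2 = lin₂ 1ℤ m a≡ v≡m (lem m a v)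
      where
      lem : ∀ m a v → a - (m * m - + 2) ≡ 1ℤ * (a + + 2 - m * v) + m * (v - m)
      lem = solve-∀
    b≡0 : b ≡ 0ℤ
    b≡0 = lin₂ 1ℤ (- (m - 1ℤ)) b≡ v≡m (lem m b v)
      where
      lem : ∀ m b v → b - 0ℤ ≡ 1ℤ * (b - (m - 1ℤ) * (m - v)) + (- (m - 1ℤ)) * (v - m)
      lem = solve-∀
    c≡ : c ≡ m * (m - 1ℤ)
    c≡ = *-cancel (m + 1ℤ) (pos⇒≢0 0<m+1) (lin₂ (- 1ℤ) (m - 1ℤ) e₂ a≡m²-2 (lem m a c))
      where
      lem : ∀ m a c → (m + 1ℤ) * c - (m + 1ℤ) * (m * (m - 1ℤ)) ≡
        (- 1ℤ) * ((m - 1ℤ) * (m + + 2 + a) - (m + 1ℤ) * c) + (m - 1ℤ) * (a - (m * m - + 2))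
      lem = solve-∀
    0<q : 0ℤ < m * (m - 1ℤ) - 1ℤ
    0<q = subst (λ m → 0ℤ < m * (m - 1ℤ) - 1ℤ) (sym m≡) (subst (0ℤ <_) (lem u)
        (+-mono-≤-< {0ℤ} {+ 4 * (u * u) + + 6 * u} {0ℤ} {1ℤ} (+-mono-≤ (*-nonneg {+ 4} 0≤+ (*-nonneg 0≤u 0≤u)) (*-nonneg {+ 6} 0≤+ 0≤u)) 0<+))
      where
      lem : ∀ u → + 4 * (u * u) + + 6 * u + 1ℤ ≡ (+ 2 * u + + 2) * (+ 2 * u + + 2 - 1ℤ) - 1ℤ
      lem = solve-∀
    final : ∀ {a b c} → a ≡ m * m - + 2 → b ≡ 0ℤ → c ≡ m * (m - 1ℤ) →
      (+ 2 * (m * m) + m - m * m) * (m * m - 1ℤ) + (m * m - 1ℤ - m * m) * (a * (m * m - 1ℤ)) + m * m * ((m * m - 1ℤ) * (m * m - 1ℤ)) ≢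
      + 2 * ((m * m - 1ℤ) * (m * m - 1ℤ)) + a * a * (m * m - 1ℤ) + + 2 * (b * b * (+ 2 * (m * m) + m - (m * m - 1ℤ) - 1ℤ)) + c * c * (+ 2 * (+ 2 * (m * m) + + 2 * m + 1ℤ) - + 2 * (+ 2 * (m * m) + m) + (m * m - 1ℤ) - + 2 + + 2 * 1ℤ)
    final refl refl refl e = pos⇒≢0 (pos×pos (pos×pos (pos×pos 0<m-1 0<m+1) (pos×pos 0<m 0<m+1)) 0<q) (lin₁ (- 1ℤ) e (lem m))
      where
      lem : ∀ m → (m - 1ℤ) * (m + 1ℤ) * (m * (m + 1ℤ)) * (m * (m - 1ℤ) - 1ℤ) - 0ℤ ≡
        (- 1ℤ) * (((+ 2 * (m * m) + m - m * m) * (m * m - 1ℤ) + (m * m - 1ℤ - m * m) * ((m * m - + 2) * (m * m - 1ℤ)) + m * m * ((m * m - 1ℤ) * (m * m - 1ℤ)))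
        - (+ 2 * ((m * m - 1ℤ) * (m * m - 1ℤ)) + (m * m - + 2) * (m * m - + 2) * (m * m - 1ℤ) + + 2 * (0ℤ * 0ℤ * (+ 2 * (m * m) + m - (m * m - 1ℤ) - 1ℤ)) + m * (m - 1ℤ) * (m * (m - 1ℤ)) * (+ 2 * (+ 2 * (m * m) + + 2 * m + 1ℤ) - + 2 * (+ 2 * (m * m) + m) + (m * m - 1ℤ) - + 2 + + 2 * 1ℤ)))
      lem = solve-∀

module NegativeFamily (M : ℤ) (0<M-1 : 0ℤ < M - 1ℤ) where

  private
    lem-M : ∀ M j → M - 1ℤ + j ≡ M + (j - 1ℤ)
    lem-M = solve-∀

  0<M : 0ℤ < M
  0<M = subst (0ℤ <_) (trans (lem-M M 1ℤ) (+-identityʳ M)) (+-mono-< {0ℤ} {M - 1ℤ} {0ℤ} {1ℤ} 0<M-1 0<+)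
  0<M+1 : 0ℤ < M + 1ℤ
  0<M+1 = +-mono-< {0ℤ} {M} {0ℤ} {1ℤ} 0<M 0<+
  M-1≢0 : M - 1ℤ ≢ 0ℤ
  M-1≢0 = pos⇒≢0 0<M-1
  M≢0 : M ≢ 0ℤ
  M≢0 = pos⇒≢0 0<M

  -- Here a + 2 = M v, b = (M + 1)(M - v) and 2 (v - 1) = (M - 1) g, with 0 ≤ g ≤ 2. The value g = 0
  -- violates `paths`, g = 2 makes `c` exceed the number of common neighbours, and g = 1 says that M
  -- is odd.
  adjacent : Counts⁻ M 1ℤ (M * M - 1ℤ) → ∃ λ v → M ≡ + 2 * v - 1ℤ
  adjacent record { a = a ; b = b ; c = c ; 0≤a = 0≤a ; 0≤b = 0≤b ; c≤τ = c≤τ ; neighbours = E₁ ; all-vertices = E₂ ; paths = E₃ } =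
    cases (range₀₁₂ g 0≤g 0≤2-g)
    where
    v g : ℤ
    v = M - b + M * M - + 2 - a
    g = c - (M + + 2) * (v - 1ℤ)
    e₁ : (M + 1ℤ) * (M * M - + 2 - a) ≡ M * b
    e₁ = *-cancel (M - 1ℤ) M-1≢0 (lin₁ 1ℤ E₁ (lem M a b))
      where
      lem : ∀ M a b → (M - 1ℤ) * ((M + 1ℤ) * (M * M - + 2 - a)) - (M - 1ℤ) * (M * b) ≡ 1ℤ * ((M * M - 1ℤ) * (M * M - 1ℤ) - (1ℤ * (M * M - 1ℤ) + a * (M * M - 1ℤ) + b * ((+ 2 * (M * M) - M) - (M * M - 1ℤ) - 1ℤ)))
      lem = solve-∀
    a≡ : a + + 2 ≡ M * v
    a≡ = lin₁ (- 1ℤ) e₁ (lem M a b)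
      where
      lem : ∀ M a b → a + + 2 - M * (M - b + M * M - + 2 - a) ≡ (- 1ℤ) * ((M + 1ℤ) * (M * M - + 2 - a) - M * b)
      lem = solve-∀
    b≡ : b ≡ (M + 1ℤ) * (M - v)
    b≡ = *-cancel M M≢0 (lin₂ (- 1ℤ) (- (M + 1ℤ)) e₁ a≡ (lem M a b v))
      where
      lem : ∀ M a b v → M * b - M * ((M + 1ℤ) * (M - v)) ≡
        (- 1ℤ) * ((M + 1ℤ) * (M * M - + 2 - a) - M * b) + (- (M + 1ℤ)) * (a + + 2 - M * v)
      lem = solve-∀
    e₂ : (M + 1ℤ) * (a + + 2 - M) ≡ (M - 1ℤ) * c
    e₂ = *-cancel (M - 1ℤ) M-1≢0 (lin₂ 1ℤ (- (+ 2)) E₂ E₁ (lem M a b c))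
      where
      lem : ∀ M a b c → (M - 1ℤ) * ((M + 1ℤ) * (a + + 2 - M)) - (M - 1ℤ) * ((M - 1ℤ) * c) ≡
        1ℤ * ((+ 2 * (M * M) - M) * (M * M - 1ℤ) - (+ 2 * (M * M - 1ℤ) + a * (M * M - 1ℤ) + + 2 * (b * ((+ 2 * (M * M) - M) - (M * M - 1ℤ) - 1ℤ)) + c * ((+ 2 * (+ 2 * (M * M) - + 2 * M + 1ℤ)) - + 2 * (+ 2 * (M * M) - M) + (M * M - 1ℤ) - + 2 + + 2 * 1ℤ)))
        + (- (+ 2)) * ((M * M - 1ℤ) * (M * M - 1ℤ) - (1ℤ * (M * M - 1ℤ) + a * (M * M - 1ℤ) + b * ((+ 2 * (M * M) - M) - (M * M - 1ℤ) - 1ℤ)))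
      lem = solve-∀
    2v-2 : + 2 * (v - 1ℤ) ≡ (M - 1ℤ) * g
    2v-2 = lin₂ 1ℤ (- (M + 1ℤ)) e₂ a≡ (lem M a c v)
      where
      lem : ∀ M a c v → + 2 * (v - 1ℤ) - (M - 1ℤ) * (c - (M + + 2) * (v - 1ℤ)) ≡
        1ℤ * ((M + 1ℤ) * (a + + 2 - M) - (M - 1ℤ) * c) + (- (M + 1ℤ)) * (a + + 2 - M * v)
      lem = solve-∀
    0<v : 0ℤ < v
    0<v = pos-factor 0<M (subst (0ℤ <_) a≡ (+-mono-≤-< {0ℤ} {a} {0ℤ} {+ 2} 0≤a 0<+))
    0≤M-v : 0ℤ ≤ M - v
    0≤M-v = nonneg-factor 0<M+1 (subst (0ℤ ≤_) b≡ 0≤b)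
    0≤g : 0ℤ ≤ g
    0≤g = nonneg-factor 0<M-1 (subst (0ℤ ≤_) 2v-2 (*-nonneg {+ 2} 0≤+ (pos⇒0≤-1 0<v)))
    0≤2-g : 0ℤ ≤ + 2 - g
    0≤2-g = nonneg-factor 0<M-1 (subst (0ℤ ≤_) (lin₁ (- 1ℤ) 2v-2 (lem M v g)) (*-nonneg {+ 2} 0≤+ 0≤M-v))
      where
      lem : ∀ M v g → + 2 * (M - v) - (M - 1ℤ) * (+ 2 - g) ≡ (- 1ℤ) * (+ 2 * (v - 1ℤ) - (M - 1ℤ) * g)
      lem = solve-∀
    numeric₀ : ∀ {a b c} → a ≡ M - + 2 → b ≡ (M + 1ℤ) * (M - 1ℤ) → c ≡ 0ℤ →
      ((+ 2 * (M * M) - M) - M * M) * (M * M - 1ℤ) + ((M * M - 1ℤ) - M * M) * (a * (M * M - 1ℤ)) + M * M * ((M * M - 1ℤ) * (M * M - 1ℤ)) ≢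
      + 2 * ((M * M - 1ℤ) * (M * M - 1ℤ)) + a * a * (M * M - 1ℤ) + + 2 * (b * b * ((+ 2 * (M * M) - M) - (M * M - 1ℤ) - 1ℤ)) + c * c * ((+ 2 * (+ 2 * (M * M) - + 2 * M + 1ℤ)) - + 2 * (+ 2 * (M * M) - M) + (M * M - 1ℤ) - + 2 + + 2 * 1ℤ)
    numeric₀ refl refl refl e = pos⇒≢0 (pos×pos (pos×pos 0<M-1 0<M+1) (pos×pos (pos×pos 0<M 0<M) (pos×pos 0<M-1 0<M-1))) (lin₁ (- 1ℤ) e (lem M))
      where
      lem : ∀ M → (M - 1ℤ) * (M + 1ℤ) * (M * M * ((M - 1ℤ) * (M - 1ℤ))) - 0ℤ ≡ (- 1ℤ) *
        ((((+ 2 * (M * M) - M) - M * M) * (M * M - 1ℤ) + ((M * M - 1ℤ) - M * M) * ((M - + 2) * (M * M - 1ℤ)) + M * M * ((M * M - 1ℤ) * (M * M - 1ℤ))) - (+ 2 * ((M * M - 1ℤ) * (M * M - 1ℤ)) + (M - + 2) * (M - + 2) * (M * M - 1ℤ) + + 2 * (((M + 1ℤ) * (M - 1ℤ)) * ((M + 1ℤ) * (M - 1ℤ)) * ((+ 2 * (M * M) - M) - (M * M - 1ℤ) - 1ℤ)) + 0ℤ * 0ℤ * ((+ 2 * (+ 2 * (M * M) - + 2 * M + 1ℤ)) - + 2 * (+ 2 * (M * M) - M) + (M * M - 1ℤ) - + 2 + + 2 * 1ℤ)))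
      lem = solve-∀
    cases : g ≡ 0ℤ ⊎ g ≡ 1ℤ ⊎ g ≡ + 2 → ∃ λ v → M ≡ + 2 * v - 1ℤ
    cases (inj₁ g≡0) = contradiction E₃ (numeric₀ a≡M-2 b≡M²-1 c≡0)
      where
      v≡1 : v ≡ 1ℤ
      v≡1 = *-cancelˡ-≡ (+ 2) v 1ℤ (lin₂ 1ℤ (M - 1ℤ) 2v-2 g≡0 (lem M v g))
        where
        lem : ∀ M v g → + 2 * v - + 2 * 1ℤ ≡ 1ℤ * (+ 2 * (v - 1ℤ) - (M - 1ℤ) * g) + (M - 1ℤ) * (g - 0ℤ)
        lem = solve-∀
      a≡M-2 : a ≡ M - + 2
      a≡M-2 = lin₂ 1ℤ M a≡ v≡1 (lem M a v)
        where
        lem : ∀ M a v → a - (M - + 2) ≡ 1ℤ * (a + + 2 - M * v) + M * (v - 1ℤ)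
        lem = solve-∀
      b≡M²-1 : b ≡ (M + 1ℤ) * (M - 1ℤ)
      b≡M²-1 = trans b≡ (cong (λ v → (M + 1ℤ) * (M - v)) v≡1)
      c≡0 : c ≡ 0ℤ
      c≡0 = lin₂ 1ℤ (M + + 2) g≡0 v≡1 (lem M c v)
        where
        lem : ∀ M c v → c - 0ℤ ≡ 1ℤ * (c - (M + + 2) * (v - 1ℤ) - 0ℤ) + (M + + 2) * (v - 1ℤ)
        lem = solve-∀
    cases (inj₂ (inj₁ g≡1)) = v , lin₂ (- 1ℤ) (- (M - 1ℤ)) 2v-2 g≡1 (lem M v g)
      where
      lem : ∀ M v g → M - (+ 2 * v - 1ℤ) ≡ (- 1ℤ) * (+ 2 * (v - 1ℤ) - (M - 1ℤ) * g) + (- (M - 1ℤ)) * (g - 1ℤ)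
      lem = solve-∀
    -- The trivial equation for `g` is listed so that the certificate can use its definition.
    cases (inj₂ (inj₂ g≡2)) = contradiction (lin₃ (+ 2) (- (M + + 2)) (- (M * M + M)) (refl {x = g}) 2v-2 g≡2 (lem M c v g))
        (pos+nonneg≢0 (pos×pos {+ 2} 0<+ 0<M+1) (*-nonneg {+ 2} 0≤+ (nonneg-sub c≤τ)))
      where
      lem : ∀ M c v g → + 2 * (M + 1ℤ) + + 2 * ((M * M - 1ℤ) - c) - 0ℤ ≡
        + 2 * (g - (c - (M + + 2) * (v - 1ℤ))) + (- (M + + 2)) * (+ 2 * (v - 1ℤ) - (M - 1ℤ) * g) + (- (M * M + M)) * (g - + 2)
      lem = solve-∀

  -- Here a = (M - 1) u and b = M (M + 1 - u). As M is odd, M and M - 2 are coprime, so a - M = (M -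
  -- 2) Q′ and c = M Q′; then Q′ ≡ 1 modulo M - 1 and 0 ≤ Q′ ≤ M leave Q′ = 1 and Q′ = M, and both
  -- violate `paths`.
  nonadjacent : ∀ v → M ≡ + 2 * v - 1ℤ → ¬ Counts⁻ M 0ℤ (M * M)
  nonadjacent v M≡ record { a = a ; b = b ; c = c ; 0≤c = 0≤c ; c≤τ = c≤τ ; neighbours = E₁ ; all-vertices = E₂ ; paths = E₃ } =
    cases (range₀₁ g 0≤g 0≤1-g)
    where
    u Z Q Q′ g : ℤ
    u = M + M * M - a - b
    Z = a - M
    Q = c - Z
    -- `e₂` amounts to 2 Z = (M - 2) Q, and M - 2 = 2 (v - 2) + 1, so this is the quotient of `Z` by
    -- M - 2.
    Q′ = Z - (v - + 2) * Q
    g = 1ℤ + Q′ - u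
    M-2≢0 : M - + 2 ≢ 0ℤ
    M-2≢0 e = 2h≢3 v (lin₂ (- 1ℤ) 1ℤ M≡ e (lem M v))
      where
      lem : ∀ M v → + 2 * v - + 3 ≡ (- 1ℤ) * (M - (+ 2 * v - 1ℤ)) + 1ℤ * (M - + 2 - 0ℤ)
      lem = solve-∀
    0<M-2 : 0ℤ < M - + 2
    0<M-2 = nonneg∧≢0⇒pos (subst (0ℤ ≤_) (lem M) (pos⇒0≤-1 0<M-1)) M-2≢0
      where
      lem : ∀ M → M - 1ℤ - 1ℤ ≡ M - + 2
      lem = solve-∀
    e₁ : M * (M * M - 1ℤ - a) ≡ (M - 1ℤ) * b
    e₁ = *-cancel M M≢0 (lin₁ 1ℤ E₁ (lem M a b))
      where
      lem : ∀ M a b → M * (M * (M * M - 1ℤ - a)) - M * ((M - 1ℤ) * b) ≡ 1ℤ * ((M * M - 1ℤ) * (M * M) - (0ℤ * (M * M) + a * (M * M) + b * ((+ 2 * (M * M) - M) - (M * M) - 0ℤ)))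
      lem = solve-∀
    a≡ : a ≡ (M - 1ℤ) * u
    a≡ = lin₁ (- 1ℤ) e₁ (lem M a b)
      where
      lem : ∀ M a b → a - (M - 1ℤ) * (M + M * M - a - b) ≡ (- 1ℤ) * (M * (M * M - 1ℤ - a) - (M - 1ℤ) * b)
      lem = solve-∀
    b≡ : b ≡ M * (M + 1ℤ - u)
    b≡ = *-cancel (M - 1ℤ) M-1≢0 (lin₂ (- 1ℤ) (- M) e₁ a≡ (lem M a b u))
      where
      lem : ∀ M a b u → (M - 1ℤ) * b - (M - 1ℤ) * (M * (M + 1ℤ - u)) ≡
        (- 1ℤ) * (M * (M * M - 1ℤ - a) - (M - 1ℤ) * b) + (- M) * (a - (M - 1ℤ) * u)
      lem = solve-∀
    e₂ : M * (a - M) ≡ (M - + 2) * c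
    e₂ = *-cancel M M≢0 (lin₂ 1ℤ (- (+ 2)) E₂ E₁ (lem M a b c))
      where
      lem : ∀ M a b c → M * (M * (a - M)) - M * ((M - + 2) * c) ≡
        1ℤ * ((+ 2 * (M * M) - M) * (M * M) - (+ 2 * (M * M) + a * (M * M) + + 2 * (b * ((+ 2 * (M * M) - M) - (M * M) - 0ℤ)) + c * ((+ 2 * (+ 2 * (M * M) - + 2 * M + 1ℤ)) - + 2 * (+ 2 * (M * M) - M) + (M * M) - + 2 + + 2 * 0ℤ)))
        + (- (+ 2)) * ((M * M - 1ℤ) * (M * M) - (0ℤ * (M * M) + a * (M * M) + b * ((+ 2 * (M * M) - M) - (M * M) - 0ℤ)))
      lem = solve-∀
    Z≡ : a - M ≡ (M - + 2) * Q′
    Z≡ = lin₂ (- (a - M)) (- (v - + 2)) M≡ e₂ (lem M a c v)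
      where
      lem : ∀ M a c v → a - M - (M - + 2) * (a - M - (v - + 2) * (c - (a - M))) ≡
        (- (a - M)) * (M - (+ 2 * v - 1ℤ)) + (- (v - + 2)) * (M * (a - M) - (M - + 2) * c)
      lem = solve-∀
    c≡ : c ≡ M * Q′
    c≡ = *-cancel (M - + 2) M-2≢0 (lin₂ (- 1ℤ) M e₂ Z≡ (lem M a c Q′))
      where
      lem : ∀ M a c Q → (M - + 2) * c - (M - + 2) * (M * Q) ≡ (- 1ℤ) * (M * (a - M) - (M - + 2) * c) + M * (a - M - (M - + 2) * Q)
      lem = solve-∀
    0≤Q′ : 0ℤ ≤ Q′
    0≤Q′ = nonneg-factor 0<M (subst (0ℤ ≤_) c≡ 0≤c)
    0≤M-Q′ : 0ℤ ≤ M - Q′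
    0≤M-Q′ = nonneg-factor 0<M (subst (0ℤ ≤_) (trans (cong (λ c → M * M - c) c≡) (lem M Q′)) (nonneg-sub c≤τ))
      where
      lem : ∀ M Q → M * M - M * Q ≡ M * (M - Q)
      lem = solve-∀
    Q′-1 : Q′ - 1ℤ ≡ (M - 1ℤ) * g
    Q′-1 = lin₂ 1ℤ (- 1ℤ) Z≡ a≡ (lem M a Q′ u)
      where
      lem : ∀ M a Q u → Q - 1ℤ - (M - 1ℤ) * (1ℤ + Q - u) ≡ 1ℤ * (a - M - (M - + 2) * Q) + (- 1ℤ) * (a - (M - 1ℤ) * u)
      lem = solve-∀
    0≤g : 0ℤ ≤ g
    0≤g = subst (0ℤ ≤_) (lem₀ g) (pos⇒0≤-1 (pos-factor 0<M-1 (subst (0ℤ <_) (lin₁ 1ℤ Q′-1 (lem M Q′ g))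
            (+-mono-≤-< {0ℤ} {Q′} {0ℤ} {M - + 2} 0≤Q′ 0<M-2))))
      where
      lem₀ : ∀ g → g + 1ℤ - 1ℤ ≡ g
      lem₀ = solve-∀
      lem : ∀ M Q g → Q + (M - + 2) - (M - 1ℤ) * (g + 1ℤ) ≡ 1ℤ * (Q - 1ℤ - (M - 1ℤ) * g)
      lem = solve-∀
    0≤1-g : 0ℤ ≤ 1ℤ - g
    0≤1-g = nonneg-factor 0<M-1 (subst (0ℤ ≤_) (lin₁ (- 1ℤ) Q′-1 (lem M Q′ g)) 0≤M-Q′)
      where
      lem : ∀ M Q g → M - Q - (M - 1ℤ) * (1ℤ - g) ≡ (- 1ℤ) * (Q - 1ℤ - (M - 1ℤ) * g)
      lem = solve-∀
    solution : ∀ u₀ q₀ → u ≡ u₀ → Q′ ≡ q₀ → a ≡ (M - 1ℤ) * u₀ × b ≡ M * (M + 1ℤ - u₀) × c ≡ M * q₀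
    solution u₀ q₀ u≡ q≡ = trans a≡ (cong ((M - 1ℤ) *_) u≡) , trans b≡ (cong (λ u → M * (M + 1ℤ - u)) u≡) , trans c≡ (cong (M *_) q≡)
    numeric₀ : ∀ {a b c} → a ≡ (M - 1ℤ) * + 2 × b ≡ M * (M + 1ℤ - + 2) × c ≡ M * 1ℤ →
      ((+ 2 * (M * M) - M) - M * M) * (M * M) + ((M * M - 1ℤ) - M * M) * (a * (M * M)) + M * M * ((M * M) * (M * M)) ≢
      + 2 * ((M * M) * (M * M)) + a * a * (M * M) + + 2 * (b * b * ((+ 2 * (M * M) - M) - (M * M) - 0ℤ)) + c * c * ((+ 2 * (+ 2 * (M * M) - + 2 * M + 1ℤ)) - + 2 * (+ 2 * (M * M) - M) + (M * M) - + 2 + + 2 * 0ℤ)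
    numeric₀ (refl , refl , refl) e = pos⇒≢0 (pos×pos (pos×pos (pos×pos 0<M 0<M) (pos×pos 0<M-1 0<M-2)) 0<q) (lin₁ (- 1ℤ) e (lem M))
      where
      0<q : 0ℤ < M * (M - + 2 - 1ℤ) + 1ℤ
      0<q = +-mono-≤-< {0ℤ} {M * (M - + 2 - 1ℤ)} {0ℤ} {1ℤ} (*-nonneg (<⇒≤ 0<M) (pos⇒0≤-1 0<M-2)) 0<+
      lem : ∀ M → M * M * ((M - 1ℤ) * (M - + 2)) * (M * (M - + 2 - 1ℤ) + 1ℤ) - 0ℤ ≡ (- 1ℤ) *
        ((((+ 2 * (M * M) - M) - M * M) * (M * M) + ((M * M - 1ℤ) - M * M) * (((M - 1ℤ) * + 2) * (M * M)) + M * M * ((M * M) * (M * M))) - (+ 2 * ((M * M) * (M * M)) + ((M - 1ℤ) * + 2) * ((M - 1ℤ) * + 2) * (M * M) + + 2 * ((M * (M + 1ℤ - + 2)) * (M * (M + 1ℤ - + 2)) * ((+ 2 * (M * M) - M) - (M * M) - 0ℤ)) + (M * 1ℤ) * (M * 1ℤ) * ((+ 2 * (+ 2 * (M * M) - + 2 * M + 1ℤ)) - + 2 * (+ 2 * (M * M) - M) + (M * M) - + 2 + + 2 * 0ℤ)))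
      lem = solve-∀
    numeric₁ : ∀ {a b c} → a ≡ (M - 1ℤ) * M × b ≡ M * (M + 1ℤ - M) × c ≡ M * M →
      ((+ 2 * (M * M) - M) - M * M) * (M * M) + ((M * M - 1ℤ) - M * M) * (a * (M * M)) + M * M * ((M * M) * (M * M)) ≢
      + 2 * ((M * M) * (M * M)) + a * a * (M * M) + + 2 * (b * b * ((+ 2 * (M * M) - M) - (M * M) - 0ℤ)) + c * c * ((+ 2 * (+ 2 * (M * M) - + 2 * M + 1ℤ)) - + 2 * (+ 2 * (M * M) - M) + (M * M) - + 2 + + 2 * 0ℤ)
    numeric₁ (refl , refl , refl) e = pos⇒≢0 (pos×pos (pos×pos (pos×pos 0<M 0<M) (pos×pos 0<M 0<M-2)) (pos×pos 0<M-1 0<M-1)) (lin₁ (- 1ℤ) e (lem M))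
      where
      lem : ∀ M → M * M * (M * (M - + 2)) * ((M - 1ℤ) * (M - 1ℤ)) - 0ℤ ≡ (- 1ℤ) *
        ((((+ 2 * (M * M) - M) - M * M) * (M * M) + ((M * M - 1ℤ) - M * M) * (((M - 1ℤ) * M) * (M * M)) + M * M * ((M * M) * (M * M))) - (+ 2 * ((M * M) * (M * M)) + ((M - 1ℤ) * M) * ((M - 1ℤ) * M) * (M * M) + + 2 * ((M * (M + 1ℤ - M)) * (M * (M + 1ℤ - M)) * ((+ 2 * (M * M) - M) - (M * M) - 0ℤ)) + (M * M) * (M * M) * ((+ 2 * (+ 2 * (M * M) - + 2 * M + 1ℤ)) - + 2 * (+ 2 * (M * M) - M) + (M * M) - + 2 + + 2 * 0ℤ)))
      lem = solve-∀
    cases : g ≡ 0ℤ ⊎ g ≡ 1ℤ → ⊥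
    cases (inj₁ g≡0) = numeric₀ (solution (+ 2) 1ℤ (lin₂ (- 1ℤ) 1ℤ g≡0 Q≡1 (lem u Q′)) Q≡1) E₃
      where
      Q≡1 : Q′ ≡ 1ℤ
      Q≡1 = i-j≡0⇒i≡j Q′ 1ℤ (trans Q′-1 (trans (cong ((M - 1ℤ) *_) g≡0) (*-zeroʳ (M - 1ℤ))))
      lem : ∀ u Q → u - + 2 ≡ (- 1ℤ) * (1ℤ + Q - u - 0ℤ) + 1ℤ * (Q - 1ℤ)
      lem = solve-∀
    cases (inj₂ g≡1) = numeric₁ (solution M M (lin₂ (- 1ℤ) 1ℤ g≡1 Q≡M (lem u Q′ M)) Q≡M) E₃
      where
      Q≡M : Q′ ≡ M
      Q≡M = lin₂ 1ℤ (M - 1ℤ) Q′-1 g≡1 (lem₁ M Q′ g)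
        where
        lem₁ : ∀ M Q g → Q - M ≡ 1ℤ * (Q - 1ℤ - (M - 1ℤ) * g) + (M - 1ℤ) * (g - 1ℤ)
        lem₁ = solve-∀
      lem : ∀ u Q M → u - M ≡ (- 1ℤ) * (1ℤ + Q - u - 1ℤ) + 1ℤ * (Q - M)
      lem = solve-∀

positive-absurd : ∀ m → 0ℤ < m → Counts⁺ m 1ℤ (m * m - 1ℤ) → ¬ Counts⁺ m 0ℤ (m * m)
positive-absurd m 0<m adj non = adjacent (proj₁ r) (proj₁ (proj₂ r)) (proj₂ (proj₂ r)) adj
  where
  open PositiveFamily m 0<m using (nonadjacent; adjacent)
  r = nonadjacent non

negative-absurd : ∀ M → 0ℤ < M - 1ℤ → Counts⁻ M 1ℤ (M * M - 1ℤ) → ¬ Counts⁻ M 0ℤ (M * M)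
negative-absurd M 0<M-1 adj non = nonadjacent (proj₁ r) (proj₂ r) non
  where
  open NegativeFamily M 0<M-1 using (nonadjacent; adjacent)
  r = adjacent adj

counts⁺ : ∀ {n k lam μ t τ m} → + n ≡ + 2 * (m * m) + + 2 * m + 1ℤ → k ≡ + 2 * (m * m) + m → lam ≡ m * m - 1ℤ → μ ≡ m * m →
  IsoregularCounts (+ 2 * + n) k lam μ t τ → Counts⁺ m t τ
counts⁺ {t = t} {τ} {m} n≡ refl refl refl =
  subst (λ N → IsoregularCounts (+ 2 * N) (+ 2 * (m * m) + m) (m * m - 1ℤ) (m * m) t τ) n≡

counts⁻ : ∀ {t τ} m → Counts⁺ (- m) t τ → Counts⁻ m t τ
counts⁻ {t} {τ} m = subst₂ (λ N k → IsoregularCounts (+ 2 * N) k (m * m - 1ℤ) (m * m) t τ) (lem₁ m) (lem₂ m)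
                  ∘ subst (λ s → IsoregularCounts (+ 2 * (+ 2 * s + + 2 * (- m) + 1ℤ)) (+ 2 * s + - m) (s - 1ℤ) s t τ) (lem₀ m)
  where
  lem₀ : ∀ m → (- m) * (- m) ≡ m * m
  lem₀ = solve-∀
  lem₁ : ∀ m → + 2 * (m * m) + + 2 * (- m) + 1ℤ ≡ + 2 * (m * m) - + 2 * m + 1ℤ
  lem₁ = solve-∀
  lem₂ : ∀ m → + 2 * (m * m) + - m ≡ + 2 * (m * m) - m
  lem₂ = solve-∀

-- The two trivial members of the family are m = 0, with μ = 0, and m = -1, with k = μ.
family-absurd : ∀ m → m * m ≢ 0ℤ → + 2 * (m * m) + m ≢ m * m → Counts⁺ m 1ℤ (m * m - 1ℤ) → ¬ Counts⁺ m 0ℤ (m * m)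
family-absurd (+ zero)         m²≢0 _ _ _ = m²≢0 refl
family-absurd m@(+ suc _)      _ _ adj non = positive-absurd m 0<+ adj non
family-absurd -[1+ zero ]      _ k≢μ _ _ = k≢μ refl
family-absurd -[1+ suc j ]     _ _ adj non =
  negative-absurd M 0<+ (counts⁻ M adj) (counts⁻ M non)
  where
  M : ℤ
  M = + suc (suc j)

exceptional-absurd : ∀ {n k lam μ} → Exceptional n k lam μ → μ ≢ 0ℤ → k ≢ μ →
  IsoregularCounts (+ 2 * + n) k lam μ 1ℤ lam → ¬ IsoregularCounts (+ 2 * + n) k lam μ 0ℤ μ
exceptional-absurd (hoffman-singleton refl refl refl refl) _ _ _ non = hs-absurd non
exceptional-absurd (hoffman-singletonᶜ refl refl refl refl) _ _ adj _ = hsᶜ-absurd adj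
exceptional-absurd {n} {k} {lam} {μ} (family m n≡ k≡ lam≡ μ≡) μ≢0 k≢μ adj non = family-absurd m
  (μ≢0 ∘ trans μ≡) (λ e → k≢μ (trans k≡ (trans e (sym μ≡))))
  (subst (Counts⁺ m 1ℤ) lam≡ (counts⁺ {m = m} n≡ k≡ lam≡ μ≡ adj)) (subst (Counts⁺ m 0ℤ) μ≡ (counts⁺ {m = m} n≡ k≡ lam≡ μ≡ non))

open import Defs
open SemiringSum +-*-semiring using (sum; sum-cong-≗; ∑-distrib-+; ∑-comm; *-distribˡ-sum; *-distribʳ-sum)

-- Sums over the vertices

sum-const : ∀ N c → sum {N} (λ _ → c) ≡ + N * c
sum-const zero    c = refl
sum-const (suc N) c = trans (cong (λ z → c + z) (sum-const N c)) (lem (+ N) c)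
  where
  lem : ∀ n c → c + n * c ≡ (1ℤ + n) * c
  lem = solve-∀

sum-+ : ∀ {N} (f g : Fin N → ℤ) → sum (λ v → f v + g v) ≡ sum f + sum g
sum-+ = ∑-distrib-+

sum-≡+ : ∀ {N} (f g : Fin N → ℤ) {p q} → sum f ≡ p → sum g ≡ q → sum (λ v → f v + g v) ≡ p + q
sum-≡+ f g e e′ = trans (sum-+ f g) (cong₂ _+_ e e′)

sum-*ˡ : ∀ {N} c (f : Fin N → ℤ) → sum (λ v → c * f v) ≡ c * sum f
sum-*ˡ c f = sym (*-distribˡ-sum c f)

sum-*ʳ : ∀ {N} c (f : Fin N → ℤ) → sum (λ v → f v * c) ≡ sum f * c
sum-*ʳ c f = sym (*-distribʳ-sum c f)

sum-∑ : ∀ {N} n (f : Fin N → ℤ → ℤ) → sum (λ v → ∑ n (f v)) ≡ ∑ n (λ i → sum (λ v → f v i))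
sum-∑ {N} zero    f = trans (sum-const N 0ℤ) (*-zeroʳ (+ N))
sum-∑ (suc n) f = trans (sum-+ (λ v → ∑ n (f v)) (λ v → f v (+ n))) (cong (_+ sum (λ v → f v (+ n))) (sum-∑ n f))

sum-nonneg : ∀ {N} {f : Fin N → ℤ} → (∀ v → 0ℤ ≤ f v) → 0ℤ ≤ sum f
sum-nonneg {zero}  h = ≤-refl
sum-nonneg {suc N} h = +-mono-≤ (h zero) (sum-nonneg (h ∘ suc))

sum-mono : ∀ {N} {f g : Fin N → ℤ} → (∀ v → f v ≤ g v) → sum f ≤ sum g
sum-mono {zero}  h = ≤-refl
sum-mono {suc N} h = +-mono-≤ (h zero) (sum-mono (h ∘ suc))

sum≡0⇒0 : ∀ {N} {f : Fin N → ℤ} → (∀ v → 0ℤ ≤ f v) → sum f ≡ 0ℤ → ∀ v → f v ≡ 0ℤ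
sum≡0⇒0 {suc N} {f} h e zero with f zero ≟ 0ℤ
... | yes f0≡0 = f0≡0
... | no f0≢0 = contradiction e (pos+nonneg≢0 (nonneg∧≢0⇒pos (h zero) f0≢0) (sum-nonneg (h ∘ suc)))
sum≡0⇒0 {suc N} {f} h e (suc v) = sum≡0⇒0 (h ∘ suc)
  (trans (sym (+-identityˡ _)) (trans (cong (_+ sum (f ∘ suc)) (sym (sum≡0⇒0 h e zero))) e)) v

bit : Bool → ℤ
bit p = if p then 1ℤ else 0ℤ

bit-Bit : ∀ p → Bit (bit p)
bit-Bit false = inj₁ refl
bit-Bit true  = inj₂ refl

bit-∧ : ∀ p q → bit (p ∧ q) ≡ bit p * bit q
bit-∧ false q = refl
bit-∧ true  q = sym (*-identityˡ (bit q))

eq : ∀ {N} → Fin N → Fin N → ℤ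
eq u v = bit (does (u Finₚ.≟ v))

eq-refl : ∀ {N} {u v : Fin N} → u ≡ v → eq u v ≡ 1ℤ
eq-refl {u = u} {v} e = cong bit (dec-true (u Finₚ.≟ v) e)

eq-≢ : ∀ {N} {u v : Fin N} → u ≢ v → eq u v ≡ 0ℤ
eq-≢ {u = u} {v} e = cong bit (dec-false (u Finₚ.≟ v) e)

eq-sym : ∀ {N} (u v : Fin N) → eq u v ≡ eq v u
eq-sym u v with u Finₚ.≟ v
... | yes e = sym (eq-refl (sym e))
... | no ¬e = sym (eq-≢ (¬e ∘ sym))

sum-eq : ∀ {N} (u : Fin N) (f : Fin N → ℤ) → sum (λ v → eq u v * f v) ≡ f u
sum-eq {suc N} zero f = trans (cong₂ _+_ (*-identityˡ (f zero)) (trans (sum-cong-≗ (λ v → *-zeroˡ (f (suc v))))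
    (trans (sum-const N 0ℤ) (*-zeroʳ (+ N))))) (+-identityʳ (f zero))
sum-eq {suc N} (suc u) f = trans (cong₂ _+_ (*-zeroˡ (f zero)) (sum-eq u (f ∘ suc))) (+-identityˡ (f (suc u)))

length-filter : ∀ N {V : Set} (p : V → Bool) (f : Fin N → V) → + length (filterᵇ p (tabulate f)) ≡ sum (λ v → bit (p (f v)))
length-filter zero    p f = refl
length-filter (suc N) p f with p (f zero)
... | true  = cong (λ z → 1ℤ + z) (length-filter N p (f ∘ suc))
... | false = trans (length-filter N p (f ∘ suc)) (sym (+-identityˡ _))

-- The adjacency matrix of a non-trivial strongly regular graph

module Matrix {N : ℕ} (G : Graph N) where

  A : Fin N → Fin N → ℤ
  A u v = bit (adj G u v)

  A-bit : ∀ u v → Bit (A u v)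
  A-bit u v = bit-Bit (adj G u v)

  A-sym : ∀ u v → A u v ≡ A v u
  A-sym u v = cong bit (adj-sym G u v)

  A-irrefl : ∀ u → A u u ≡ 0ℤ
  A-irrefl u = cong bit (adj-irrefl G u)

  A-adj : ∀ {u v} → Adj G u v → A u v ≡ 1ℤ
  A-adj = cong bit

  A-nonadj : ∀ {u v} → ¬ Adj G u v → A u v ≡ 0ℤ
  A-nonadj e = cong bit (Boolₚ.¬-not e)

  adj-A : ∀ {u v} → A u v ≡ 1ℤ → Adj G u v
  adj-A {u} {v} e with adj G u v
  ... | true = refl

  adj-≢ : ∀ {u v} → Adj G u v → u ≢ v
  adj-≢ {u} a refl = contradiction (trans (sym a) (adj-irrefl G u)) λ ()

  degree-sum : ∀ u → + degree G u ≡ sum (A u)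
  degree-sum u = trans (length-filter N _ id) (sum-cong-≗ (λ w → cong bit (Boolₚ.∧-identityʳ (adj G u w))))

  valency₂-sum : ∀ u v → + valency G (u ∷ v ∷ []) ≡ sum (λ w → A u w * A v w)
  valency₂-sum u v = trans (length-filter N _ id) (sum-cong-≗ (λ w → trans (cong (λ z → bit (adj G u w ∧ z)) (Boolₚ.∧-identityʳ (adj G v w)))
    (bit-∧ (adj G u w) (adj G v w))))

  valency₃-sum : ∀ u v x → + valency G (u ∷ v ∷ x ∷ []) ≡ sum (λ w → A u w * A v w * A x w)
  valency₃-sum u v x = trans (length-filter N _ id) (sum-cong-≗ (λ w → trans (bit-∧ (adj G u w) (adj G v w ∧ (adj G x w ∧ true)))
    (trans (cong (A u w *_) (trans (cong (λ z → bit (adj G v w ∧ z)) (Boolₚ.∧-identityʳ (adj G x w))) (bit-∧ (adj G v w) (adj G x w))))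
           (sym (*-assoc (A u w) (A v w) (A x w))))))

module StronglyRegularMatrix {N : ℕ} (G : Graph N) {k′ λ′ μ′ : ℕ} (srg : IsSRG G k′ λ′ μ′) where

  open Matrix G

  k lam μ β : ℤ
  k = + k′
  lam = + λ′
  μ = + μ′
  β = lam - μ

  row-sum : ∀ u → sum (A u) ≡ k
  row-sum u = trans (sym (degree-sum u)) (cong +_ (proj₁ srg u))

  adjacent-product : ∀ {u v} → Adj G u v → sum (λ w → A u w * A v w) ≡ lam
  adjacent-product {u} {v} a = trans (sym (valency₂-sum u v)) (cong +_ (proj₁ (proj₂ srg) u v (adj-≢ a) a))

  nonadjacent-product : ∀ {u v} → u ≢ v → ¬ Adj G u v → sum (λ w → A u w * A v w) ≡ μ
  nonadjacent-product {u} {v} u≢v a = trans (sym (valency₂-sum u v)) (cong +_ (proj₂ (proj₂ srg) u v u≢v a))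

  -- Entrywise form of A² = β A + (k - μ) I + μ J.
  row-product : ∀ u v → sum (λ w → A u w * A v w) ≡ β * A u v + (k - μ) * eq u v + μ
  row-product u v with u Finₚ.≟ v
  ... | yes refl = trans (trans (sum-cong-≗ (λ w → bit-square (A-bit u w))) (row-sum u))
        (trans (lem β k μ) (cong (λ a → β * a + (k - μ) * 1ℤ + μ) (sym (A-irrefl u))))
    where
    lem : ∀ b k m → k ≡ b * 0ℤ + (k - m) * 1ℤ + m
    lem = solve-∀
  ... | no u≢v with adj G u v Boolₚ.≟ true
  ...   | yes a = trans (adjacent-product a) (trans (lem lam k μ) (cong (λ a → β * a + (k - μ) * 0ℤ + μ) (sym (A-adj a))))
    where
    lem : ∀ l k m → l ≡ (l - m) * 1ℤ + (k - m) * 0ℤ + m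
    lem = solve-∀
  ...   | no ¬a = trans (nonadjacent-product u≢v ¬a) (trans (lem β k μ) (cong (λ a → β * a + (k - μ) * 0ℤ + μ) (sym (A-nonadj ¬a))))
    where
    lem : ∀ b k m → m ≡ b * 0ℤ + (k - m) * 0ℤ + m
    lem = solve-∀

  column-product : ∀ u v → sum (λ w → A w u * A w v) ≡ β * A u v + (k - μ) * eq u v + μ
  column-product u v = trans (sum-cong-≗ (λ w → cong₂ _*_ (A-sym w u) (A-sym w v))) (row-product u v)

  module Nontrivial (nt : NonTrivial G) {a b : Fin N} (a≢b : a ≢ b) where

    complete-absurd : (∀ u v → u ≡ v ⊎ Adj G u v) → ⊥
    complete-absurd h = go (proj₂ nt a b)
      where
      go : Reach (compAdj G) a b → ⊥
      go here = a≢b refl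
      go (step {y = y} e _) with h a y
      ... | inj₁ refl = contradiction (trans (sym e) (cong (λ d → not d ∧ not (adj G a a)) (dec-true (a Finₚ.≟ a) refl))) λ ()
      ... | inj₂ ay = contradiction (trans (sym e) (trans (cong (λ d → not (does (a Finₚ.≟ y)) ∧ not d) ay) (Boolₚ.∧-zeroʳ _))) λ ()

    compAdj⇒ : ∀ {u v} → compAdj G u v ≡ true → u ≢ v × ¬ Adj G u v
    compAdj⇒ {u} {v} e with u Finₚ.≟ v | adj G u v
    ... | no u≢v | false = u≢v , λ ()

    A-nonneg : ∀ u v → 0ℤ ≤ A u v
    A-nonneg u v = bit-nonneg (A-bit u v)

    -- With μ = 0 the end points of a path of length two are equal or adjacent, so a connected graph
    -- would be complete.
    μ≢0 : μ ≢ 0ℤ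
    μ≢0 μ≡0 = complete-absurd (λ u v → go (proj₁ nt u v))
      where
      go : ∀ {u v} → Reach (adj G) u v → u ≡ v ⊎ Adj G u v
      go here = inj₁ refl
      go {u} {v} (step {y = y} uy r) with go r
      ... | inj₁ refl = inj₂ uy
      ... | inj₂ yv with u Finₚ.≟ v | adj G u v Boolₚ.≟ true
      ...   | yes u≡v | _ = inj₁ u≡v
      ...   | no _ | yes uv = inj₂ uv
      ...   | no u≢v | no ¬uv = contradiction
              (trans (sym (cong₂ _*_ (A-adj uy) (trans (A-sym v y) (A-adj yv))))
                (sum≡0⇒0 {f = λ w → A u w * A v w} (λ w → *-nonneg (A-nonneg u w) (A-nonneg v w)) (trans (nonadjacent-product u≢v ¬uv) μ≡0) y)) λ ()

    -- With k = μ non-adjacent vertices have equal rows, so following a walk in the complement shows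
    -- every entry to be 0, and no edge remains.
    k≢μ : k ≢ μ
    k≢μ k≡μ = absurd (proj₁ nt a b)
      where
      same : ∀ {u v} → u ≢ v → ¬ Adj G u v → ∀ w → A u w ≡ A v w
      same {u} {v} u≢v ¬uv w = trans (lem (A u w) (A v w)) (trans (cong (λ z → z + A u w * A v w) (zeroes u v u≢v ¬uv w))
          (trans (+-identityˡ _) (trans (*-comm (A u w) (A v w)) (sym (trans (lem (A v w) (A u w))
            (trans (cong (λ z → z + A v w * A u w) (zeroes v u (u≢v ∘ sym) (¬uv ∘ trans (adj-sym G u v)) w)) (+-identityˡ _)))))))
        where
        lem : ∀ a b → a ≡ (a + (- 1ℤ) * (a * b)) + a * b
        lem = solve-∀
        zeroes : ∀ u v → u ≢ v → ¬ Adj G u v → ∀ w → A u w + (- 1ℤ) * (A u w * A v w) ≡ 0ℤ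
        zeroes u v u≢v ¬uv = sum≡0⇒0 (λ w → nn (A-bit u w) (A-bit v w))
          (trans (sum-+ (A u) _) (trans (cong₂ _+_ (row-sum u) (trans (sum-*ˡ (- 1ℤ) (λ w → A u w * A v w)) (cong ((- 1ℤ) *_) (nonadjacent-product u≢v ¬uv))))
            (lin₁ 1ℤ k≡μ (lem₁ k μ))))
          where
          lem₁ : ∀ k m → k + (- 1ℤ) * m - 0ℤ ≡ 1ℤ * (k - m)
          lem₁ = solve-∀
          nn : ∀ {p q} → Bit p → Bit q → 0ℤ ≤ p + (- 1ℤ) * (p * q)
          nn (inj₁ refl) (inj₁ refl) = ≤-refl
          nn (inj₁ refl) (inj₂ refl) = ≤-refl
          nn (inj₂ refl) (inj₁ refl) = 0≤+
          nn (inj₂ refl) (inj₂ refl) = ≤-refl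
      go : ∀ {u v} → Reach (compAdj G) u v → A u v ≡ 0ℤ
      go {u} here = A-irrefl u
      go {u} {v} (step {y = y} e r) = trans (same (proj₁ (compAdj⇒ e)) (proj₂ (compAdj⇒ e)) v) (go r)
      absurd : Reach (adj G) a b → ⊥
      absurd here = a≢b refl
      absurd (step {y = y} e _) = contradiction (trans (sym (A-adj e)) (go (proj₂ nt a y))) λ ()

    -- With λ = k - 1 the end points of an edge share all their other neighbours, so a connected
    -- graph would again be complete.
    lam≢k-1 : lam ≢ k - 1ℤ
    lam≢k-1 lam≡ = complete-absurd (λ u v → go (proj₁ nt u v))
      where
      zeroes : ∀ {u v} → Adj G u v → ∀ w → (A u w + (- 1ℤ) * (A u w * A v w)) + (- 1ℤ) * (eq v w * 1ℤ) ≡ 0ℤ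
      zeroes {u} {v} uv = sum≡0⇒0 nn
          (trans (sum-+ (λ w → A u w + (- 1ℤ) * (A u w * A v w)) (λ w → (- 1ℤ) * (eq v w * 1ℤ)))
          (trans (cong₂ _+_ (trans (sum-+ (A u) _) (cong₂ _+_ (row-sum u) (trans (sum-*ˡ (- 1ℤ) (λ w → A u w * A v w)) (cong ((- 1ℤ) *_) (adjacent-product uv)))))
                            (trans (sum-*ˡ (- 1ℤ) (λ w → eq v w * 1ℤ)) (cong ((- 1ℤ) *_) (sum-eq v (λ _ → 1ℤ)))))
            (lin₁ (- 1ℤ) lam≡ (lem₁ k lam))))
        where
        lem₁ : ∀ k l → (k + (- 1ℤ) * l) + (- 1ℤ) * 1ℤ - 0ℤ ≡ (- 1ℤ) * (l - (k - 1ℤ))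
        lem₁ = solve-∀
        bits : ∀ {p q} → Bit p → Bit q → 0ℤ ≤ (p + (- 1ℤ) * (p * q)) + (- 1ℤ) * (0ℤ * 1ℤ)
        bits (inj₁ refl) (inj₁ refl) = ≤-refl
        bits (inj₁ refl) (inj₂ refl) = ≤-refl
        bits (inj₂ refl) (inj₁ refl) = 0≤+
        bits (inj₂ refl) (inj₂ refl) = ≤-refl
        nn : ∀ w → 0ℤ ≤ (A u w + (- 1ℤ) * (A u w * A v w)) + (- 1ℤ) * (eq v w * 1ℤ)
        nn w with v Finₚ.≟ w
        ... | yes refl = ≤-reflexive (sym (cong₂ (λ p q → (p + (- 1ℤ) * (p * q)) + (- 1ℤ) * (1ℤ * 1ℤ)) (A-adj uv) (A-irrefl v)))
        ... | no _ = bits (A-bit u w) (A-bit v w)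
      transfer : ∀ {u v w} → Adj G u v → v ≢ w → Adj G u w → Adj G v w
      transfer {u} {v} {w} uv v≢w uw = adj-A (lin₂ (- 1ℤ) (1ℤ - A v w)
          (trans (cong (λ e → (A u w + (- 1ℤ) * (A u w * A v w)) + (- 1ℤ) * (e * 1ℤ)) (sym (eq-≢ v≢w))) (zeroes uv w)) (A-adj uw)
          (lem (A u w) (A v w)))
        where
        lem : ∀ p q → q - 1ℤ ≡ (- 1ℤ) * ((p + (- 1ℤ) * (p * q)) + (- 1ℤ) * (0ℤ * 1ℤ) - 0ℤ) + (1ℤ - q) * (p - 1ℤ)
        lem = solve-∀
      go : ∀ {u v} → Reach (adj G) u v → u ≡ v ⊎ Adj G u v
      go here = inj₁ refl
      go {u} {v} (step {y = y} uy r) with go r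
      ... | inj₁ refl = inj₂ uy
      ... | inj₂ yv with u Finₚ.≟ v
      ...   | yes u≡v = inj₁ u≡v
      ...   | no u≢v = inj₂ (transfer (trans (adj-sym G y u) uy) u≢v yv)

-- Double counts around a 3-isoregular pair

bit-pairs : ∀ p q p′ q′ → bit p + bit q ≡ bit p′ + bit q′ → (p ≡ p′ × q ≡ q′) ⊎ (p ≡ q′ × q ≡ p′)
bit-pairs false false false false _ = inj₁ (refl , refl)
bit-pairs false false false true  ()
bit-pairs false false true  true  ()
bit-pairs true  true  false false ()
bit-pairs true  true  true  false ()
bit-pairs false true  false true  _ = inj₁ (refl , refl)
bit-pairs false true  true  false _ = inj₂ (refl , refl)
bit-pairs true  false false true  _ = inj₂ (refl , refl)
bit-pairs true  false true  false _ = inj₁ (refl , refl)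
bit-pairs true  true  true  true  _ = inj₁ (refl , refl)

module IsoregularPair {N : ℕ} (G : Graph N) {k′ λ′ μ′ : ℕ} (srg : IsSRG G k′ λ′ μ′)
  {x y : Fin N} (iso : ThreeIsoregular G x y) where

  open Matrix G
  open StronglyRegularMatrix G srg

  x≢y : x ≢ y
  x≢y = proj₁ iso

  ω val : Fin N → ℤ
  ω w = A x w * A y w
  val z = sum (λ w → ω w * A z w)

  t τ : ℤ
  t = A x y
  τ = sum ω

  ω-bit : ∀ w → Bit (ω w)
  ω-bit w = product-bit (A-bit x w) (A-bit y w)
    where
    product-bit : ∀ {p q} → Bit p → Bit q → Bit (p * q)
    product-bit (inj₁ refl) _ = inj₁ refl
    product-bit (inj₂ refl) (inj₁ refl) = inj₁ refl
    product-bit (inj₂ refl) (inj₂ refl) = inj₂ refl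

  0≤val : ∀ z → 0ℤ ≤ val z
  0≤val z = sum-nonneg (λ w → *-nonneg (bit-nonneg (ω-bit w)) (bit-nonneg (A-bit z w)))

  0≤τ : 0ℤ ≤ τ
  0≤τ = sum-nonneg (λ w → bit-nonneg (ω-bit w))

  val≤τ : ∀ z → val z ≤ τ
  val≤τ z = sum-mono (λ w → le (ω-bit w) (A-bit z w))
    where
    le : ∀ {p q} → Bit p → Bit q → p * q ≤ p
    le (inj₁ refl) (inj₁ refl) = ≤-refl
    le (inj₁ refl) (inj₂ refl) = ≤-refl
    le (inj₂ refl) (inj₁ refl) = 0≤+
    le (inj₂ refl) (inj₂ refl) = ≤-refl

  -- For a fixed pair, the number of its members adjacent to the third vertex determines the induced
  -- subgraph; if the two bits come in the other order, the isomorphism exchanges `x` and `y`.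
  induced-iso : ∀ z z′ → A x z + A y z ≡ A x z′ + A y z′ → InducedIso G (triple G x y z) (triple G x y z′)
  induced-iso z z′ e with bit-pairs (adj G x z) (adj G y z) (adj G x z′) (adj G y z′) e
  ... | inj₁ (p , q) = idₚ , λ
        { zero zero → refl ; zero (suc zero) → refl ; zero (suc (suc zero)) → p
        ; (suc zero) zero → refl ; (suc zero) (suc zero) → refl ; (suc zero) (suc (suc zero)) → q
        ; (suc (suc zero)) zero → trans (adj-sym G z x) (trans p (adj-sym G x z′))
        ; (suc (suc zero)) (suc zero) → trans (adj-sym G z y) (trans q (adj-sym G y z′))
        ; (suc (suc zero)) (suc (suc zero)) → trans (adj-irrefl G z) (sym (adj-irrefl G z′)) }
  ... | inj₂ (p , q) = transpose zero (suc zero) , λ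
        { zero zero → trans (adj-irrefl G x) (sym (adj-irrefl G y)) ; zero (suc zero) → adj-sym G x y ; zero (suc (suc zero)) → p
        ; (suc zero) zero → adj-sym G y x ; (suc zero) (suc zero) → trans (adj-irrefl G y) (sym (adj-irrefl G x)) ; (suc zero) (suc (suc zero)) → q
        ; (suc (suc zero)) zero → trans (adj-sym G z x) (trans p (adj-sym G y z′))
        ; (suc (suc zero)) (suc zero) → trans (adj-sym G z y) (trans q (adj-sym G x z′))
        ; (suc (suc zero)) (suc (suc zero)) → trans (adj-irrefl G z) (sym (adj-irrefl G z′)) }

  InClass : ℤ → Fin N → Set
  InClass s z = z ≢ x × z ≢ y × A x z + A y z ≡ s

  inClass? : ∀ s z → Dec (InClass s z)
  inClass? s z = ¬? (z Finₚ.≟ x) ×-dec ¬? (z Finₚ.≟ y) ×-dec (A x z + A y z) ≟ s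

  val-of : ∀ s → Dec (∃ (InClass s)) → ℤ
  val-of s (yes (z , _)) = val z
  -- Default for an empty class, which contributes nothing to the sums; 0 respects the bounds 0 and
  -- `τ`.
  val-of s (no _)        = 0ℤ

  class-val : ℤ → ℤ
  class-val s = val-of s (Finₚ.any? (inClass? s))

  val≡class-val : ∀ s z → InClass s z → val z ≡ class-val s
  val≡class-val s z c@(z≢x , z≢y , s≡) = go (Finₚ.any? (inClass? s))
    where
    go : ∀ d → val z ≡ val-of s d
    go (no ∄) = contradiction (z , c) ∄
    go (yes (z′ , z′≢x , z′≢y , s′≡)) = trans (sym (valency₃-sum′ z)) (trans
        (cong +_ (proj₂ iso z z′ z≢x z≢y z′≢x z′≢y (induced-iso z z′ (trans s≡ (sym s′≡))))) (valency₃-sum′ z′))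
      where
      valency₃-sum′ : ∀ z → + valency G (x ∷ y ∷ z ∷ []) ≡ val z
      valency₃-sum′ z = valency₃-sum x y z

  0≤class-val : ∀ s → 0ℤ ≤ class-val s
  0≤class-val s = go (Finₚ.any? (inClass? s))
    where
    go : ∀ d → 0ℤ ≤ val-of s d
    go (yes (z , _)) = 0≤val z
    go (no _)        = ≤-refl

  class-val≤τ : ∀ s → class-val s ≤ τ
  class-val≤τ s = go (Finₚ.any? (inClass? s))
    where
    go : ∀ d → val-of s d ≤ τ
    go (yes (z , _)) = val≤τ z
    go (no _)        = 0≤τ

  val-x : val x ≡ τ
  val-x = sum-cong-≗ (λ w → lem (A-bit x w) (A-bit y w))
    where
    lem : ∀ {p q} → Bit p → Bit q → p * q * p ≡ p * q
    lem (inj₁ refl) _ = refl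
    lem (inj₂ refl) (inj₁ refl) = refl
    lem (inj₂ refl) (inj₂ refl) = refl

  val-y : val y ≡ τ
  val-y = sum-cong-≗ (λ w → lem (A-bit x w) (A-bit y w))
    where
    lem : ∀ {p q} → Bit p → Bit q → p * q * q ≡ p * q
    lem (inj₁ refl) _ = refl
    lem (inj₂ refl) (inj₁ refl) = refl
    lem (inj₂ refl) (inj₂ refl) = refl

  a b c : ℤ
  a = class-val (+ 2)
  b = class-val 1ℤ
  c = class-val 0ℤ

  byClass : (P : ℤ → ℤ → ℤ → Set) → ∀ z → z ≢ x → z ≢ y →
    P 1ℤ 1ℤ a → P 1ℤ 0ℤ b → P 0ℤ 1ℤ b → P 0ℤ 0ℤ c → P (A x z) (A y z) (val z)
  byClass P z z≢x z≢y p₁₁ p₁₀ p₀₁ p₀₀ with A x z in e | A y z in e′ | A-bit x z | A-bit y z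
  ... | _ | _ | inj₂ refl | inj₂ refl = subst (P 1ℤ 1ℤ) (sym (val≡class-val (+ 2) z (z≢x , z≢y , cong₂ _+_ e e′))) p₁₁
  ... | _ | _ | inj₂ refl | inj₁ refl = subst (P 1ℤ 0ℤ) (sym (val≡class-val 1ℤ z (z≢x , z≢y , cong₂ _+_ e e′))) p₁₀
  ... | _ | _ | inj₁ refl | inj₂ refl = subst (P 0ℤ 1ℤ) (sym (val≡class-val 1ℤ z (z≢x , z≢y , cong₂ _+_ e e′))) p₀₁
  ... | _ | _ | inj₁ refl | inj₁ refl = subst (P 0ℤ 0ℤ) (sym (val≡class-val 0ℤ z (z≢x , z≢y , cong₂ _+_ e e′))) p₀₀

  module Total (φ : ℤ → ℤ) where

    private
      α a′ b′ c′ : ℤ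
      α = φ τ
      a′ = φ a
      b′ = φ b
      c′ = φ c

    -- Interpolates φ(val z) from the bits `p` = A x z and `q` = A y z. At `x` and `y` themselves
    -- the value is φ(τ), where interpolation alone would give b′ t + c′ (1 - t); the two indicator
    -- terms correct this.
    expression : ℤ → ℤ → ℤ → ℤ → ℤ
    expression ex ey p q = ((α - b′ * t - c′ * (1ℤ - t)) * (ex * 1ℤ) + (α - b′ * t - c′ * (1ℤ - t)) * (ey * 1ℤ))
      + ((a′ - + 2 * b′ + c′) * (p * q) + ((b′ - c′) * p + ((b′ - c′) * q + c′)))

    expression-cong : ∀ {ex ex′ ey ey′ p p′ q q′} → ex ≡ ex′ → ey ≡ ey′ → p ≡ p′ → q ≡ q′ →
      expression ex ey p q ≡ expression ex′ ey′ p′ q′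
    expression-cong refl refl refl refl = refl

    pointwise : ∀ z → φ (val z) ≡ expression (eq x z) (eq y z) (A x z) (A y z)
    pointwise z = go (z Finₚ.≟ x) (z Finₚ.≟ y)
      where
      atX : ∀ α a b c t → α ≡ ((α - b * t - c * (1ℤ - t)) * (1ℤ * 1ℤ) + (α - b * t - c * (1ℤ - t)) * (0ℤ * 1ℤ))
        + ((a - + 2 * b + c) * (0ℤ * t) + ((b - c) * 0ℤ + ((b - c) * t + c)))
      atX = solve-∀
      atY : ∀ α a b c t → α ≡ ((α - b * t - c * (1ℤ - t)) * (0ℤ * 1ℤ) + (α - b * t - c * (1ℤ - t)) * (1ℤ * 1ℤ))
        + ((a - + 2 * b + c) * (t * 0ℤ) + ((b - c) * t + ((b - c) * 0ℤ + c)))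
      atY = solve-∀
      at₁₁ : ∀ d a b c → a ≡ (d * (0ℤ * 1ℤ) + d * (0ℤ * 1ℤ)) + ((a - + 2 * b + c) * (1ℤ * 1ℤ) + ((b - c) * 1ℤ + ((b - c) * 1ℤ + c)))
      at₁₁ = solve-∀
      at₁₀ : ∀ d a b c → b ≡ (d * (0ℤ * 1ℤ) + d * (0ℤ * 1ℤ)) + ((a - + 2 * b + c) * (1ℤ * 0ℤ) + ((b - c) * 1ℤ + ((b - c) * 0ℤ + c)))
      at₁₀ = solve-∀
      at₀₁ : ∀ d a b c → b ≡ (d * (0ℤ * 1ℤ) + d * (0ℤ * 1ℤ)) + ((a - + 2 * b + c) * (0ℤ * 1ℤ) + ((b - c) * 0ℤ + ((b - c) * 1ℤ + c)))
      at₀₁ = solve-∀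
      at₀₀ : ∀ d a b c → c ≡ (d * (0ℤ * 1ℤ) + d * (0ℤ * 1ℤ)) + ((a - + 2 * b + c) * (0ℤ * 0ℤ) + ((b - c) * 0ℤ + ((b - c) * 0ℤ + c)))
      at₀₀ = solve-∀
      d : ℤ
      d = α - b′ * t - c′ * (1ℤ - t)
      go : Dec (z ≡ x) → Dec (z ≡ y) → φ (val z) ≡ expression (eq x z) (eq y z) (A x z) (A y z)
      go (yes z≡x) _ = trans (trans (cong (φ ∘ val) z≡x) (cong φ val-x)) (trans (atX α a′ b′ c′ t)
        (expression-cong (sym (eq-refl (sym z≡x))) (sym (eq-≢ (λ y≡z → x≢y (sym (trans y≡z z≡x)))))
          (sym (trans (cong (A x) z≡x) (A-irrefl x))) (sym (trans (cong (A y) z≡x) (A-sym y x)))))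
      go (no z≢x) (yes z≡y) = trans (trans (cong (φ ∘ val) z≡y) (cong φ val-y)) (trans (atY α a′ b′ c′ t)
        (expression-cong (sym (eq-≢ (z≢x ∘ sym))) (sym (eq-refl (sym z≡y)))
          (sym (cong (A x) z≡y)) (sym (trans (cong (A y) z≡y) (A-irrefl y)))))
      go (no z≢x) (no z≢y) = trans
        (byClass (λ p q v → φ v ≡ expression 0ℤ 0ℤ p q) z z≢x z≢y (at₁₁ d a′ b′ c′) (at₁₀ d a′ b′ c′) (at₀₁ d a′ b′ c′) (at₀₀ d a′ b′ c′))
        (expression-cong (sym (eq-≢ (z≢x ∘ sym))) (sym (eq-≢ (z≢y ∘ sym))) refl refl)

    total : sum (φ ∘ val) ≡ + 2 * α + a′ * τ + + 2 * (b′ * (k - τ - t)) + c′ * (+ N - + 2 * k + τ - + 2 + + 2 * t)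
    total = trans (sum-cong-≗ pointwise)
      (trans (sum-≡+ (λ z → d * (eq x z * 1ℤ) + d * (eq y z * 1ℤ)) (λ z → e * ω z + ((b′ - c′) * A x z + ((b′ - c′) * A y z + c′)))
        (sum-≡+ (λ z → d * (eq x z * 1ℤ)) (λ z → d * (eq y z * 1ℤ)) (indicator x) (indicator y))
        (sum-≡+ (λ z → e * ω z) (λ z → (b′ - c′) * A x z + ((b′ - c′) * A y z + c′)) (sum-*ˡ e ω)
          (sum-≡+ (λ z → (b′ - c′) * A x z) (λ z → (b′ - c′) * A y z + c′) (row x)
            (sum-≡+ (λ z → (b′ - c′) * A y z) (λ _ → c′) (row y) (sum-const N c′)))))
        (lem α a′ b′ c′ t τ k (+ N)))
      where
      d e : ℤ
      d = α - b′ * t - c′ * (1ℤ - t)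
      e = a′ - + 2 * b′ + c′
      indicator : ∀ u → sum (λ z → d * (eq u z * 1ℤ)) ≡ d * 1ℤ
      indicator u = trans (sum-*ˡ d (λ z → eq u z * 1ℤ)) (cong (d *_) (sum-eq u (λ _ → 1ℤ)))
      row : ∀ u → sum (λ z → (b′ - c′) * A u z) ≡ (b′ - c′) * k
      row u = trans (sum-*ˡ (b′ - c′) (A u)) (cong ((b′ - c′) *_) (row-sum u))
      lem : ∀ α a b c t τ k N → ((α - b * t - c * (1ℤ - t)) * 1ℤ + (α - b * t - c * (1ℤ - t)) * 1ℤ)
        + ((a - + 2 * b + c) * τ + ((b - c) * k + ((b - c) * k + N * c))) ≡
        + 2 * α + a * τ + + 2 * (b * (k - τ - t)) + c * (N - + 2 * k + τ - + 2 + + 2 * t)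
      lem = solve-∀

  -- The weight A x z vanishes at `x`, so only `y` calls for a correction.
  weighted-pointwise : ∀ z → A x z * val z ≡ (τ * t - b * t) * (eq y z * 1ℤ) + ((a - b) * ω z + b * A x z)
  weighted-pointwise z = go (z Finₚ.≟ x) (z Finₚ.≟ y)
    where
    expression : ℤ → ℤ → ℤ → ℤ
    expression ey p q = (τ * t - b * t) * (ey * 1ℤ) + ((a - b) * (p * q) + b * p)
    expression-cong : ∀ {ey ey′ p p′ q q′} → ey ≡ ey′ → p ≡ p′ → q ≡ q′ → expression ey p q ≡ expression ey′ p′ q′
    expression-cong refl refl refl = refl
    atX : ∀ d a b q v → 0ℤ * v ≡ d * (0ℤ * 1ℤ) + ((a - b) * (0ℤ * q) + b * 0ℤ)
    atX = solve-∀
    atY : ∀ τ a b t → t * τ ≡ (τ * t - b * t) * (1ℤ * 1ℤ) + ((a - b) * (t * 0ℤ) + b * t)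
    atY = solve-∀
    at₁₁ : ∀ d a b → 1ℤ * a ≡ d * (0ℤ * 1ℤ) + ((a - b) * (1ℤ * 1ℤ) + b * 1ℤ)
    at₁₁ = solve-∀
    at₁₀ : ∀ d a b → 1ℤ * b ≡ d * (0ℤ * 1ℤ) + ((a - b) * (1ℤ * 0ℤ) + b * 1ℤ)
    at₁₀ = solve-∀
    go : Dec (z ≡ x) → Dec (z ≡ y) → A x z * val z ≡ expression (eq y z) (A x z) (A y z)
    go (yes z≡x) _ = trans (cong (_* val z) Axz) (trans (atX (τ * t - b * t) a b (A y z) (val z))
      (expression-cong (sym (eq-≢ (λ y≡z → x≢y (sym (trans y≡z z≡x))))) (sym Axz) refl))
      where
      Axz : A x z ≡ 0ℤ
      Axz = trans (cong (A x) z≡x) (A-irrefl x)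
    go (no z≢x) (yes z≡y) = trans (cong₂ _*_ (cong (A x) z≡y) (trans (cong val z≡y) val-y)) (trans (atY τ a b t)
      (expression-cong (sym (eq-refl (sym z≡y))) (sym (cong (A x) z≡y)) (sym (trans (cong (A y) z≡y) (A-irrefl y)))))
    go (no z≢x) (no z≢y) = trans
      (byClass (λ p q v → p * v ≡ expression 0ℤ p q) z z≢x z≢y (at₁₁ d a b) (at₁₀ d a b) (atX d a b 1ℤ b) (atX d a b 0ℤ c))
      (expression-cong (sym (eq-≢ (z≢y ∘ sym))) refl refl)
      where
      d : ℤ
      d = τ * t - b * t

  ω-val : ∀ w → ω w * val w ≡ a * ω w
  ω-val w = go (w Finₚ.≟ x) (w Finₚ.≟ y)
    where
    zeroˡ : ∀ {p} q v → p ≡ 0ℤ → p * q * v ≡ a * (p * q)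
    zeroˡ q v refl = trans (*-zeroˡ v) (sym (*-zeroʳ a))
    zeroʳ : ∀ p {q} v → q ≡ 0ℤ → p * q * v ≡ a * (p * q)
    zeroʳ p v refl = trans (cong (_* v) (*-zeroʳ p)) (trans (*-zeroˡ v) (sym (trans (cong (a *_) (*-zeroʳ p)) (*-zeroʳ a))))
    go : Dec (w ≡ x) → Dec (w ≡ y) → ω w * val w ≡ a * ω w
    go (yes refl) _ = zeroˡ (A y w) (val w) (A-irrefl w)
    go (no _) (yes refl) = zeroʳ (A x w) (val w) (A-irrefl w)
    go (no w≢x) (no w≢y) = byClass (λ p q v → p * q * v ≡ a * (p * q)) w w≢x w≢y
      (*-comm 1ℤ a) (zeroʳ 1ℤ b refl) (zeroˡ 1ℤ b refl) (zeroˡ 0ℤ c refl)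

  val-swap : ∀ (f : Fin N → ℤ) → sum (λ z → f z * val z) ≡ sum (λ w → ω w * sum (λ z → f z * A z w))
  val-swap f = trans (sum-cong-≗ (λ z → sym (sum-*ˡ (f z) (λ w → ω w * A z w))))
    (trans (∑-comm (λ z w → f z * (ω w * A z w)))
    (sum-cong-≗ (λ w → trans (sum-cong-≗ (λ z → lem (f z) (ω w) (A z w))) (sum-*ˡ (ω w) (λ z → f z * A z w)))))
    where
    lem : ∀ f o a → f * (o * a) ≡ o * (f * a)
    lem = solve-∀

  sum-val : sum val ≡ k * τ
  sum-val = trans (sum-cong-≗ (λ z → sym (*-identityˡ (val z)))) (trans (val-swap (λ _ → 1ℤ))
    (trans (sum-cong-≗ (λ w → cong (ω w *_) (trans (sum-cong-≗ (λ z → trans (*-identityˡ (A z w)) (A-sym z w))) (row-sum w))))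
    (trans (sum-*ʳ k ω) (*-comm τ k))))

  sum-neighbours : sum (λ z → A x z * val z) ≡ lam * τ
  sum-neighbours = trans (val-swap (A x)) (trans (sum-cong-≗ pw)
    (trans (sum-≡+ (λ w → lam * ω w) (λ w → (k - μ) * (eq x w * ω w)) (sum-*ˡ lam ω) (trans (sum-*ˡ (k - μ) (λ w → eq x w * ω w))
       (cong ((k - μ) *_) (trans (sum-eq x ω) (cong (_* A y x) (A-irrefl x)))))) (lem₂ (lam * τ) (k - μ))))
    where
    lem₂ : ∀ p q → p + q * 0ℤ ≡ p
    lem₂ = solve-∀
    lem : ∀ l m km e p q → p * q * ((l - m) * p + km * e + m) ≡ (l - m) * (p * p * q) + m * (p * q) + km * (e * (p * q))
    lem = solve-∀
    lem₁ : ∀ l m pq r → (l - m) * pq + m * pq + r ≡ l * pq + r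
    lem₁ = solve-∀
    pw : ∀ w → ω w * sum (λ z → A x z * A z w) ≡ lam * ω w + (k - μ) * (eq x w * ω w)
    pw w = trans (cong (ω w *_) (trans (sum-cong-≗ (λ z → cong (A x z *_) (A-sym z w))) (row-product x w)))
      (trans (lem lam μ (k - μ) (eq x w) (A x w) (A y w))
      (trans (cong (λ s → β * (s * A y w) + μ * ω w + (k - μ) * (eq x w * ω w)) (bit-square (A-bit x w)))
             (lem₁ lam μ (ω w) ((k - μ) * (eq x w * ω w)))))

  -- Since `val` is Aω, this sum is ωᵀA²ω, evaluated by the equation for A²; by `ω-val`, ωᵀAω = a τ.
  sum-squares : sum (λ z → val z * val z) ≡ (k - μ) * τ + β * (a * τ) + μ * (τ * τ)
  sum-squares = trans (val-swap val) (trans (sum-cong-≗ pw)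
    (trans (sum-≡+ (λ w → (k - μ) * ω w + β * a * ω w) (λ w → μ * τ * ω w)
        (sum-≡+ (λ w → (k - μ) * ω w) (λ w → β * a * ω w) (sum-*ˡ (k - μ) ω) (sum-*ˡ (β * a) ω)) (sum-*ˡ (μ * τ) ω))
      (lem₂ (k - μ) τ β a μ)))
    where
    lem₂ : ∀ km t b a m → km * t + b * a * t + m * t * t ≡ km * t + b * (a * t) + m * (t * t)
    lem₂ = solve-∀
    inner : ∀ w → sum (λ z → val z * A z w) ≡ β * val w + (k - μ) * ω w + μ * τ
    inner w = trans (sum-cong-≗ (λ z → *-comm (val z) (A z w))) (trans (val-swap (λ z → A z w))
      (trans (sum-cong-≗ (λ v → trans (cong (ω v *_) (column-product w v)) (lem₃ (ω v) β (A w v) (k - μ) (eq w v) μ)))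
      (sum-≡+ (λ v → β * (ω v * A w v) + (k - μ) * (eq w v * ω v)) (λ v → μ * ω v)
        (sum-≡+ (λ v → β * (ω v * A w v)) (λ v → (k - μ) * (eq w v * ω v)) (sum-*ˡ β (λ v → ω v * A w v))
          (trans (sum-*ˡ (k - μ) (λ v → eq w v * ω v)) (cong ((k - μ) *_) (sum-eq w ω)))) (sum-*ˡ μ ω))))
      where
      lem₃ : ∀ o b A km e m → o * (b * A + km * e + m) ≡ b * (o * A) + km * (e * o) + m * o
      lem₃ = solve-∀
    lem : ∀ o b v km m t → o * (b * v + km * o + m * t) ≡ km * (o * o) + b * (o * v) + m * t * o
    lem = solve-∀
    lem₁ : ∀ b a o → b * (a * o) ≡ b * a * o
    lem₁ = solve-∀
    pw : ∀ w → ω w * sum (λ z → val z * A z w) ≡ (k - μ) * ω w + β * a * ω w + μ * τ * ω w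
    pw w = trans (cong (ω w *_) (inner w)) (trans (lem (ω w) β (val w) (k - μ) μ τ)
      (cong₂ (λ o v → (k - μ) * o + v + μ * τ * ω w) (bit-square (ω-bit w)) (trans (cong (β *_) (ω-val w)) (lem₁ β a (ω w)))))

  counts : IsoregularCounts (+ N) k lam μ t τ
  counts = record
    { a = a ; b = b ; c = c
    ; 0≤a = 0≤class-val (+ 2) ; 0≤b = 0≤class-val 1ℤ ; 0≤c = 0≤class-val 0ℤ ; c≤τ = class-val≤τ 0ℤ
    ; neighbours = trans (sym sum-neighbours) (trans (sum-cong-≗ weighted-pointwise)
        (trans (sum-≡+ (λ z → (τ * t - b * t) * (eq y z * 1ℤ)) (λ z → (a - b) * ω z + b * A x z)
           (trans (sum-*ˡ (τ * t - b * t) (λ z → eq y z * 1ℤ)) (cong ((τ * t - b * t) *_) (sum-eq y (λ _ → 1ℤ))))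
           (sum-≡+ (λ z → (a - b) * ω z) (λ z → b * A x z) (sum-*ˡ (a - b) ω) (trans (sum-*ˡ b (A x)) (cong (b *_) (row-sum x)))))
           (lem τ t a b k)))
    ; all-vertices = trans (sym sum-val) (Total.total id)
    ; paths = trans (sym sum-squares) (Total.total (λ v → v * v))
    }
    where
    lem : ∀ τ t a b k → (τ * t - b * t) * 1ℤ + ((a - b) * τ + b * k) ≡ t * τ + a * τ + b * (k - τ - t)
    lem = solve-∀

  adjacent-counts : Adj G x y → IsoregularCounts (+ N) k lam μ 1ℤ lam
  adjacent-counts xy = subst₂ (IsoregularCounts (+ N) k lam μ) (A-adj xy) (adjacent-product xy) counts

  nonadjacent-counts : ¬ Adj G x y → IsoregularCounts (+ N) k lam μ 0ℤ μ
  nonadjacent-counts ¬xy = subst₂ (IsoregularCounts (+ N) k lam μ) (A-nonadj ¬xy) (nonadjacent-product x≢y ¬xy) counts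

-- Orbits of the automorphism, indexed by ℤ

module IntegerPowers {N : ℕ} (π : Permutation′ N) where

  s s⁻¹ : Fin N → Fin N
  s v = π ⟨$⟩ʳ v
  s⁻¹ v = π ⟨$⟩ˡ v

  _^ᶻ_ : Fin N → ℤ → Fin N
  v ^ᶻ (+ i)    = iterate s i v
  v ^ᶻ -[1+ i ] = iterate s⁻¹ (suc i) v

  ^-suc : ∀ v z → v ^ᶻ (z + 1ℤ) ≡ s (v ^ᶻ z)
  ^-suc v (+ i)          = cong (v ^ᶻ_) (+-comm (+ i) 1ℤ)
  ^-suc v -[1+ zero ]    = sym (inverseʳ π)
  ^-suc v -[1+ suc i ]   = sym (inverseʳ π)

  ^-pred : ∀ v z → v ^ᶻ (z - 1ℤ) ≡ s⁻¹ (v ^ᶻ z)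
  ^-pred v z = trans (sym (inverseˡ π)) (cong s⁻¹ (trans (sym (^-suc v (z - 1ℤ))) (cong (v ^ᶻ_) (lem z))))
    where
    lem : ∀ z → z - 1ℤ + 1ℤ ≡ z
    lem = solve-∀

  ^-+ : ∀ v w z → v ^ᶻ (w + z) ≡ (v ^ᶻ w) ^ᶻ z
  ^-+ v w (+ zero)  = cong (v ^ᶻ_) (+-identityʳ w)
  ^-+ v w (+ suc i) = trans (cong (v ^ᶻ_) (lem w (+ i))) (trans (^-suc v (w + + i)) (cong s (^-+ v w (+ i))))
    where
    lem : ∀ w i → w + (1ℤ + i) ≡ (w + i) + 1ℤ
    lem = solve-∀
  ^-+ v w -[1+ zero ]  = ^-pred v w
  ^-+ v w -[1+ suc i ] = trans (cong (v ^ᶻ_) (lem w (+ i))) (trans (^-pred v (w + -[1+ i ])) (cong s⁻¹ (^-+ v w -[1+ i ])))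
    where
    lem : ∀ w i → w + (- (1ℤ + (1ℤ + i))) ≡ (w + (- (1ℤ + i))) - 1ℤ
    lem = solve-∀

  module Invariant (B : Fin N → Fin N → ℤ) (inv : ∀ u v → B (s u) (s v) ≡ B u v) where

    inv⁻¹ : ∀ u v → B (s⁻¹ u) (s⁻¹ v) ≡ B u v
    inv⁻¹ u v = trans (sym (inv (s⁻¹ u) (s⁻¹ v))) (cong₂ B (inverseʳ π) (inverseʳ π))

    invᶻ : ∀ u v z → B (u ^ᶻ z) (v ^ᶻ z) ≡ B u v
    invᶻ u v (+ zero)  = refl
    invᶻ u v (+ suc i) = trans (inv (u ^ᶻ (+ i)) (v ^ᶻ (+ i))) (invᶻ u v (+ i))
    invᶻ u v -[1+ zero ]  = inv⁻¹ u v
    invᶻ u v -[1+ suc i ] = trans (inv⁻¹ (u ^ᶻ -[1+ i ]) (v ^ᶻ -[1+ i ])) (invᶻ u v -[1+ i ])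

    -- An invariant matrix depends on positions in the orbits only through their difference; this is
    -- what turns rows of A² into convolutions.
    difference : ∀ u v i j → B (u ^ᶻ i) (v ^ᶻ j) ≡ B u (v ^ᶻ (j - i))
    difference u v i j = trans (cong (B (u ^ᶻ i)) (trans (cong (v ^ᶻ_) (lem i j)) (^-+ v (j - i) i))) (invᶻ u (v ^ᶻ (j - i)) i)
      where
      lem : ∀ i j → j ≡ (j - i) + i
      lem = solve-∀

  module Periodicᶻ {n : ℕ} (period : ∀ v → iterate s n v ≡ v) where

    ^-periodic : ∀ (f : Fin N → ℤ) v → Periodic n (λ z → f (v ^ᶻ z))
    ^-periodic f v z = cong f (trans (cong (v ^ᶻ_) (+-comm z (+ n))) (trans (^-+ v (+ n) z) (cong (_^ᶻ z) (period v))))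

    ^-residue : .{{_ : ℕ.NonZero n}} → ∀ v z → v ^ᶻ z ≡ iterate s (z %ℕ n) v
    -- Periodicity is stated for integer-valued functions, so equality of the two vertices is tested
    -- through `eq`.
    ^-residue v z with (v ^ᶻ z) Finₚ.≟ iterate s (z %ℕ n) v
    ... | yes e = e
    ... | no ≢ = contradiction (trans (sym (eq-≢ (≢ ∘ sym))) (trans (periodic-≡ (^-periodic (eq (iterate s (z %ℕ n) v)) v) {z} {+ (z %ℕ n)}
          (divides (z /ℕ n) (lin₁ 1ℤ (a≡a%ℕn+[a/ℕn]*n z n) (lem z (+ (z %ℕ n)) (z /ℕ n * + n))))) (eq-refl {u = iterate s (z %ℕ n) v} refl))) λ ()
      where
      lem : ∀ z r d → z - r - d ≡ 1ℤ * (z - (r + d))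
      lem = solve-∀

-- Connection sets of a bicirculant and the conclusion

module Bicirculant (n : ℕ) (0<n : 0 ℕ.< n) (2∤n : ¬ 2 ℕ∣.∣ n) (G : Graph (n ℕ.+ n)) (nt : NonTrivial G)
  {k′ λ′ μ′ : ℕ} (srg : IsSRG G k′ λ′ μ′) (π : Permutation′ (n ℕ.+ n)) (aut : IsAutomorphism G π)
  (period : ∀ v → iterate (π ⟨$⟩ʳ_) n v ≡ v)
  (free : ∀ v i → 0 ℕ.< i → i ℕ.< n → iterate (π ⟨$⟩ʳ_) i v ≢ v)
  (a b : Fin (n ℕ.+ n)) (disjoint : ∀ i → iterate (π ⟨$⟩ʳ_) i a ≢ b)
  (cover : ∀ v → Σ ℕ λ i → i ℕ.< n × (v ≡ iterate (π ⟨$⟩ʳ_) i a ⊎ v ≡ iterate (π ⟨$⟩ʳ_) i b)) where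

  open IntegerPowers π
  open Periodicᶻ {n} period
  open Matrix G
  open StronglyRegularMatrix G srg
  open Nontrivial nt (disjoint 0) using (μ≢0; k≢μ; lam≢k-1)

  private
    instance
      n-nonZero : ℕ.NonZero n
      n-nonZero = ℕ.>-nonZero 0<n

  A-inv : ∀ u v → A (s u) (s v) ≡ A u v
  A-inv u v = cong bit (aut u v)

  eq-inv : ∀ u v → eq (s u) (s v) ≡ eq u v
  eq-inv u v with u Finₚ.≟ v
  ... | yes e = eq-refl (cong s e)
  ... | no ¬e = eq-≢ (λ e → ¬e (trans (sym (inverseˡ π)) (trans (cong s⁻¹ e) (inverseˡ π))))

  open Invariant A A-inv using () renaming (difference to A-difference)
  open Invariant eq eq-inv using () renaming (difference to eq-difference)

  eq-orbit : ∀ u z → eq u (u ^ᶻ z) ≡ δ n z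
  eq-orbit u z with + n ∣? z
  ... | yes d = trans (trans (periodic-≡ (^-periodic (eq u) u) {z} {0ℤ} (subst (+ n ∣_) (sym (+-identityʳ z)) d)) (eq-refl {u = u} refl)) (sym (⟦⟧-yes d))
  ... | no ¬d = trans (eq-≢ (λ e → free u (z %ℕ n) 0<r (n%ℕd<d z n) (sym (trans e (^-residue u z))))) (sym (⟦⟧-no ¬d))
    where
    0<r : 0 ℕ.< z %ℕ n
    0<r = ℕₚ.n≢0⇒n>0 (λ r≡0 → ¬d (divides (z /ℕ n) (trans (a≡a%ℕn+[a/ℕn]*n z n) (trans (cong (λ r → + r + z /ℕ n * + n) r≡0) (+-identityˡ _)))))

  b-notin-orbit : ∀ z → a ^ᶻ z ≢ b
  b-notin-orbit z e = disjoint (z %ℕ n) (trans (sym (^-residue a z)) e)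

  eq-ab : ∀ z → eq a (b ^ᶻ z) ≡ 0ℤ
  eq-ab z = eq-≢ (λ e → b-notin-orbit (- z) (trans (cong (_^ᶻ (- z)) e)
    (trans (sym (^-+ b z (- z))) (cong (b ^ᶻ_) (+-inverseʳ z)))))

  eq-ba : ∀ z → eq b (a ^ᶻ z) ≡ 0ℤ
  eq-ba z = eq-≢ (λ e → b-notin-orbit z (sym e))

  -- Multiplied by `f v` and summed, this splits a sum over the vertices into two sums over ℤ/n. The
  -- cycles reach `v` at least once by `cover`; freeness and disjointness, through the `eq` lemmas,
  -- prevent a second time.
  covered-once : ∀ v → ∑ n (λ i → eq v (a ^ᶻ i)) + ∑ n (λ i → eq v (b ^ᶻ i)) ≡ 1ℤ
  covered-once v with cover v
  ... | j , _ , inj₁ refl = cong₂ _+_ (trans (∑-cong n (λ i → trans (eq-difference a a (+ j) i) (eq-orbit a (i - + j)))) (trans (∑-shift n (δ-periodic n) (- + j)) (∑-δ n 0<n)))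
        (trans (∑-cong n (λ i → trans (eq-difference a b (+ j) i) (eq-ab (i - + j)))) (trans (∑-const n 0ℤ) (*-zeroʳ (+ n))))
  ... | j , _ , inj₂ refl = cong₂ _+_ (trans (∑-cong n (λ i → trans (eq-difference b a (+ j) i) (eq-ba (i - + j)))) (trans (∑-const n 0ℤ) (*-zeroʳ (+ n))))
        (trans (∑-cong n (λ i → trans (eq-difference b b (+ j) i) (eq-orbit b (i - + j)))) (trans (∑-shift n (δ-periodic n) (- + j)) (∑-δ n 0<n)))

  sum-orbits : ∀ f → sum f ≡ ∑ n (λ i → f (a ^ᶻ i)) + ∑ n (λ i → f (b ^ᶻ i))
  sum-orbits f = trans (sum-cong-≗ (λ v → trans (sym (*-identityˡ (f v))) (trans (cong (_* f v) (sym (covered-once v)))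
      (*-distribʳ-+ (f v) (∑ n (λ i → eq v (a ^ᶻ i))) (∑ n (λ i → eq v (b ^ᶻ i)))))))
    (sum-≡+ (λ v → ∑ n (λ i → eq v (a ^ᶻ i)) * f v) (λ v → ∑ n (λ i → eq v (b ^ᶻ i)) * f v) (orbit a) (orbit b))
    where
    orbit : ∀ u → sum (λ v → ∑ n (λ i → eq v (u ^ᶻ i)) * f v) ≡ ∑ n (λ i → f (u ^ᶻ i))
    orbit u = trans (sum-cong-≗ (λ v → sym (∑-*ʳ n (f v) (λ i → eq v (u ^ᶻ i)))))
      (trans (sum-∑ n (λ v i → eq v (u ^ᶻ i) * f v))
      (∑-cong n (λ i → trans (sum-cong-≗ (λ v → cong (_* f v) (eq-sym v (u ^ᶻ i)))) (sum-eq (u ^ᶻ i) f))))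

  S T R : ℤ → ℤ
  S z = A a (a ^ᶻ z)
  T z = A b (b ^ᶻ z)
  R z = A a (b ^ᶻ z)

  even : ∀ u z → A u (u ^ᶻ (- z)) ≡ A u (u ^ᶻ z)
  even u z = trans (cong (λ w → A u (u ^ᶻ w)) (sym (+-identityˡ (- z)))) (trans (sym (A-difference u u z 0ℤ)) (A-sym (u ^ᶻ z) u))

  even′ : ∀ u x i → A u (u ^ᶻ (i - x)) ≡ A u (u ^ᶻ (x - i))
  even′ u x i = trans (cong (λ w → A u (u ^ᶻ w)) (lem x i)) (even u (x - i))
    where
    lem : ∀ x i → i - x ≡ - (x - i)
    lem = solve-∀

  A-ba : ∀ z → A b (a ^ᶻ z) ≡ R (- z)
  A-ba z = trans (A-sym b (a ^ᶻ z)) (trans (A-difference a b z 0ℤ) (cong R (+-identityˡ (- z))))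

  zero-at-multiples : ∀ u z → + n ∣ z → A u (u ^ᶻ z) ≡ 0ℤ
  zero-at-multiples u z d = trans (periodic-≡ (^-periodic (A u) u) {z} {0ℤ} (subst (+ n ∣_) (sym (+-identityʳ z)) d)) (A-irrefl u)

  -- The equation for A² at the entries (a, a^x), (b, b^x) and (a, b^x); symmetry of A lets the
  -- reflected arguments of a convolution appear.
  bicirculantSRG : BicirculantSRG n S T R k lam μ
  bicirculantSRG = record
    { 0<n = 0<n ; 2∤n = 2∤n
    ; perS = perS ; perT = perT ; perR = perR
    ; bitS = λ z → A-bit a (a ^ᶻ z) ; bitT = λ z → A-bit b (b ^ᶻ z) ; bitR = λ z → A-bit a (b ^ᶻ z)
    ; evenS = even a ; evenT = even b
    ; zeroS = zero-at-multiples a ; zeroT = zero-at-multiples b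
    ; degreeS = trans (sym (sum-orbits (A a))) (row-sum a)
    ; degreeT = trans (+-comm (∑ n T) (∑ n R)) (trans (cong (_+ ∑ n T) (sym (trans (∑-cong n A-ba) (∑-neg n perR)))) (trans (sym (sum-orbits (A b))) (row-sum b)))
    ; squareS = λ x → trans (cong₂ _+_
          (trans (conv-def n S S x) (∑-cong n (λ i → cong (S i *_) (sym (trans (A-difference a a x i) (even′ a x i))))))
          (trans (conv-def n R (λ i → R (- i)) x) (∑-cong n (λ i → cong (R i *_) (sym (trans (A-difference a b x i) (cong R (lem i x))))))))
        (trans (sym (sum-orbits (λ w → A a w * A (a ^ᶻ x) w))) (trans (row-product a (a ^ᶻ x))
          (cong (λ e → β * S x + (k - μ) * e + μ) (eq-orbit a x))))
    -- The row of `b` produces the reflected R as first factor; commutativity restores the order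
    -- used in `BicirculantSRG`.
    ; squareT = λ x → trans (cong (λ z → conv n T T x + z) (conv-comm n perR (λ i → trans (cong R (lem₁ i (+ n))) (per⁻ i)) x)) (trans (cong₂ _+_
          (trans (conv-def n T T x) (∑-cong n (λ i → cong (T i *_) (sym (trans (A-difference b b x i) (even′ b x i))))))
          (trans (conv-def n (λ i → R (- i)) R x) (∑-cong n (λ i → cong₂ _*_ (sym (A-ba i)) (sym (trans (A-sym (b ^ᶻ x) (a ^ᶻ i)) (A-difference a b i x)))))))
        (trans (+-comm (∑ n (λ i → A b (b ^ᶻ i) * A (b ^ᶻ x) (b ^ᶻ i))) _) (trans (sym (sum-orbits (λ w → A b w * A (b ^ᶻ x) w))) (trans (row-product b (b ^ᶻ x))
          (cong (λ e → β * T x + (k - μ) * e + μ) (eq-orbit b x))))))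
    ; mixed = λ x → trans (cong₂ _+_
          (trans (conv-def n S R x) (∑-cong n (λ i → cong (S i *_) (sym (trans (A-sym (b ^ᶻ x) (a ^ᶻ i)) (A-difference a b i x))))))
          (trans (conv-def n R T x) (∑-cong n (λ i → cong (R i *_) (sym (trans (A-difference b b x i) (even′ b x i)))))))
        (trans (sym (sum-orbits (λ w → A a w * A (b ^ᶻ x) w))) (trans (row-product a (b ^ᶻ x))
          (trans (cong (λ e → β * R x + (k - μ) * e + μ) (eq-ab x)) (lem₂ (β * R x) (k - μ) μ))))
    ; μ≢0 = μ≢0 ; k≢μ = k≢μ ; lam≢k-1 = lam≢k-1
    }
    where
    perS : Periodic n S
    perS = ^-periodic (A a) a
    perT : Periodic n T
    perT = ^-periodic (A b) b
    perR : Periodic n R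
    perR = ^-periodic (A a) b
    lem : ∀ i x → i - x ≡ - (x - i)
    lem = solve-∀
    lem₁ : ∀ i n → - (i + n) ≡ - i + (- 1ℤ) * n
    lem₁ = solve-∀
    per⁻ : ∀ i → R (- i + (- 1ℤ) * + n) ≡ R (- i)
    per⁻ i = periodic-multiple perR (- 1ℤ) (- i)
    lem₂ : ∀ p q m → p + q * 0ℤ + m ≡ p + m
    lem₂ = solve-∀

  no-local-isoregularity : ∀ x → ¬ LocallyThreeIsoregular G x
  no-local-isoregularity x (y , z , xy , z≢x , ¬xz , iso-xy , iso-xz) =
    exceptional-absurd (classification bicirculantSRG) μ≢0 k≢μ
      (subst (λ N → IsoregularCounts N k lam μ 1ℤ lam) N≡2n (IsoregularPair.adjacent-counts G srg iso-xy xy))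
      (subst (λ N → IsoregularCounts N k lam μ 0ℤ μ) N≡2n (IsoregularPair.nonadjacent-counts G srg iso-xz ¬xz))
    where
    lem : ∀ n → n + n ≡ + 2 * n
    lem = solve-∀
    N≡2n : + (n ℕ.+ n) ≡ + 2 * + n
    N≡2n = trans (pos-+ n n) (lem (+ n))

theorem4p3 : (n : ℕ) → Σ ℕ (λ m → n ≡ 2 ℕ.* m ℕ.+ 1) →
    (G : Graph (n ℕ.+ n)) → NonTrivial G → StronglyRegular G →
    IsBicirculant n G →
    (x : Fin (n ℕ.+ n)) → ¬ LocallyThreeIsoregular G x
theorem4p3 n (m , n≡2m+1) G nt (k , l , μ , srg) (π , aut , period , free , a , b , disjoint , cover) =
  Bicirculant.no-local-isoregularity n 0<n 2∤n G nt srg π aut period free a b disjoint cover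
  where
  0<n : 0 ℕ.< n
  0<n = subst (0 ℕ.<_) (sym (trans n≡2m+1 (ℕₚ.+-comm (2 ℕ.* m) 1))) (ℕ.s≤s ℕ.z≤n)
  2∤n : ¬ 2 ℕ∣.∣ n
  2∤n d = ℕ∣.>⇒∤ (ℕₚ.n<1+n 1) (ℕ∣.∣m+n∣m⇒∣n (subst (2 ℕ∣.∣_) n≡2m+1 d) (ℕ∣.m∣m*n m))
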